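{- Let $G$ be a connected $K_{1,5}$-free graph with $n$ vertices. If $\sigma_5(G)\geq n-1$, then $G$ contains a spanning tree with at most $4$ leaves.
   Context: All graphs are finite and simple. For a vertex $v$, $d(v)$ is its degree in $G$. A set of vertices is independent if no two of its vertices are adjacent. For $k\geq 1$, $\sigma_k(G)=\min\{\sum_{i=1}^k d(v_i) : \{v_1,\ldots,v_k\}$ is an independent set of $k$ vertices in $G\}$. A graph is $K_{1,r}$-free if it does not contain $K_{1,r}$ as an induced subgraph. A leaf of a tree is a vertex of degree one in the tree. -}

module Defs where

open import Data.Nat using (ℕ; zero; suc; _+_; _≤_)
open import Data.Bool using (Bool; true; false; if_then_else_)
open import Data.Fin using (Fin; zero; suc; inject₁; fromℕ)
open import Data.List using (List; map; length; filter)
open import Data.Nat.ListAction using (sum)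
open import Data.List.Base using (allFin)
open import Data.Product using (_×_; Σ)
open import Relation.Binary.PropositionalEquality using (_≡_; _≢_)
open import Relation.Nullary using (¬_)
open import Function.Definitions using (Injective)

record Graph (n : ℕ) : Set where
  field
    adj   : Fin n → Fin n → Bool
    sym   : ∀ u v → adj u v ≡ adj v u
    irrefl : ∀ v → adj v v ≡ false
open Graph public

_∼[_]_ : ∀ {n} → Fin n → Graph n → Fin n → Set
u ∼[ G ] v = adj G u v ≡ true

count : ∀ {n} → (Fin n → Bool) → ℕ
count {n} p = sum (map (λ u → if p u then 1 else 0) (allFin n))

deg : ∀ {n} → Graph n → Fin n → ℕ
deg G v = count (adj G v)

data Walk {n} (G : Graph n) : Fin n → Fin n → Set where
  here : ∀ {u} → Walk G u u
  step : ∀ {u w v} → u ∼[ G ] w → Walk G w v → Walk G u v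

Connected : ∀ {n} → Graph n → Set
Connected {n} G = ∀ (u v : Fin n) → Walk G u v

IndependentFamily : ∀ {n k} → Graph n → (Fin k → Fin n) → Set
IndependentFamily {n} {k} G f =
  Injective _≡_ _≡_ f × (∀ (i j : Fin k) → ¬ (f i ∼[ G ] f j))

-- "σ_k(G) ≥ m": every independent set of k vertices has degree sum ≥ m
-- (vacuous if G has no independent set of k vertices, matching σ_k = ∞).
σ≥ : ∀ {n} → Graph n → (k m : ℕ) → Set
σ≥ {n} G k m = ∀ (f : Fin k → Fin n) → IndependentFamily G f →
  m ≤ sum (map (λ i → deg G (f i)) (allFin k))

HasInducedStar : ∀ {n} → Graph n → ℕ → Set
HasInducedStar {n} G r = Σ (Fin n) λ c → Σ (Fin r → Fin n) λ f →
  IndependentFamily G f × (∀ i → c ∼[ G ] f i)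

K1r-free : ∀ {n} → Graph n → ℕ → Set
K1r-free G r = ¬ HasInducedStar G r

HasCycle : ∀ {n} → Graph n → Set
HasCycle {n} G = Σ ℕ λ k → Σ (Fin (suc (suc (suc k))) → Fin n) λ c →
  Injective _≡_ _≡_ c ×
  ((∀ (i : Fin (suc (suc k))) → c (inject₁ i) ∼[ G ] c (suc i)) ×
   (c (fromℕ (suc (suc k))) ∼[ G ] c zero))

IsTree : ∀ {n} → Graph n → Set
IsTree G = Connected G × ¬ HasCycle G

_⊆G_ : ∀ {n} → Graph n → Graph n → Set
_⊆G_ {n} T G = ∀ (u v : Fin n) → u ∼[ T ] v → u ∼[ G ] v

IsSpanningTree : ∀ {n} → Graph n → Graph n → Set
IsSpanningTree T G = (T ⊆G G) × IsTree T

leaves : ∀ {n} → Graph n → ℕ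
leaves G = count (λ v → isOne (deg G v))
  where
  isOne : ℕ → Bool
  isOne (suc zero) = true
  isOne _ = false

module Submission where

-- A tree with at most k leaves is a spine with k legs. Suppose that no spanning tree has at most four
-- leaves. A tree with at most four leaves then misses a vertex, and by connectivity it grows to a larger one,
-- or to a larger one with five leaves. So it suffices to exclude a five-leaf tree T with the most vertices
-- and, among these, the shortest spine, such that no tree with as many vertices has at most four leaves.
-- Exchanging edges of T shows that its leaves are independent and have all their neighbours in T, so they
-- contradict the hypothesis on σ₅ once their degree sum is seen to be at most |T| − 2. Counted leg by leg, a leg
-- together with the spine vertex it hangs from exceeds its length by at most one, and then there are
-- enough exchanges, or independent neighbours of that spine vertex, to make up for it elsewhere.

open import Defs
open import Algebra.Properties.CommutativeMonoid.Sum as MonoidSum using ()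
open import Data.Bool using (Bool; true; false; if_then_else_)
open import Data.Bool.Properties using () renaming (_≟_ to _≟ᵇ_)
open import Data.Empty using (⊥; ⊥-elim)
open import Data.Fin using (Fin; zero; suc; punchIn; punchOut; inject₁; fromℕ; toℕ)
open import Data.Fin.Patterns using (0F; 1F; 2F; 3F; 4F)
open import Data.Fin.Properties using (_≟_; punchInᵢ≢i; punchIn-injective; punchIn-punchOut; any?; all?; pigeonhole; <⇒≢; ¬∀⟶∃¬; toℕ-inject₁)
open import Data.Fin.Relation.Unary.Top using (view; ‵fromℕ; ‵inject₁)
open import Data.List using (List; []; _∷_; _++_; length; reverse; lookup; map; allFin; tabulate)
open import Data.List.Membership.Propositional using (_∈_; find)
open import Data.List.Membership.Propositional.Properties using (∈-lookup)
open import Data.List.Properties using (++-assoc; unfold-reverse; reverse-++; reverse-involutive; length-++; length-reverse; length-map; map-tabulate; ∷-injectiveˡ; ∷-injectiveʳ; ∷ʳ-injectiveʳ)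
open import Data.List.Relation.Unary.All as All using (All; []; _∷_)
open import Data.List.Relation.Unary.AllPairs using (AllPairs; []; _∷_)
open import Data.List.Relation.Unary.Any as Any using () renaming (here to hd; there to tl)
open import Data.Nat using (ℕ; zero; suc; _+_; _*_; _∸_; _≤_; _<_; _≤?_; z≤n; s≤s)
open import Data.Nat.ListAction using (sum)
open import Data.Nat.Properties hiding (_≟_; <⇒≢)
open import Data.Nat.Solver using (module +-*-Solver)
open import Data.Product using (Σ; _×_; _,_; proj₁; proj₂)
open import Data.Product.Properties using (≡-dec)
open import Data.Sum using (_⊎_; inj₁; inj₂) renaming (map to map⊎)
open import Data.Unit using (⊤; tt)
open import Function using (_∘_)
open import Function.Bundles using (mk⇔)
open import Relation.Binary.PropositionalEquality using (_≡_; _≢_; refl; cong; cong₂; subst; subst₂; trans) renaming (sym to ≡-sym)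
open import Relation.Nullary using (¬_; Dec; yes; no; does; ¬?)
open import Relation.Nullary.Decidable using (_×-dec_; _⊎-dec_; dec-true; dec-false; does-⇔)
import Data.List.Membership.DecPropositional as DecMembership
open MonoidSum +-0-commutativeMonoid using (sum-remove; ∑-distrib-+; ∑-comm; sum-cong-≗) renaming (sum to ∑)
open +-*-Solver using (solve; _:+_; _:=_; con)

-- On a shortest spine each end carries at least two legs, because a single leg there could take
-- over the end vertex. Hence five legs can hang in only three patterns: all from one vertex, three
-- and two from the ends, or two, one and two. The same fact explains why exchanges are so strong:
-- any one leg may be emptied or rehung while both ends stay covered, so an emptied leg can be
-- deleted, and four legs then carry the same vertices. The two vertices that the degree sum must
-- leave over are normally found on the spine: a leaf never sees the spine neighbours of the vertex
-- it hangs from, and it sees no other spine vertex at all if that vertex is an end with only two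
-- legs. A spine of one vertex has no such reserve; there K₁,₅-freeness provides legs that stay
-- below their length. The argument refutes and constructs nothing. The tree itself comes from a
-- finite search through edge lists, which is decidable; the extremal choices become inductions,
-- downward on the size and upward on the spine length.

-- Finite sums and changes at one index.

∑-mono : ∀ {k} {f g : Fin k → ℕ} → (∀ i → f i ≤ g i) → ∑ f ≤ ∑ g
∑-mono {zero}  h = z≤n
∑-mono {suc k} h = +-mono-≤ (h zero) (∑-mono (h ∘ suc))

∑-zero : ∀ {k} {f : Fin k → ℕ} → (∀ i → f i ≡ 0) → ∑ f ≡ 0
∑-zero {zero}  h = refl
∑-zero {suc k} h = cong₂ _+_ (h zero) (∑-zero (h ∘ suc))

∑-const-1 : ∀ k → ∑ {k} (λ _ → 1) ≡ k
∑-const-1 zero    = refl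
∑-const-1 (suc k) = cong suc (∑-const-1 k)

≤-∑ : ∀ {k} (f : Fin k → ℕ) i → f i ≤ ∑ f
≤-∑ {suc k} f i = subst (f i ≤_) (≡-sym (sum-remove {i = i} f)) (m≤m+n _ _)

pair≤∑ : ∀ {k} (f : Fin k → ℕ) {i j} → i ≢ j → f i + f j ≤ ∑ f
pair≤∑ {suc k} f {i} {j} i≢j =
  subst (f i + f j ≤_) (≡-sym (sum-remove {i = i} f))
    (+-monoʳ-≤ (f i) (subst (λ x → f x ≤ _) (punchIn-punchOut i≢j) (≤-∑ (f ∘ punchIn i) (punchOut i≢j))))

∑-positive : ∀ {k} (f : Fin k → ℕ) → 1 ≤ ∑ f → Σ (Fin k) λ i → 1 ≤ f i
∑-positive {suc k} f p with f zero in eq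
... | suc m = zero , subst (1 ≤_) (≡-sym eq) (s≤s z≤n)
... | zero with ∑-positive (f ∘ suc) p
... | i , q = suc i , q

upd : ∀ {k} {A : Set} → Fin k → A → (Fin k → A) → Fin k → A
upd zero    a f zero    = a
upd zero    a f (suc j) = f (suc j)
upd (suc i) a f zero    = f zero
upd (suc i) a f (suc j) = upd i a (f ∘ suc) j

upd-same : ∀ {k} {A : Set} i {a : A} {f : Fin k → A} → upd i a f i ≡ a
upd-same zero    = refl
upd-same (suc i) = upd-same i

upd-other : ∀ {k} {A : Set} i {j} {a : A} {f : Fin k → A} → j ≢ i → upd i a f j ≡ f j
upd-other zero    {zero}  j≢i = ⊥-elim (j≢i refl)
upd-other zero    {suc j} j≢i = refl
upd-other (suc i) {zero}  j≢i = refl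
upd-other (suc i) {suc j} j≢i = upd-other i (j≢i ∘ cong suc)

-- Subtraction is avoided by keeping the old value on the left; the effect of an exchange on a sum
-- then follows by cancellation.
∑-upd : ∀ {k} {A : Set} (w : A → ℕ) i {a : A} (f : Fin k → A) →
        ∑ (w ∘ upd i a f) + w (f i) ≡ ∑ (w ∘ f) + w a
∑-upd {suc k} w zero {a} f =
  solve 3 (λ x s y → (x :+ s) :+ y := (y :+ s) :+ x) refl (w a) (∑ (w ∘ f ∘ suc)) (w (f zero))
∑-upd {suc k} w (suc i) {a} f =
  trans (+-assoc (w (f zero)) _ _)
    (trans (cong (w (f zero) +_) (∑-upd w i (f ∘ suc))) (≡-sym (+-assoc (w (f zero)) _ _)))

-- Weighted sums over lists.

W : {X : Set} → (X → ℕ) → List X → ℕ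
W w []       = 0
W w (x ∷ xs) = w x + W w xs

module _ {X : Set} where

  W-++ : ∀ (w : X → ℕ) xs {ys} → W w (xs ++ ys) ≡ W w xs + W w ys
  W-++ w []       = refl
  W-++ w (x ∷ xs) = trans (cong (w x +_) (W-++ w xs)) (≡-sym (+-assoc (w x) _ _))

  W-snoc : ∀ (w : X → ℕ) xs {x} → W w (xs ++ x ∷ []) ≡ W w xs + w x
  W-snoc w xs {x} = trans (W-++ w xs) (cong (W w xs +_) (+-identityʳ (w x)))

  W-reverse : ∀ (w : X → ℕ) xs → W w (reverse xs) ≡ W w xs
  W-reverse w []       = refl
  W-reverse w (x ∷ xs) =
    trans (cong (W w) (unfold-reverse x xs))
      (trans (W-snoc w (reverse xs)) (trans (cong (_+ w x) (W-reverse w xs)) (+-comm _ (w x))))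

  W-one : ∀ (xs : List X) → W (λ _ → 1) xs ≡ length xs
  W-one []       = refl
  W-one (x ∷ xs) = cong suc (W-one xs)

  W-mono : ∀ {v w : X → ℕ} xs → (∀ {x} → x ∈ xs → v x ≤ w x) → W v xs ≤ W w xs
  W-mono []       h = z≤n
  W-mono (x ∷ xs) h = +-mono-≤ (h (hd refl)) (W-mono xs (h ∘ tl))

  W-cong : ∀ {v w : X → ℕ} → (∀ x → v x ≡ w x) → ∀ xs → W v xs ≡ W w xs
  W-cong h []       = refl
  W-cong h (x ∷ xs) = cong₂ _+_ (h x) (W-cong h xs)

  W-∑ : ∀ {k} (w : Fin k → X → ℕ) xs → W (λ x → ∑ (λ i → w i x)) xs ≡ ∑ (λ i → W (w i) xs)
  W-∑ w []       = ≡-sym (∑-zero {f = λ i → W (w i) []} (λ _ → refl))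
  W-∑ w (x ∷ xs) = trans (cong (∑ (λ i → w i x) +_) (W-∑ w xs))
    (≡-sym (∑-distrib-+ (λ i → w i x) (λ i → W (w i) xs)))

  W-≤-length : ∀ {w : X → ℕ} xs → (∀ {x} → x ∈ xs → w x ≤ 1) → W w xs ≤ length xs
  W-≤-length {w} xs h = subst (W w xs ≤_) (W-one xs) (W-mono xs h)

  split-∈ : ∀ {x : X} {xs} → x ∈ xs → Σ (List X) λ A → Σ (List X) λ B → xs ≡ A ++ x ∷ B
  split-∈ {xs = y ∷ ys} (hd refl) = [] , ys , refl
  split-∈ {xs = y ∷ ys} (tl p) with split-∈ p
  ... | A , B , refl = y ∷ A , B , refl

  ∈-mid : ∀ A {x : X} {B} → x ∈ A ++ x ∷ B
  ∈-mid []      = hd refl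
  ∈-mid (_ ∷ A) = tl (∈-mid A)

  ∈-right : ∀ A {x : X} {B} → x ∈ B → x ∈ A ++ B
  ∈-right []      p = p
  ∈-right (_ ∷ A) p = tl (∈-right A p)

  ∈-left : ∀ {A} {x : X} {B} → x ∈ A → x ∈ A ++ B
  ∈-left (hd p) = hd p
  ∈-left (tl p) = tl (∈-left p)

  ∈-++⁻ : ∀ A {x : X} {B} → x ∈ A ++ B → x ∈ A ⊎ x ∈ B
  ∈-++⁻ []      p      = inj₂ p
  ∈-++⁻ (_ ∷ A) (hd p) = inj₁ (hd p)
  ∈-++⁻ (_ ∷ A) (tl p) with ∈-++⁻ A p
  ... | inj₁ q = inj₁ (tl q)
  ... | inj₂ q = inj₂ q

  ∈-reverse : ∀ {x : X} {xs} → x ∈ xs → x ∈ reverse xs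
  ∈-reverse {x} p with split-∈ p
  ... | A , B , refl = subst (x ∈_) (≡-sym (trans (reverse-++ A (x ∷ B))
          (trans (cong (_++ reverse A) (unfold-reverse x B)) (++-assoc (reverse B) _ _)))) (∈-mid (reverse B))

  unsnoc : ∀ (xs : List X) → xs ≡ [] ⊎ Σ (List X) λ A → Σ X λ x → xs ≡ A ++ x ∷ []
  unsnoc []       = inj₁ refl
  unsnoc (x ∷ xs) with unsnoc xs
  ... | inj₁ refl           = inj₂ ([] , x , refl)
  ... | inj₂ (A , y , refl) = inj₂ (x ∷ A , y , refl)

  uncons : ∀ (xs : List X) → (xs ≡ [] → ⊥) → Σ X λ x → Σ (List X) λ A → xs ≡ x ∷ A
  uncons []       h = ⊥-elim (h refl)
  uncons (x ∷ xs) h = x , xs , refl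

  reverse-mid : ∀ A {x y : X} {B} → reverse (A ++ x ∷ y ∷ B) ≡ reverse B ++ y ∷ x ∷ reverse A
  reverse-mid A {x} {y} {B} =
    trans (reverse-++ A (x ∷ y ∷ B))
      (trans (cong (_++ reverse A) (trans (unfold-reverse x (y ∷ B)) (cong (_++ x ∷ []) (unfold-reverse y B))))
        (trans (++-assoc (reverse B ++ y ∷ []) (x ∷ []) (reverse A)) (++-assoc (reverse B) (y ∷ []) (x ∷ reverse A))))

  reverse-snoc : ∀ A {x : X} → reverse (A ++ x ∷ []) ≡ x ∷ reverse A
  reverse-snoc A {x} = reverse-++ A (x ∷ [])

-- Multiplicities of vertices in lists, and sums of bits.

δ : ∀ {n} → Fin n → Fin n → ℕ
δ v x = if does (v ≟ x) then 1 else 0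

δ-same : ∀ {n} (v : Fin n) → δ v v ≡ 1
δ-same v with v ≟ v
... | yes _  = refl
... | no v≢v = ⊥-elim (v≢v refl)

mult : ∀ {n} → Fin n → List (Fin n) → ℕ
mult v = W (δ v)

∈⇒mult : ∀ {n} {v : Fin n} {xs} → v ∈ xs → 1 ≤ mult v xs
∈⇒mult {v = v} {x ∷ xs} (hd refl) = ≤-trans (≤-reflexive (≡-sym (δ-same v))) (m≤m+n _ _)
∈⇒mult {v = v} {x ∷ xs} (tl p)    = ≤-trans (∈⇒mult p) (m≤n+m _ _)

mult⇒∈ : ∀ {n} {v : Fin n} xs → 1 ≤ mult v xs → v ∈ xs
mult⇒∈ {v = v} (x ∷ xs) p with v ≟ x
... | yes refl = hd refl
... | no _     = tl (mult⇒∈ xs p)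

∑-δ : ∀ {n} (f : Fin n → ℕ) x → ∑ (λ v → δ v x * f v) ≡ f x
∑-δ {suc n} f zero = trans (cong₂ _+_ (+-identityʳ (f zero)) (∑-zero {f = λ v → δ (suc v) zero * f (suc v)} (λ _ → refl))) (+-identityʳ _)
∑-δ {suc n} f (suc x) = trans (sum-cong-≗ (λ v → cong (_* f (suc v)) (δ-suc v x))) (∑-δ (f ∘ suc) x)
  where
  δ-suc : ∀ {n} (v x : Fin n) → δ (suc v) (suc x) ≡ δ v x
  δ-suc v x with v ≟ x
  ... | yes _ = refl
  ... | no _  = refl

∑-mult : ∀ {n} (f : Fin n → ℕ) xs → ∑ (λ v → mult v xs * f v) ≡ W f xs
∑-mult {n} f [] = ∑-zero {n} (λ _ → refl)
∑-mult {n} f (x ∷ xs) =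
  trans (sum-cong-≗ (λ v → *-distribʳ-+ (f v) (δ v x) (mult v xs)))
    (trans (∑-distrib-+ (λ v → δ v x * f v) (λ v → mult v xs * f v))
      (cong₂ _+_ (∑-δ f x) (∑-mult f xs)))

bit : Bool → ℕ
bit b = if b then 1 else 0

bit≤1 : ∀ b → bit b ≤ 1
bit≤1 true  = s≤s z≤n
bit≤1 false = z≤n

bit-false : ∀ {b} → ¬ (b ≡ true) → bit b ≡ 0
bit-false {true}  h = ⊥-elim (h refl)
bit-false {false} h = refl

bit-true : ∀ {b} → 1 ≤ bit b → b ≡ true
bit-true {true} _ = refl

∑bit-two : ∀ {k} (p : Fin k → Bool) → 2 ≤ ∑ (bit ∘ p) →
           Σ (Fin k) λ i → Σ (Fin k) λ j → i ≢ j × p i ≡ true × p j ≡ true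
∑bit-two {suc k} p h with p zero in eq
... | false with ∑bit-two (p ∘ suc) h
...   | i , j , i≢j , pi , pj = suc i , suc j , (λ { refl → i≢j refl }) , pi , pj
∑bit-two {suc k} p (s≤s h) | true with ∑-positive (bit ∘ p ∘ suc) h
...   | j , q = zero , suc j , (λ ()) , eq , bit-true q

∑bit-three : ∀ {k} (p : Fin k → Bool) → 3 ≤ ∑ (bit ∘ p) →
             Σ (Fin k) λ i → Σ (Fin k) λ j → Σ (Fin k) λ l →
             (i ≢ j × i ≢ l × j ≢ l) × p i ≡ true × p j ≡ true × p l ≡ true
∑bit-three {suc k} p h with p zero in eq
... | false with ∑bit-three (p ∘ suc) h
...   | i , j , l , (a , b , c) , pi , pj , pl =
        suc i , suc j , suc l , ((λ { refl → a refl }) , (λ { refl → b refl }) , (λ { refl → c refl })) , pi , pj , pl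
∑bit-three {suc k} p (s≤s h) | true with ∑bit-two (p ∘ suc) h
...   | i , j , i≢j , pi , pj = zero , suc i , suc j , ((λ ()) , (λ ()) , (λ { refl → i≢j refl })) , eq , pi , pj

W-* : ∀ {X : Set} (w : X → ℕ) c xs → W (λ x → w x * c) xs ≡ W w xs * c
W-* w c []       = refl
W-* w c (x ∷ xs) = trans (cong (w x * c +_) (W-* w c xs)) (≡-sym (*-distribʳ-+ c (w x) _))

∑-* : ∀ {k} (f : Fin k → ℕ) c → ∑ (λ i → f i * c) ≡ ∑ f * c
∑-* {zero}  f c = refl
∑-* {suc k} f c = trans (cong (f zero * c +_) (∑-* (f ∘ suc) c)) (≡-sym (*-distribʳ-+ c (f zero) _))

sum-allFin : ∀ {k} (f : Fin k → ℕ) → sum (map f (allFin k)) ≡ ∑ f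
sum-allFin f = trans (cong sum (map-tabulate (λ i → i) f)) (sum-tabulate f)
  where
  sum-tabulate : ∀ {k} (f : Fin k → ℕ) → sum (tabulate f) ≡ ∑ f
  sum-tabulate {zero}  f = refl
  sum-tabulate {suc k} f = cong (f zero +_) (sum-tabulate (f ∘ suc))

choose : ∀ {k} {A B : Fin k → Set} → (∀ i → A i ⊎ B i) → (∀ i → A i) ⊎ Σ (Fin k) B
choose {zero}  h = inj₁ λ ()
choose {suc k} {A} {B} h with h zero | choose {k} {A ∘ suc} {B ∘ suc} (h ∘ suc)
... | inj₂ p | _            = inj₂ (zero , p)
... | inj₁ p | inj₂ (i , q) = inj₂ (suc i , q)
... | inj₁ p | inj₁ q       = inj₁ λ { zero → p ; (suc i) → q i }

∑-single : ∀ {k} (i : Fin k) m → ∑ (upd i m (λ _ → 0)) ≡ m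
∑-single {suc k} zero m = trans (cong (m +_) (∑-zero {k} {f = λ _ → 0} (λ _ → refl))) (+-identityʳ m)
∑-single (suc i) m = ∑-single i m

lookup-pairs : ∀ {X : Set} {R : X → X → Set} → (∀ {x y} → R x y → R y x) → ∀ {xs} → AllPairs R xs →
               ∀ i j → i ≢ j → R (lookup xs i) (lookup xs j)
lookup-pairs s (p ∷ ps) zero    zero    i≢j = ⊥-elim (i≢j refl)
lookup-pairs s (p ∷ ps) zero    (suc j) i≢j = All.lookup p (∈-lookup j)
lookup-pairs s (p ∷ ps) (suc i) zero    i≢j = s (All.lookup p (∈-lookup i))
lookup-pairs s (p ∷ ps) (suc i) (suc j) i≢j = lookup-pairs s ps i j (i≢j ∘ cong suc)

-- Charging leaf adjacencies along one leg.

-- A leg Ls = y₁ … y_m hangs from z. Here a y says whether y is adjacent to the leaf y₁ and r y counts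
-- the other leaves adjacent to y. Charging a y to the predecessor of y, and r y to y and to the
-- successor of y when r y = 2, overloads a vertex only if it follows a vertex with r = 2 and precedes
-- a neighbour of y₁; after that some vertex stays uncharged before the next overload, unless the leg ends first.
module Charge {X : Set} (a r : X → ℕ) (Ls : List X) (z : X)
  (a≤1 : ∀ x → a x ≤ 1)
  (r≤2 : ∀ {A x B} → Ls ≡ A ++ x ∷ B → r x ≤ 2)
  (r-last : ∀ {A x} → Ls ≡ A ++ x ∷ [] → r x ≡ 0)
  (r-before-a : ∀ {A x y B} → Ls ≡ A ++ x ∷ y ∷ B → a y ≡ 1 → r x ≡ 0)
  (r-after-2 : ∀ {A x y B} → Ls ≡ A ++ x ∷ y ∷ B → r x ≡ 2 → r y ≡ 0)
  (r-after-a : ∀ {A x y B v} → v ∈ A → r v ≡ 2 → Ls ≡ A ++ x ∷ y ∷ B → a x ≡ 1 → r y ≡ 0)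
  (a-last : ∀ {A x v} → v ∈ A → r v ≡ 2 → Ls ≡ A ++ x ∷ [] → a x ≡ 0)
  (r-first-a : ∀ {A x y B v} → v ∈ A → r v ≡ 2 → Ls ≡ A ++ x ∷ y ∷ B → a x ≡ 0 → a y ≡ 1 → r y ≢ 2)
  where

  -- `Overload` is the evidence left behind by a leg that ends with a debt; its parts later supply
  -- rays of a star at `z` and a vertex at which the leg can be cut. `Slack` excludes that evidence
  -- and gains one unit as well.
  Overload Slack : Set
  Overload = a z ≡ 1 × (Σ (List X) λ A → Σ X λ y → Σ X λ s → Ls ≡ A ++ y ∷ s ∷ [] × 1 ≤ r y × a s ≡ 0) ×
             (Σ X λ x → x ∈ Ls × r x ≡ 2)
  Slack = a z ≡ 0 × (∀ {A y s} → Ls ≡ A ++ y ∷ s ∷ [] → r y ≡ 0)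

  -- The term `a q` is missing because the predecessor of `q` has paid for it; `a z` is left to the
  -- last vertex of the leg.
  S : X → List X → ℕ
  S q B = r q + W (λ x → a x + r x) B + a z

  -- Here `K` is the debt handed to `q` by the vertices before it, and `suc (length B)` is the
  -- number of vertices that can still pay.
  Goal : ℕ → X → List X → Set
  Goal K q B = (K + S q B ≤ suc (length B) ⊎ (K + S q B ≤ suc (suc (length B)) × Overload)) ×
               (Slack → K + S q B < suc (length B))

  private
    -- The vertex `q` has one unit to spend on the old debt `K`, on `r q` and on `a q′`; whatever is
    -- not covered becomes the new debt `K′`.
    shift : ∀ K K′ q q′ B → K + (r q + a q′) ≤ suc K′ → K + S q (q′ ∷ B) ≤ suc (K′ + S q′ B)
    shift K K′ q q′ B le = subst (_≤ suc (K′ + S q′ B))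
      (≡-sym (solve 6 (λ k x y u v w → k :+ (x :+ ((y :+ u) :+ v) :+ w) := (k :+ (x :+ y)) :+ ((u :+ v) :+ w))
        refl K (r q) (a q′) (r q′) (W (λ x → a x + r x) B) (a z)))
      (+-monoˡ-≤ (S q′ B) le)

    advance : ∀ K K′ q q′ B → K + (r q + a q′) ≤ suc K′ → Goal K′ q′ B → Goal K q (q′ ∷ B)
    advance K K′ q q′ B le (inj₁ p , f)       =
      inj₁ (≤-trans (shift K K′ q q′ B le) (s≤s p)) , λ sl → s≤s (≤-trans (shift K K′ q q′ B le) (f sl))
    advance K K′ q q′ B le (inj₂ (p , o) , f) =
      inj₂ (≤-trans (shift K K′ q q′ B le) (s≤s p) , o) , λ sl → s≤s (≤-trans (shift K K′ q q′ B le) (f sl))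

    Seen : List X → Set
    Seen A = Σ X λ v → v ∈ A × r v ≡ 2

    seen : ∀ {A q} → Seen A → Seen (A ++ q ∷ [])
    seen (v , p , e) = v , ∈-left p , e

    assoc : ∀ {A q B} → Ls ≡ A ++ q ∷ B → Ls ≡ (A ++ q ∷ []) ++ B
    assoc {A} e = trans e (≡-sym (++-assoc A _ _))

    bits : ∀ x → a x ≡ 0 ⊎ a x ≡ 1
    bits x with a x | a≤1 x
    ... | zero        | _ = inj₁ refl
    ... | suc zero    | _ = inj₂ refl
    ... | suc (suc _) | s≤s ()

    not-before : ∀ {A q q′ B} → Ls ≡ A ++ q ∷ q′ ∷ B → r q ≢ 0 → a q′ ≡ 0
    not-before {q′ = q′} e ne with bits q′
    ... | inj₁ x = x
    ... | inj₂ x = ⊥-elim (ne (r-before-a e x))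

    small : ∀ {m} → m ≤ 2 → m ≡ 0 ⊎ m ≡ 1 ⊎ m ≡ 2
    small z≤n             = inj₁ refl
    small (s≤s z≤n)       = inj₂ (inj₁ refl)
    small (s≤s (s≤s z≤n)) = inj₂ (inj₂ refl)

    0≢1 : ∀ {m} → m ≡ 0 → m ≡ 1 → ⊥
    0≢1 refl ()

    0≢2 : ∀ {m} → m ≡ 0 → m ≡ 2 → ⊥
    0≢2 refl ()

    ∈-Ls : ∀ {A B} → Ls ≡ A ++ B → Seen A → Seen Ls
    ∈-Ls e (v , p , q) = v , subst (v ∈_) (≡-sym e) (∈-left p) , q

  -- No overload is pending.
  neutral : ∀ A q B → Ls ≡ A ++ q ∷ B → Goal 0 q B
  -- One overload is pending, and q is adjacent to the leaf.
  adjacent : ∀ A q B → Ls ≡ A ++ q ∷ B → Seen A → a q ≡ 1 → r q ≢ 2 → Goal 1 q B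
  -- One overload is pending, and q, preceded by p, is not adjacent to any leaf.
  idle : ∀ A p q B → Ls ≡ A ++ p ∷ q ∷ B → Seen (A ++ p ∷ []) → 1 ≤ r p → a q ≡ 0 → r q ≡ 0 → Goal 1 q B

  neutral A q [] e rewrite r-last e =
    inj₁ (a≤1 z) , λ sl → subst (_< 1) (≡-sym (proj₁ sl)) (s≤s z≤n)
  neutral A q (q′ ∷ B) e with small (r≤2 e)
  ... | inj₁ eq = advance 0 0 q q′ B ((subst (λ x → x + a q′ ≤ 1) (≡-sym eq) (a≤1 q′)))
          (neutral (A ++ q ∷ []) q′ B (assoc e))
  ... | inj₂ (inj₁ eq) = advance 0 0 q q′ B ((≤-reflexive (cong₂ _+_ eq a≡0)))
          (neutral (A ++ q ∷ []) q′ B (assoc e))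
    where a≡0 = not-before e (λ x → 0≢1 x eq)
  ... | inj₂ (inj₂ eq) = advance 0 1 q q′ B ((≤-reflexive (cong₂ _+_ eq a≡0)))
          (idle A q q′ B e (q , ∈-mid A , eq) (subst (1 ≤_) (≡-sym eq) (s≤s z≤n)) a≡0 (r-after-2 e eq))
    where a≡0 = not-before e (λ x → 0≢2 x eq)

  adjacent A q [] e (v , p , w) aq rq = ⊥-elim (0≢1 (a-last p w e) aq)
  adjacent A q (q′ ∷ B) e sn@(v , p , w) aq rq with small (r≤2 e)
  ... | inj₂ (inj₂ eq) = ⊥-elim (rq eq)
  ... | inj₂ (inj₁ eq) = advance 1 1 q q′ B ((≤-reflexive (cong suc (cong₂ _+_ eq a≡0))))
          (idle A q q′ B e (seen sn) (subst (1 ≤_) (≡-sym eq) (s≤s z≤n)) a≡0 (r-after-a p w e aq))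
    where a≡0 = not-before e (λ x → 0≢1 x eq)
  ... | inj₁ eq with bits q′
  ...   | inj₁ a0 = advance 1 0 q q′ B ((≤-reflexive (cong suc (cong₂ _+_ eq a0))))
          (neutral (A ++ q ∷ []) q′ B (assoc e))
  ...   | inj₂ a1 = advance 1 1 q q′ B ((≤-reflexive (cong suc (cong₂ _+_ eq a1))))
          (adjacent (A ++ q ∷ []) q′ B (assoc e) (seen sn) a1 (0≢2 (r-after-a p w e aq)))

  idle A p q [] e sn rp aq rq rewrite rq with bits z
  -- The leg ends here: `q` itself repays the debt if `a z` is 0, and otherwise one unit stays
  -- unpaid. Slack forbids the first case, as `p` sees another leaf, and the second, as `a z` is 1.
  ... | inj₁ a0 = inj₁ (≤-reflexive (cong suc a0)) , λ sl → ⊥-elim (1+n≰n (subst (1 ≤_) (proj₂ sl e) rp))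
  ... | inj₂ a1 = inj₂ (≤-reflexive (cong suc a1) , a1 , (A , p , q , e , rp , aq) , ∈-Ls (assoc e) sn) ,
                  λ sl → ⊥-elim (0≢1 (proj₁ sl) a1)
  idle A p q (q′ ∷ B) e sn rp aq rq with bits q′
  ... | inj₁ a0 = advance 1 0 q q′ B ((≤-reflexive (cong suc (cong₂ _+_ rq a0))))
          (neutral ((A ++ p ∷ []) ++ q ∷ []) q′ B (assoc (assoc e)))
  ... | inj₂ a1 = advance 1 1 q q′ B ((≤-reflexive (cong suc (cong₂ _+_ rq a1))))
          (adjacent ((A ++ p ∷ []) ++ q ∷ []) q′ B (assoc (assoc e)) (seen sn) a1
            (r-first-a (proj₁ (proj₂ sn)) (proj₂ (proj₂ sn)) (assoc e) aq a1))

-- Paths in the graph.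

module Configurations {n : ℕ} (G : Graph n) where

  V : Set
  V = Fin n

  infix 4 _∼_
  _∼_ : V → V → Set
  u ∼ v = u ∼[ G ] v

  ∼-sym : ∀ {u v} → u ∼ v → v ∼ u
  ∼-sym {u} {v} p = trans (Graph.sym G v u) p

  ∼-irrefl : ∀ {u} → ¬ u ∼ u
  ∼-irrefl {u} p with trans (≡-sym p) (Graph.irrefl G u)
  ... | ()

  Path : List V → Set
  Path []           = ⊤
  Path (x ∷ [])     = ⊤
  Path (x ∷ y ∷ xs) = x ∼ y × Path (y ∷ xs)

  path-join : ∀ A {x B} → Path (A ++ x ∷ []) → Path (x ∷ B) → Path (A ++ x ∷ B)
  path-join []          p       q = q
  path-join (a ∷ [])    (e , _) q = e , q
  path-join (a ∷ b ∷ A) (e , p) q = e , path-join (b ∷ A) p q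

  path-link : ∀ A {x y B} → Path (A ++ x ∷ []) → x ∼ y → Path (y ∷ B) → Path (A ++ x ∷ y ∷ B)
  path-link A p e q = path-join A p (e , q)

  path-left : ∀ A {x B} → Path (A ++ x ∷ B) → Path (A ++ x ∷ [])
  path-left []          p       = tt
  path-left (a ∷ [])    (e , _) = e , tt
  path-left (a ∷ b ∷ A) (e , p) = e , path-left (b ∷ A) p

  path-right : ∀ A {B} → Path (A ++ B) → Path B
  path-right []                    p       = p
  path-right (a ∷ [])    {[]}      p       = tt
  path-right (a ∷ [])    {b ∷ B}   (_ , p) = p
  path-right (a ∷ b ∷ A)           (_ , p) = path-right (b ∷ A) p

  path-prefix : ∀ A {B} → Path (A ++ B) → Path A
  path-prefix []          p       = tt
  path-prefix (a ∷ [])    p       = tt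
  path-prefix (a ∷ b ∷ A) (e , p) = e , path-prefix (b ∷ A) p

  path-edge : ∀ A {x y B} → Path (A ++ x ∷ y ∷ B) → x ∼ y
  path-edge A p = proj₁ (path-right A p)

  path-reverse : ∀ xs → Path xs → Path (reverse xs)
  path-reverse []           p       = tt
  path-reverse (x ∷ [])     p       = tt
  path-reverse (x ∷ y ∷ xs) (e , p) =
    subst Path (≡-sym (reverse-mid [] {x} {y} {xs})) (path-link (reverse xs) (subst Path (unfold-reverse y xs) (path-reverse (y ∷ xs) p)) (∼-sym e) tt)

  Head Last : List V → V → Set
  Head P z = Σ (List V) λ B → P ≡ z ∷ B
  Last P z = Σ (List V) λ A → P ≡ A ++ z ∷ []

  Last-++ : ∀ A {B z} → Last B z → Last (A ++ B) z
  Last-++ A (C , refl) = A ++ C , ≡-sym (++-assoc A C _)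

  Last⇒∈ : ∀ {P z} → Last P z → z ∈ P
  Last⇒∈ (A , refl) = ∈-mid A

  Head-reverse : ∀ {P z} → Last P z → Head (reverse P) z
  Head-reverse (A , refl) = reverse A , reverse-snoc A

  Last-reverse : ∀ {P z} → Head P z → Last (reverse P) z
  Last-reverse {z = z} (B , refl) = reverse B , unfold-reverse z B

  head-unique : ∀ {xs : List V} {s t} → Head xs s → Head xs t → s ≡ t
  head-unique (A , e) (B , e′) = ∷-injectiveˡ (trans (≡-sym e) e′)

  last-unique : ∀ {xs : List V} {s t} → Last xs s → Last xs t → s ≡ t
  last-unique (A , e) (B , e′) = ∷ʳ-injectiveʳ A B (trans (≡-sym e) e′)

  -- Configurations and their elementary changes.

  total : ∀ {k} → (V → ℕ) → List V → (Fin k → List V) → ℕ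
  total w P L = W w P + ∑ (W w ∘ L)

  -- A tree with at most k leaves: a spine P with k legs, leg i being listed from its leaf towards
  -- the spine vertex at i. Legs may be empty; since both ends of the spine carry a leg, each leaf of
  -- the tree is the first vertex of a leg or the spine vertex of an empty leg.
  record Cfg (k : ℕ) : Set where
    field
      P      : List V
      L      : Fin k → List V
      at     : Fin k → V
      P-path : Path P
      L-path : ∀ i → Path (L i ++ at i ∷ [])
      at∈P   : ∀ i → at i ∈ P
      first  : Σ (Fin k) λ i → Head P (at i)
      final  : Σ (Fin k) λ i → Last P (at i)
      simple : ∀ v → total (δ v) P L ≤ 1
  open Cfg public

  weight : ∀ {k} → (V → ℕ) → Cfg k → ℕ
  weight w T = total w (P T) (L T)

  size : ∀ {k} → Cfg k → ℕ
  size = weight (λ _ → 1)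

  spine : ∀ {k} → Cfg k → ℕ
  spine T = length (P T)

  In : ∀ {k} → V → Cfg k → Set
  In v T = 1 ≤ weight (δ v) T

  ∈leg-≤ : ∀ {k} (T : Cfg k) {i v} → v ∈ L T i → 1 ≤ ∑ (λ i → mult v (L T i))
  ∈leg-≤ T {i} {v} p = ≤-trans (∈⇒mult p) (≤-∑ (λ i → mult v (L T i)) i)

  ∈spine⇒In : ∀ {k} (T : Cfg k) {v} → v ∈ P T → In v T
  ∈spine⇒In T p = ≤-trans (∈⇒mult p) (m≤m+n _ _)

  In⇒∈ : ∀ {k} (T : Cfg k) {v} → In v T → v ∈ P T ⊎ Σ (Fin k) λ i → v ∈ L T i
  In⇒∈ T {v} p with mult v (P T) in eq
  ... | suc m = inj₁ (mult⇒∈ (P T) (subst (1 ≤_) (≡-sym eq) (s≤s z≤n)))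
  ... | zero with ∑-positive _ p
  ...   | i , q = inj₂ (i , mult⇒∈ (L T i) q)

  2≰1 : ∀ {m} → 2 ≤ m → m ≤ 1 → ⊥
  2≰1 p q with ≤-trans p q
  ... | s≤s ()

  leg≢spine : ∀ {k} (T : Cfg k) {i x y} → x ∈ L T i → y ∈ P T → x ≢ y
  leg≢spine T {x = x} p q refl = 2≰1 (+-mono-≤ (∈⇒mult q) (∈leg-≤ T p)) (simple T x)

  leg≢leg : ∀ {k} (T : Cfg k) {i j x y} → i ≢ j → x ∈ L T i → y ∈ L T j → x ≢ y
  leg≢leg T {x = x} i≢j p q refl =
    2≰1 (≤-trans (+-mono-≤ (∈⇒mult p) (∈⇒mult q)) (≤-trans (pair≤∑ (λ i → mult x (L T i)) i≢j) (m≤n+m _ _))) (simple T x)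

  mult-mid : ∀ A {v x : V} {B} → v ∈ A ⊎ v ∈ B → v ≡ x → 2 ≤ mult v (A ++ x ∷ B)
  mult-mid A {v} {_} {B} s refl = subst (2 ≤_) (≡-sym (trans (W-++ (δ v) A) (cong (λ z → mult v A + (z + mult v B)) (δ-same v)))) (h s)
    where
    h : v ∈ A ⊎ v ∈ B → 2 ≤ mult v A + (1 + mult v B)
    h (inj₁ p) = +-mono-≤ (∈⇒mult p) (s≤s z≤n)
    h (inj₂ p) = ≤-trans (s≤s (∈⇒mult p)) (m≤n+m _ (mult v A))

  leg-distinct : ∀ {k} (T : Cfg k) i {A x B v} → L T i ≡ A ++ x ∷ B → v ∈ A ⊎ v ∈ B → v ≢ x
  leg-distinct T i {A} {v = v} eq s v≡x =
    2≰1 (mult-mid A s v≡x) (subst (λ z → mult v z ≤ 1) eq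
      (≤-trans (≤-∑ (λ i → mult v (L T i)) i) (≤-trans (m≤n+m _ _) (simple T v))))

  spine-distinct : ∀ {k} (T : Cfg k) {A x B v} → P T ≡ A ++ x ∷ B → v ∈ A ⊎ v ∈ B → v ≢ x
  spine-distinct T {A} {v = v} eq s v≡x =
    2≰1 (mult-mid A s v≡x) (subst (λ z → mult v z ≤ 1) eq (≤-trans (m≤m+n _ _) (simple T v)))

  upd-∀ : ∀ {k} {A : Set} (Q : Fin k → A → Set) i {a : A} {f : Fin k → A} →
          Q i a → (∀ j → Q j (f j)) → ∀ j → Q j (upd i a f j)
  upd-∀ Q zero    q h zero    = q
  upd-∀ Q zero    q h (suc j) = h (suc j)
  upd-∀ Q (suc i) q h zero    = h zero
  upd-∀ Q (suc i) q h (suc j) = upd-∀ (Q ∘ suc) i q (h ∘ suc) j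

  upd₂-∀ : ∀ {k} {A B : Set} (R : A → B → Set) i {a : A} {b : B} {f : Fin k → A} {g : Fin k → B} →
           R a b → (∀ j → R (f j) (g j)) → ∀ j → R (upd i a f j) (upd i b g j)
  upd₂-∀ R zero    q h zero    = q
  upd₂-∀ R zero    q h (suc j) = h (suc j)
  upd₂-∀ R (suc i) q h zero    = h zero
  upd₂-∀ R (suc i) q h (suc j) = upd₂-∀ R i q (h ∘ suc) j

  ∑-upd₁ : ∀ {k} {A : Set} (w : A → ℕ) i {a : A} (f : Fin k → A) → w a ≡ w (f i) → ∑ (w ∘ upd i a f) ≡ ∑ (w ∘ f)
  ∑-upd₁ w i {a} f e = +-cancelʳ-≡ (w (f i)) _ _ (trans (∑-upd w i f) (cong (∑ (w ∘ f) +_) e))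

  ∑-upd₂ : ∀ {k} {A : Set} (w : A → ℕ) i j {a b : A} (f : Fin k → A) → j ≢ i → w a + w b ≡ w (f i) + w (f j) →
           ∑ (w ∘ upd j b (upd i a f)) ≡ ∑ (w ∘ f)
  ∑-upd₂ w i j {a} {b} f j≢i e = +-cancelʳ-≡ (w (f j) + w (f i)) _ _
    (trans (≡-sym (+-assoc S (w (f j)) (w (f i))))
    (trans (cong (_+ w (f i)) (trans (cong (λ z → S + w z) (≡-sym (upd-other i j≢i))) (∑-upd w j (upd i a f))))
    (trans (solve 3 (λ x y z → (x :+ y) :+ z := (x :+ z) :+ y) refl S′ (w b) (w (f i)))
    (trans (cong (_+ w b) (∑-upd w i f))
    (trans (+-assoc (∑ (w ∘ f)) (w a) (w b)) (cong (∑ (w ∘ f) +_) (trans e (+-comm (w (f i)) (w (f j))))))))))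
    where
    S  = ∑ (w ∘ upd j b (upd i a f))
    S′ = ∑ (w ∘ upd i a f)

  -- Equality is asked for every weight `w` because one identity then serves twice: `w = δ v` keeps
  -- the vertices distinct, and the constant 1 keeps the size.
  module _ {k} (T : Cfg k) (L′ : Fin k → List V) (at′ : Fin k → V)
    (paths : ∀ i → Path (L′ i ++ at′ i ∷ [])) (on-spine : ∀ i → at′ i ∈ P T)
    (first′ : Σ (Fin k) λ i → Head (P T) (at′ i)) (final′ : Σ (Fin k) λ i → Last (P T) (at′ i))
    (same : ∀ w → ∑ (W w ∘ L′) ≡ ∑ (W w ∘ L T)) where

    rebuild : Cfg k
    rebuild = record
      { P = P T ; L = L′ ; at = at′ ; P-path = P-path T ; L-path = paths ; at∈P = on-spine
      ; first = first′ ; final = final′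
      ; simple = λ v → subst (_≤ 1) (cong (mult v (P T) +_) (≡-sym (same (δ v)))) (simple T v) }

    rebuild-weight : ∀ w → weight w rebuild ≡ weight w T
    rebuild-weight w = cong (W w (P T) +_) (same w)

  mirror : ∀ {k} → Cfg k → Cfg k
  mirror T = record
    { P = reverse (P T) ; L = L T ; at = at T ; P-path = path-reverse (P T) (P-path T) ; L-path = L-path T
    ; at∈P = λ i → ∈-reverse (at∈P T i)
    ; first = proj₁ (final T) , Head-reverse (proj₂ (final T))
    ; final = proj₁ (first T) , Last-reverse (proj₂ (first T))
    ; simple = λ v → subst (_≤ 1) (cong (_+ ∑ (λ i → mult v (L T i))) (≡-sym (W-reverse (δ v) (P T)))) (simple T v) }

  mirror-weight : ∀ {k} w (T : Cfg k) → weight w (mirror T) ≡ weight w T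
  mirror-weight w T = cong (_+ ∑ (W w ∘ L T)) (W-reverse w (P T))

  -- Both ends must be covered by legs other than `i`; an uncovered end would be a leaf that no leg
  -- accounts for.
  module _ {k} (T : Cfg (suc k)) (i : Fin (suc k)) (empty : L T i ≡ [])
    (first′ : Σ (Fin (suc k)) λ j → j ≢ i × Head (P T) (at T j))
    (final′ : Σ (Fin (suc k)) λ j → j ≢ i × Last (P T) (at T j)) where

    private
      same : ∀ w → ∑ (W w ∘ L T) ≡ ∑ (W w ∘ L T ∘ punchIn i)
      same w = trans (sum-remove {i = i} (W w ∘ L T)) (cong (λ z → W w z + ∑ (W w ∘ L T ∘ punchIn i)) empty)

      reindex : ∀ {R : V → Set} → (Σ (Fin (suc k)) λ j → j ≢ i × R (at T j)) → Σ (Fin k) λ j → R (at T (punchIn i j))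
      reindex {R} (j , j≢i , r) = punchOut (j≢i ∘ ≡-sym) , subst (R ∘ at T) (≡-sym (punchIn-punchOut (j≢i ∘ ≡-sym))) r

    drop : Cfg k
    drop = record
      { P = P T ; L = L T ∘ punchIn i ; at = at T ∘ punchIn i ; P-path = P-path T ; L-path = L-path T ∘ punchIn i
      ; at∈P = at∈P T ∘ punchIn i ; first = reindex {Head (P T)} first′ ; final = reindex {Last (P T)} final′
      ; simple = λ v → subst (_≤ 1) (cong (mult v (P T) +_) (same (δ v))) (simple T v) }

    drop-weight : ∀ w → weight w drop ≡ weight w T
    drop-weight w = cong (W w (P T) +_) (≡-sym (same w))

  -- An end of the spine that carries a single leg can be moved into that leg.
  module _ {k} (T : Cfg k) {i s s′ B} (eq : P T ≡ s ∷ s′ ∷ B) (at-i : at T i ≡ s) (only : ∀ j → j ≢ i → at T j ≢ s) where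

    private
      L′ : Fin k → List V
      L′ = upd i (L T i ++ s ∷ []) (L T)

      at′ : Fin k → V
      at′ = upd i s′ (at T)

      same : ∀ w → W w (s′ ∷ B) + ∑ (W w ∘ L′) ≡ weight w T
      same w = +-cancelʳ-≡ (W w (L T i)) _ _
        (trans (+-assoc (W w (s′ ∷ B)) _ _)
        (trans (cong (W w (s′ ∷ B) +_) (trans (∑-upd (W w) i (L T)) (cong (∑ (W w ∘ L T) +_) (W-snoc w (L T i)))))
        (trans (solve 4 (λ p q r t → p :+ (q :+ (r :+ t)) := ((t :+ p) :+ q) :+ r) refl (W w (s′ ∷ B)) (∑ (W w ∘ L T)) (W w (L T i)) (w s))
          (cong (λ z → W w z + ∑ (W w ∘ L T) + W w (L T i)) (≡-sym eq)))))

      edge : Path (s ∷ s′ ∷ B)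
      edge = subst Path eq (P-path T)

      tail∈ : ∀ {x} → x ∈ P T → x ≢ s → x ∈ s′ ∷ B
      tail∈ p x≢s with subst (_ ∈_) eq p
      ... | hd x≡s = ⊥-elim (x≢s x≡s)
      ... | tl q   = q

      at′∈ : ∀ j → at′ j ∈ s′ ∷ B
      at′∈ j with j ≟ i
      ... | yes refl = subst (_∈ s′ ∷ B) (≡-sym (upd-same i)) (hd refl)
      ... | no j≢i   = subst (_∈ s′ ∷ B) (≡-sym (upd-other i j≢i)) (tail∈ (at∈P T j) (only j j≢i))

      shorter : ∀ {z} A → s ∷ s′ ∷ B ≡ A ++ z ∷ [] → Last (s′ ∷ B) z
      shorter []      ()
      shorter (a ∷ A) e = A , ∷-injectiveʳ e

      final′ : Σ (Fin k) λ j → Last (s′ ∷ B) (at′ j)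
      final′ with final T
      ... | j , A , e with j ≟ i
      ...   | no j≢i = j , subst (Last (s′ ∷ B)) (≡-sym (upd-other i j≢i)) (shorter A (trans (≡-sym eq) e))
      ...   | yes refl = ⊥-elim (spine-distinct T {[]} eq
              (inj₂ (Last⇒∈ (shorter A (trans (≡-sym eq) e)))) at-i)

    absorb : Cfg k
    absorb = record
      { P = s′ ∷ B ; L = L′ ; at = at′ ; P-path = proj₂ edge
      ; L-path = upd₂-∀ (λ xs z → Path (xs ++ z ∷ [])) i
          (subst Path (≡-sym (++-assoc (L T i) _ _))
            (path-link (L T i) (subst (λ z → Path (L T i ++ z ∷ [])) at-i (L-path T i)) (proj₁ edge) tt)) (L-path T)
      ; at∈P = at′∈ ; first = i , B , cong (_∷ B) (≡-sym (upd-same i)) ; final = final′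
      ; simple = λ v → subst (_≤ 1) (≡-sym (same (δ v))) (simple T v) }

    absorb-weight : ∀ w → weight w absorb ≡ weight w T
    absorb-weight = same

  weight-∑ : ∀ {k} (f : V → ℕ) (T : Cfg k) → ∑ (λ v → weight (δ v) T * f v) ≡ weight f T
  weight-∑ f T = trans (sum-cong-≗ (λ v → trans (*-distribʳ-+ (f v) (mult v (P T)) _)
      (cong (mult v (P T) * f v +_) (≡-sym (∑-* (λ i → mult v (L T i)) (f v))))))
    (trans (∑-distrib-+ (λ v → mult v (P T) * f v) _)
      (cong₂ _+_ (∑-mult f (P T)) (trans (∑-comm (λ v i → mult v (L T i) * f v)) (sum-cong-≗ (λ i → ∑-mult f (L T i))))))

  size≤n : ∀ {k} (T : Cfg k) → size T ≤ n
  size≤n T = subst₂ _≤_ (weight-∑ (λ _ → 1) T) (∑-const-1 n)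
    (∑-mono (λ v → subst (_≤ 1) (≡-sym (*-identityʳ _)) (simple T v)))

  size-lengths : ∀ {k} (T : Cfg k) → size T ≡ length (P T) + ∑ (λ i → length (L T i))
  size-lengths T = cong₂ _+_ (W-one (P T)) (sum-cong-≗ (λ i → W-one (L T i)))

  -- Shortest spines.

  module Min {k σ ℓ : ℕ} (noShorter : ∀ (T : Cfg (suc (suc k))) → size T ≡ σ → spine T < ℓ → ⊥) where

    record Best (T : Cfg (suc (suc k))) : Set where
      constructor best
      field
        size≡  : size T ≡ σ
        spine≡ : spine T ≡ ℓ
    open Best public

    best-mirror : ∀ {T} → Best T → Best (mirror T)
    best-mirror {T} b = best (trans (mirror-weight _ T) (size≡ b)) (trans (length-reverse (P T)) (spine≡ b))

    -- If leg `i` alone hung from the first spine vertex, `absorb` would shorten the spine. On a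
    -- spine of one vertex every other leg will do.
    heads : ∀ {T} → Best T → ∀ i → Σ (Fin (suc (suc k))) λ j → j ≢ i × Head (P T) (at T j)
    heads {T} (best sz sp) i with first T
    ... | i₀ , B , eq with i₀ ≟ i
    ...   | no i₀≢i = i₀ , i₀≢i , B , eq
    ...   | yes refl with B
    ...     | [] = punchIn i zero , punchInᵢ≢i i zero , [] , trans eq (cong (_∷ []) (≡-sym (single (subst (_ ∈_) eq (at∈P T (punchIn i zero))))))
      where
      single : ∀ {x y : V} → x ∈ y ∷ [] → x ≡ y
      single (hd e) = e
    ...     | s′ ∷ B′ with any? (λ j → ¬? (j ≟ i) ×-dec (at T j ≟ at T i))
    ...       | yes (j , j≢i , e) = j , j≢i , s′ ∷ B′ , trans eq (cong (_∷ s′ ∷ B′) (≡-sym e))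
    ...       | no none = ⊥-elim (noShorter (absorb T eq refl only) (trans (absorb-weight T eq refl only _) sz)
                  (subst (suc (suc (length B′)) ≤_) (trans (≡-sym (cong length eq)) sp) ≤-refl))
      where
      only : ∀ j → j ≢ i → at T j ≢ at T i
      only j j≢i e = none (j , j≢i , e)

    lasts : ∀ {T} → Best T → ∀ i → Σ (Fin (suc (suc k))) λ j → j ≢ i × Last (P T) (at T j)
    lasts {T} b i with heads (best-mirror b) i
    ... | j , j≢i , B , e = j , j≢i , reverse B , trans (≡-sym (reverse-involutive (P T))) (trans (cong reverse e) (unfold-reverse _ B))

  Apart : V → V → Set
  Apart x y = x ≢ y × ¬ x ∼ y

  apart-sym : ∀ {x y} → Apart x y → Apart y x
  apart-sym (p , q) = p ∘ ≡-sym , q ∘ ∼-sym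

  module _ (free : K1r-free G 5) where

    no-star : ∀ c {a₁ a₂ a₃ a₄ a₅} → All (c ∼_) (a₁ ∷ a₂ ∷ a₃ ∷ a₄ ∷ a₅ ∷ []) →
              AllPairs Apart (a₁ ∷ a₂ ∷ a₃ ∷ a₄ ∷ a₅ ∷ []) → ⊥
    no-star c {a₁} {a₂} {a₃} {a₄} {a₅} adj ap = free (c , lookup xs , (inj , indep) , λ i → All.lookup adj (∈-lookup i))
      where
      xs = a₁ ∷ a₂ ∷ a₃ ∷ a₄ ∷ a₅ ∷ []
      inj : ∀ {i j} → lookup xs i ≡ lookup xs j → i ≡ j
      inj {i} {j} e with i ≟ j
      ... | yes p = p
      ... | no ne = ⊥-elim (proj₁ (lookup-pairs apart-sym ap i j ne) e)
      indep : ∀ i j → ¬ lookup xs i ∼ lookup xs j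
      indep i j e with i ≟ j
      ... | yes refl = ∼-irrefl e
      ... | no ne    = proj₂ (lookup-pairs apart-sym ap i j ne) e

  -- Exchanges in an extremal five-leg configuration.

  module Opt (free : K1r-free G 5) {σ ℓ : ℕ}
    (noShorter : ∀ (T : Cfg 5) → size T ≡ σ → spine T < ℓ → ⊥)
    (noFewer : ∀ (T : Cfg 4) → size T ≡ σ → ⊥)
    (noLarger : ∀ (T : Cfg 5) → size T ≡ suc σ → ⊥) where

    open Min {3} {σ} {ℓ} noShorter public

    -- Deleting the empty leg loses no vertex and, by `heads` and `lasts`, uncovers no end. Most
    -- exchanges below end in this contradiction.
    no-empty : ∀ {T} → Best T → ∀ {i} → L T i ≡ [] → ⊥
    no-empty {T} b {i} e = noFewer (drop T i e (heads b i) (lasts b i)) (trans (drop-weight T i e (heads b i) (lasts b i) _) (size≡ b))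

    leg-path : ∀ (T : Cfg 5) {i xs} → L T i ≡ xs → Path (xs ++ at T i ∷ [])
    leg-path T {i} e = subst (λ xs → Path (xs ++ at T i ∷ [])) e (L-path T i)

    leg-left : ∀ (T : Cfg 5) {i A y B} → L T i ≡ A ++ y ∷ B → Path (A ++ y ∷ [])
    leg-left T {A = A} e = path-left A (subst Path (++-assoc A _ _) (leg-path T e))

    leg-right : ∀ (T : Cfg 5) {i} A {B} → L T i ≡ A ++ B → Path (B ++ at T i ∷ [])
    leg-right T {i} A {B} e = path-right A (subst Path (++-assoc A B _) (leg-path T e))

    last∼at : ∀ (T : Cfg 5) {i s} → Last (L T i) s → s ∼ at T i
    last∼at T {i} (A , e) = proj₁ (leg-right T A e)

    head∈ : ∀ (T : Cfg 5) {i u} → Head (L T i) u → u ∈ L T i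
    head∈ T (B , e) = subst (_ ∈_) (≡-sym e) (hd refl)

    last∈ : ∀ (T : Cfg 5) {i u} → Last (L T i) u → u ∈ L T i
    last∈ T = Last⇒∈

    mid∈ : ∀ (T : Cfg 5) {i x B} A → L T i ≡ A ++ x ∷ B → x ∈ L T i
    mid∈ T A e = subst (_ ∈_) (≡-sym e) (∈-mid A)

    head-prefix : ∀ A {y B w} → Head (A ++ y ∷ B) w → ∀ C → Head (A ++ y ∷ C) w
    head-prefix []      (D , e) C = C , cong (_∷ C) (∷-injectiveˡ e)
    head-prefix (a ∷ A) (D , e) C = A ++ _ ∷ C , cong (_∷ A ++ _ ∷ C) (∷-injectiveˡ e)

    relegs : (T : Cfg 5) (L′ : Fin 5 → List V) → (∀ i → Path (L′ i ++ at T i ∷ [])) →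
             (∀ w → ∑ (W w ∘ L′) ≡ ∑ (W w ∘ L T)) → Cfg 5
    relegs T L′ p s = rebuild T L′ (at T) p (at∈P T) (first T) (final T) s

    relegs-best : ∀ {T} → Best T → ∀ L′ p s → Best (relegs T L′ p s)
    relegs-best {T} b L′ p s = best (trans (rebuild-weight T L′ (at T) p (at∈P T) (first T) (final T) s _) (size≡ b)) (spine≡ b)

    PathTo : Cfg 5 → Fin 5 → List V → Set
    PathTo T i xs = Path (xs ++ at T i ∷ [])

    -- Cut leg i behind y and hang its outer part, by the edge y ∼ v, from the leaf of leg j.
    module Transfer {T} (b : Best T) {i j A y B v} (i≢j : i ≢ j) (ei : L T i ≡ A ++ y ∷ B)
      (hj : Head (L T j) v) (y∼v : y ∼ v) where

      private
        C = proj₁ hj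
        ej = proj₂ hj
        L′ = upd j (A ++ y ∷ v ∷ C) (upd i B (L T))

        same : ∀ w → ∑ (W w ∘ L′) ≡ ∑ (W w ∘ L T)
        same w = ∑-upd₂ (W w) i j (L T) (i≢j ∘ ≡-sym)
          (trans (cong (W w B +_) (W-++ w A))
          (trans (solve 5 (λ a y b v c → b :+ (a :+ (y :+ (v :+ c))) := (a :+ (y :+ b)) :+ (v :+ c)) refl (W w A) (w y) (W w B) (w v) (W w C))
            (cong₂ _+_ (≡-sym (trans (cong (W w) ei) (W-++ w A))) (cong (W w) (≡-sym ej)))))

        paths : ∀ k → PathTo T k (L′ k)
        paths = upd-∀ (PathTo T) j
          (subst Path (≡-sym (++-assoc A _ _)) (path-link A (leg-left T ei) y∼v (leg-path T ej)))
          (upd-∀ (PathTo T) i (leg-right T (A ++ y ∷ []) (trans ei (≡-sym (++-assoc A _ _)))) (L-path T))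

      T′ : Cfg 5
      T′ = relegs T L′ paths same

      best′ : Best T′
      best′ = relegs-best b L′ paths same

      leg-i : L T′ i ≡ B
      leg-i = trans (upd-other j i≢j) (upd-same i)

      leg-j : L T′ j ≡ A ++ y ∷ v ∷ C
      leg-j = upd-same j

      leg-k : ∀ {k} → k ≢ i → k ≢ j → L T′ k ≡ L T k
      leg-k k≢i k≢j = trans (upd-other j k≢j) (upd-other i k≢i)

      head-j : ∀ {u} → Head (L T i) u → Head (L T′ j) u
      head-j {u} (D , e) with head-prefix A {w = u} (D , trans (≡-sym ei) e) (v ∷ C)
      ... | E , e′ = E , trans leg-j e′

      head-k : ∀ {k u} → k ≢ i → k ≢ j → Head (L T k) u → Head (L T′ k) u
      head-k k≢i k≢j (D , e) = D , trans (leg-k k≢i k≢j) e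

      last-other : ∀ {k s} → k ≢ i → Last (L T k) s → Last (L T′ k) s
      last-other {k} {s} k≢i la with k ≟ j
      ... | no k≢j   = subst (λ xs → Last xs s) (≡-sym (leg-k k≢i k≢j)) la
      ... | yes refl = subst (λ xs → Last xs s) (≡-sym leg-j)
        (Last-++ A (Last-++ (y ∷ []) (subst (λ xs → Last xs s) ej la)))

    -- A single leg may be rehung anywhere on the spine, in any order of its vertices that is a
    -- path, since `heads` and `lasts` find other legs at both ends.
    module Move {T} (b : Best T) (i : Fin 5) (A : List V) (x : V) (x∈ : x ∈ P T) (p : Path (A ++ x ∷ []))
      (same : ∀ w → W w A ≡ W w (L T i)) where

      private
        at′ = upd i x (at T)
        L′  = upd i A (L T)

        cover : ∀ {R : V → Set} → (Σ (Fin 5) λ j → j ≢ i × R (at T j)) → Σ (Fin 5) λ j → R (at′ j)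
        cover {R} (j , j≢i , r) = j , subst R (≡-sym (upd-other i j≢i)) r

        paths = upd₂-∀ (λ xs z → Path (xs ++ z ∷ [])) i p (L-path T)
        fst′ = cover {Head (P T)} (heads b i)
        fin′ = cover {Last (P T)} (lasts b i)
        on-spine = upd-∀ (λ _ z → z ∈ P T) i x∈ (at∈P T)
        sames = λ w → ∑-upd₁ (W w) i {A} (L T) (same w)

      T′ : Cfg 5
      T′ = rebuild T L′ at′ paths on-spine fst′ fin′ sames

      best′ : Best T′
      best′ = best (trans (rebuild-weight T L′ at′ paths on-spine fst′ fin′ sames _) (size≡ b)) (spine≡ b)

      leg-i : L T′ i ≡ A
      leg-i = upd-same i

      leg-k : ∀ {k} → k ≢ i → L T′ k ≡ L T k
      leg-k = upd-other i

      at-i : at T′ i ≡ x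
      at-i = upd-same i

      at-k : ∀ {k} → k ≢ i → at T′ k ≡ at T k
      at-k = upd-other i

    -- Adjacencies ruled out by exchanges.

    -- The edge would allow leg `i`, reversed, to be put in front of leg `j`, leaving leg `i` empty.
    leaf-leaf : ∀ {T} → Best T → ∀ {i j u v} → i ≢ j → Head (L T i) u → Head (L T j) v → ¬ u ∼ v
    leaf-leaf {T} b {i} {j} {u} {v} i≢j (A , ei) (B , ej) e = no-empty (relegs-best b L′ paths same) (trans (upd-other j i≢j) (upd-same i))
      where
      N = reverse A ++ u ∷ v ∷ B
      L′ = upd j N (upd i [] (L T))
      same : ∀ w → ∑ (W w ∘ L′) ≡ ∑ (W w ∘ L T)
      same w = ∑-upd₂ (W w) i j (L T) (i≢j ∘ ≡-sym)
        (trans (W-++ w (reverse A))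
        (trans (cong (_+ (w u + (w v + W w B))) (W-reverse w A))
        (trans (solve 4 (λ a u v c → a :+ (u :+ (v :+ c)) := (u :+ a) :+ (v :+ c)) refl (W w A) (w u) (w v) (W w B))
          (cong₂ _+_ (cong (W w) (≡-sym ei)) (cong (W w) (≡-sym ej))))))
      paths : ∀ k → PathTo T k (L′ k)
      paths = upd-∀ (PathTo T) j
        (subst Path (≡-sym (++-assoc (reverse A) _ _))
          (path-link (reverse A) (subst Path (unfold-reverse u A) (path-reverse (u ∷ A) (path-prefix (u ∷ A) (leg-path T ei)))) e (leg-path T ej)))
        (upd-∀ (PathTo T) i tt (L-path T))

    leaf-apart : ∀ {T} → Best T → ∀ {i j u v} → i ≢ j → Head (L T i) u → Head (L T j) v → Apart u v
    leaf-apart {T} b i≢j hi hj = leg≢leg T i≢j (head∈ T hi) (head∈ T hj) , leaf-leaf b i≢j hi hj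

    -- Otherwise the whole of leg `i` could be transferred to leg `j`.
    last-leaf : ∀ {T} → Best T → ∀ {i j s v} → i ≢ j → Last (L T i) s → Head (L T j) v → ¬ s ∼ v
    last-leaf b i≢j (A , e) hj s∼v = no-empty best′ leg-i
      where open Transfer b i≢j e hj s∼v

    -- Otherwise leg i could be inserted into the spine between x and y.
    insert : ∀ {T} → Best T → ∀ {i A x y B u s} → P T ≡ A ++ x ∷ y ∷ B → Head (L T i) u → Last (L T i) s →
             x ∼ s → u ∼ y → ⊥
    insert {T} b {i} {A} {x} {y} {B} {u} {s} ep (C , ei) (D , ei′) x∼s u∼y =
      noFewer (drop T₁ i (upd-same i) f₁ g₁) (trans (drop-weight T₁ i (upd-same i) f₁ g₁ _) (trans (same _) (size≡ b)))
      where
      M = reverse (L T i)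
      P′ = A ++ x ∷ M ++ y ∷ B
      L′ = upd i [] (L T)
      same : ∀ w → W w P′ + ∑ (W w ∘ L′) ≡ weight w T
      same w = +-cancelʳ-≡ (W w (L T i)) _ _
        (trans (+-assoc (W w P′) _ _)
        (trans (cong (W w P′ +_) (trans (∑-upd (W w) i (L T)) (+-identityʳ _)))
        (trans (cong (_+ ∑ (W w ∘ L T)) (trans (W-++ w A) (cong (λ z → W w A + (w x + z)) (trans (W-++ w M) (cong (_+ W w (y ∷ B)) (W-reverse w (L T i)))))))
        (trans (solve 5 (λ a x m r t → (a :+ (x :+ (m :+ r))) :+ t := ((a :+ (x :+ r)) :+ t) :+ m) refl (W w A) (w x) (W w (L T i)) (W w (y ∷ B)) (∑ (W w ∘ L T)))
          (cong (λ z → z + ∑ (W w ∘ L T) + W w (L T i)) (≡-sym (trans (cong (W w) ep) (W-++ w A))))))))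
      M-head : M ≡ s ∷ reverse D
      M-head = trans (cong reverse ei′) (reverse-snoc D)
      M-last : M ≡ reverse C ++ u ∷ []
      M-last = trans (cong reverse ei) (unfold-reverse u C)
      M-path : Path M
      M-path = path-reverse (L T i) (path-prefix (L T i) (L-path T i))
      old : Path (A ++ x ∷ y ∷ B)
      old = subst Path ep (P-path T)
      My : Path (M ++ y ∷ B)
      My = subst (λ m → Path (m ++ y ∷ B)) (≡-sym M-last)
        (subst Path (≡-sym (++-assoc (reverse C) _ _))
          (path-link (reverse C) (subst Path M-last M-path) u∼y (path-right (A ++ x ∷ []) (subst Path (≡-sym (++-assoc A _ _)) old))))
      P′-path : Path P′
      P′-path = path-join A (path-left A old)
        (subst (λ m → Path (x ∷ m ++ y ∷ B)) (≡-sym M-head) (x∼s , subst (λ m → Path (m ++ y ∷ B)) M-head My))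
      keep : ∀ {z} → z ∈ P T → z ∈ P′
      keep p with ∈-++⁻ A (subst (_ ∈_) ep p)
      ... | inj₁ q            = ∈-left q
      ... | inj₂ (hd refl)    = ∈-mid A
      ... | inj₂ (tl q)       = ∈-right A (tl (∈-right M q))
      headP : ∀ {z} → Head (P T) z → Head P′ z
      headP {z} (E , e) = head-prefix A {w = z} (E , trans (≡-sym ep) e) (M ++ y ∷ B)
      lastP : ∀ {z} → Last (P T) z → Last P′ z
      lastP {z} la = Last-++ A (Last-++ (x ∷ []) (Last-++ M (tail-last A (subst (λ xs → Last xs z) ep la))))
        where
        pop : ∀ {a b : V} {xs z} → Last (a ∷ b ∷ xs) z → Last (b ∷ xs) z
        pop ([]    , e) with ∷-injectiveʳ e
        ... | ()
        pop (c ∷ E , e) = E , ∷-injectiveʳ e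
        tail-last : ∀ A → Last (A ++ x ∷ y ∷ B) z → Last (y ∷ B) z
        tail-last []          la = pop la
        tail-last (a ∷ [])    la = pop (pop la)
        tail-last (a ∷ c ∷ A) la = tail-last (c ∷ A) (pop la)
      f₀ = heads b i
      g₀ = lasts b i
      T₁ : Cfg 5
      T₁ = record
        { P = P′ ; L = L′ ; at = at T ; P-path = P′-path ; L-path = upd-∀ (PathTo T) i tt (L-path T)
        ; at∈P = λ j → keep (at∈P T j) ; first = proj₁ (first T) , headP (proj₂ (first T)) ; final = proj₁ (final T) , lastP (proj₂ (final T))
        ; simple = λ v → subst (_≤ 1) (≡-sym (same (δ v))) (simple T v) }
      f₁ : Σ (Fin 5) λ j → j ≢ i × Head P′ (at T j)
      f₁ = proj₁ f₀ , proj₁ (proj₂ f₀) , headP (proj₂ (proj₂ f₀))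
      g₁ : Σ (Fin 5) λ j → j ≢ i × Last P′ (at T j)
      g₁ = proj₁ g₀ , proj₁ (proj₂ g₀) , lastP (proj₂ (proj₂ g₀))

    Next : List V → V → V → Set
    Next P x y = Σ (List V) λ A → Σ (List V) λ B → P ≡ A ++ x ∷ y ∷ B ⊎ P ≡ A ++ y ∷ x ∷ B

    next-reverse : ∀ {P x y} → Next P x y → Next (reverse P) x y
    next-reverse (A , B , inj₁ refl) = reverse B , reverse A , inj₂ (reverse-mid A)
    next-reverse (A , B , inj₂ refl) = reverse B , reverse A , inj₁ (reverse-mid A)

    next∈ : ∀ {P x y} → Next P x y → y ∈ P
    next∈ (A , B , inj₁ refl) = ∈-right A (tl (hd refl))
    next∈ (A , B , inj₂ refl) = ∈-mid A

    next∼ : ∀ (T : Cfg 5) {x y} → Next (P T) x y → x ∼ y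
    next∼ T (A , B , inj₁ e) = path-edge A (subst Path e (P-path T))
    next∼ T (A , B , inj₂ e) = ∼-sym (path-edge A (subst Path e (P-path T)))

    insert-next : ∀ {T} → Best T → ∀ {i x y u s} → Next (P T) x y → Head (L T i) u → Last (L T i) s → x ∼ s → u ∼ y → ⊥
    insert-next b (A , B , inj₁ e) = insert b e
    insert-next {T} b {x = x} {y} (A , B , inj₂ e) = insert (best-mirror b) (trans (cong reverse e) (reverse-mid A))

    leg-last : ∀ {T} → Best T → ∀ i → Σ V λ s → Last (L T i) s
    leg-last {T} b i with unsnoc (L T i)
    ... | inj₁ e           = ⊥-elim (no-empty b e)
    ... | inj₂ (A , s , e) = s , A , e

    leg-head : ∀ {T} → Best T → ∀ i → Σ V λ u → Head (L T i) u
    leg-head {T} b i with uncons (L T i) (no-empty b)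
    ... | u , A , e = u , A , e

    -- The last vertex of the leg is adjacent to `at T i`, so with `u ∼ y` the whole leg would fit
    -- between `at T i` and `y`.
    leaf-next : ∀ {T} → Best T → ∀ {i y u} → Next (P T) (at T i) y → Head (L T i) u → ¬ u ∼ y
    leaf-next {T} b {i} nx h e with leg-last b i
    ... | s , la = insert-next b nx h la (∼-sym (last∼at T la)) e

    -- A neighbour outside would lengthen the leg, against maximality of the size. So the whole
    -- degree of a leaf can be counted inside the tree.
    leaf-inside : ∀ {T} → Best T → ∀ {i u v} → Head (L T i) u → u ∼ v → In v T
    leaf-inside {T} b {i} {u} {v} (A , ei) u∼v with 1 ≤? weight (δ v) T
    ... | yes p = p
    ... | no ¬p = ⊥-elim (noLarger T₁ (trans (same _) (cong suc (size≡ b))))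
      where
      L′ = upd i (v ∷ L T i) (L T)
      same : ∀ w → W w (P T) + ∑ (W w ∘ L′) ≡ w v + weight w T
      same w = +-cancelʳ-≡ (W w (L T i)) _ _
        (trans (+-assoc (W w (P T)) _ _)
        (trans (cong (W w (P T) +_) (∑-upd (W w) i (L T)))
          (solve 4 (λ p s v l → p :+ (s :+ (v :+ l)) := (v :+ (p :+ s)) :+ l) refl (W w (P T)) (∑ (W w ∘ L T)) (w v) (W w (L T i)))))
      fresh : ∀ x → δ x v + weight (δ x) T ≤ 1
      fresh x with x ≟ v
      ... | no _     = simple T x
      ... | yes refl = s≤s (≮⇒≥ ¬p)
      T₁ : Cfg 5
      T₁ = record
        { P = P T ; L = L′ ; at = at T ; P-path = P-path T
        ; L-path = upd-∀ (PathTo T) i (subst (λ xs → Path (v ∷ xs ++ at T i ∷ [])) (≡-sym ei) (∼-sym u∼v , leg-path T ei)) (L-path T)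
        ; at∈P = at∈P T ; first = first T ; final = final T
        ; simple = λ x → subst (_≤ 1) (≡-sym (same (δ x))) (fresh x) }

    -- Cutting behind `y` and transferring makes `y′` the leaf of leg `i`, and two leaves are never
    -- adjacent. Leg `k` may be leg `i`: its old leaf then heads leg `j`.
    next-leaf : ∀ {T} → Best T → ∀ {i j k A y y′ B v w} → i ≢ j → k ≢ j → L T i ≡ A ++ y ∷ y′ ∷ B →
                Head (L T j) v → y ∼ v → Head (L T k) w → ¬ y′ ∼ w
    next-leaf b {i} {j} {k} i≢j k≢j ei hj y∼v hk e with k ≟ i
    ... | yes refl = leaf-leaf best′ i≢j (_ , leg-i) (head-j hk) e
      where open Transfer b i≢j ei hj y∼v
    ... | no k≢i   = leaf-leaf best′ (k≢i ∘ ≡-sym) (_ , leg-i) (head-k k≢i k≢j hk) e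
      where open Transfer b i≢j ei hj y∼v

    -- The edge `u ∼ y` lets the part before `y` be turned round, which makes `p` the leaf of leg
    -- `i`. When `A` is empty, `p` is that leaf already.
    rotate-leaf : ∀ {T} → Best T → ∀ {i j A p y B u v} → i ≢ j → L T i ≡ A ++ p ∷ y ∷ B → Head (L T i) u → u ∼ y →
                  Head (L T j) v → ¬ p ∼ v
    rotate-leaf b {A = []} i≢j ei hi u∼y hj e = leaf-leaf b i≢j (_ , ei) hj e
    rotate-leaf {T} b {i} {j} {a ∷ A} {p} {y} {B} {u} {v} i≢j ei (D , ei′) u∼y (E , ej) e =
      leaf-leaf best′ i≢j (_ , leg-i) (E , trans (leg-k (i≢j ∘ ≡-sym)) ej) e
      where
      a≡u : a ≡ u
      a≡u = ∷-injectiveˡ (trans (≡-sym ei) ei′)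
      N = p ∷ reverse A ++ a ∷ y ∷ B
      p-path : Path (N ++ at T i ∷ [])
      p-path = subst Path (≡-sym (++-assoc (p ∷ reverse A) _ _))
        (path-link (p ∷ reverse A)
          (subst Path (trans (unfold-reverse a (A ++ p ∷ [])) (cong (_++ a ∷ []) (reverse-snoc A)))
            (path-reverse (a ∷ A ++ p ∷ []) (leg-left T {A = a ∷ A} ei)))
          (subst (_∼ y) (≡-sym a≡u) u∼y)
          (leg-right T (a ∷ A ++ p ∷ []) (trans ei (≡-sym (++-assoc (a ∷ A) _ _)))))
      same : ∀ w → W w N ≡ W w (L T i)
      same w = trans (cong (w p +_) (trans (W-++ w (reverse A)) (cong (_+ W w (a ∷ y ∷ B)) (W-reverse w A))))
        (trans (solve 4 (λ p a c r → p :+ (c :+ (a :+ r)) := a :+ (c :+ (p :+ r))) refl (w p) (w a) (W w A) (W w (y ∷ B)))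
          (≡-sym (trans (cong (W w) ei) (cong (w a +_) (W-++ w A)))))
      open Move b i N (at T i) (at∈P T i) p-path same

    -- Otherwise y could be cut out of leg i and used to join the leaves of legs j and k.
    around : ∀ {T} → Best T → ∀ {i j k A p y q B u v} → i ≢ j → i ≢ k → j ≢ k → L T i ≡ A ++ p ∷ y ∷ q ∷ B →
             Head (L T j) u → Head (L T k) v → y ∼ u → y ∼ v → ¬ p ∼ q
    around {T} b {i} {j} {k} {A} {p} {y} {q} {B} {u} {v} i≢j i≢k j≢k ei (C , ej) (D , ek) y∼u y∼v p∼q =
      no-empty (relegs-best b L′ paths same) (upd-same k)
      where
      N = A ++ p ∷ q ∷ B
      M = reverse D ++ v ∷ y ∷ u ∷ C
      L₁ = upd j M (upd i N (L T))
      L′ = upd k [] L₁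
      same : ∀ w → ∑ (W w ∘ L′) ≡ ∑ (W w ∘ L T)
      same w = +-cancelʳ-≡ (W w (L T i) + W w (L T j) + W w (L T k)) _ _
        (trans (solve 4 (λ s a b c → s :+ ((a :+ b) :+ c) := ((s :+ c) :+ b) :+ a) refl (∑ (W w ∘ L′)) (W w (L T i)) (W w (L T j)) (W w (L T k)))
        (trans (cong (λ z → z + W w (L T j) + W w (L T i))
                 (trans (cong (λ z → ∑ (W w ∘ L′) + W w z) (≡-sym (trans (upd-other j (j≢k ∘ ≡-sym)) (upd-other i (i≢k ∘ ≡-sym)))))
                   (trans (∑-upd (W w) k L₁) (+-identityʳ _))))
        (trans (cong (_+ W w (L T i)) (trans (cong (λ z → ∑ (W w ∘ L₁) + W w z) (≡-sym (upd-other i (i≢j ∘ ≡-sym)))) (∑-upd (W w) j (upd i N (L T)))))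
        (trans (solve 3 (λ x y z → (x :+ y) :+ z := (x :+ z) :+ y) refl (∑ (W w ∘ upd i N (L T))) (W w M) (W w (L T i)))
        (trans (cong (_+ W w M) (∑-upd (W w) i (L T)))
        (trans (+-assoc (∑ (W w ∘ L T)) (W w N) (W w M)) (cong (∑ (W w ∘ L T) +_) pieces)))))))
        where
        pieces : W w N + W w M ≡ W w (L T i) + W w (L T j) + W w (L T k)
        pieces = trans (cong₂ _+_ (W-++ w A) (trans (W-++ w (reverse D)) (cong (_+ W w (v ∷ y ∷ u ∷ C)) (W-reverse w D))))
          (trans (solve 8 (λ a p qb d v y u c → (a :+ (p :+ qb)) :+ (d :+ (v :+ (y :+ (u :+ c)))) := ((a :+ (p :+ (y :+ qb))) :+ (u :+ c)) :+ (v :+ d)) refl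
                   (W w A) (w p) (W w (q ∷ B)) (W w D) (w v) (w y) (w u) (W w C))
            (≡-sym (cong₂ _+_ (cong₂ _+_ (trans (cong (W w) ei) (W-++ w A)) (cong (W w) ej)) (cong (W w) ek))))
      paths : ∀ m → PathTo T m (L′ m)
      paths = upd-∀ (PathTo T) k tt (upd-∀ (PathTo T) j
        (subst Path (≡-sym (++-assoc (reverse D) _ _))
          (path-link (reverse D) (subst Path (unfold-reverse v D) (path-reverse (v ∷ D) (path-prefix (v ∷ D) (leg-path T ek)))) (∼-sym y∼v)
            (y∼u , leg-path T ej)))
        (upd-∀ (PathTo T) i
          (subst Path (≡-sym (++-assoc A _ _)) (path-link A (leg-left T ei) p∼q
            (leg-right T (A ++ p ∷ y ∷ []) (trans ei (≡-sym (++-assoc A _ _))))))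
          (L-path T)))

    -- The two leg neighbours of `y` and three leaves would be the rays of a K₁,₅. The third leaf
    -- may be that of leg `i` itself, where `next-leaf` does not separate it from `p`; hence the two
    -- hypotheses on `p` and `w`.
    leg-star : ∀ {T} → Best T → ∀ {i j k l A p y q B u v w} → i ≢ j → i ≢ k → j ≢ k → l ≢ j → l ≢ k →
               L T i ≡ A ++ p ∷ y ∷ q ∷ B → Head (L T j) u → Head (L T k) v → Head (L T l) w →
               y ∼ u → y ∼ v → y ∼ w → ¬ p ∼ w → p ≢ w → ⊥
    leg-star {T} b {i} {j} {k} {l} {A} {p} {y} {q} {B} {u} {v} {w} i≢j i≢k j≢k l≢j l≢k ei hj hk hl y∼u y∼v y∼w p≁w p≢w =
      no-star free y
        (∼-sym p∼y ∷ y∼q ∷ y∼u ∷ y∼v ∷ y∼w ∷ [])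
        ((((λ { refl → leg-distinct T i ei (inj₂ (tl (hd refl))) refl }) , around b i≢j i≢k j≢k ei hj hk y∼u y∼v)
         ∷ (leg≢leg T i≢j p∈ (head∈ T hj) , λ e → next-leaf b i≢j (j≢k ∘ ≡-sym) ei hj e hk y∼v)
         ∷ (leg≢leg T i≢k p∈ (head∈ T hk) , λ e → next-leaf b i≢k j≢k ei hk e hj y∼u)
         ∷ (p≢w , p≁w) ∷ [])
        ∷ ((leg≢leg T i≢j q∈ (head∈ T hj) , next-leaf b i≢k j≢k ei′ hk y∼v hj)
         ∷ (leg≢leg T i≢k q∈ (head∈ T hk) , next-leaf b i≢j (j≢k ∘ ≡-sym) ei′ hj y∼u hk)
         ∷ (q≢w , next-leaf b i≢j l≢j ei′ hj y∼u hl) ∷ [])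
        ∷ (leaf-apart b j≢k hj hk ∷ leaf-apart b (l≢j ∘ ≡-sym) hj hl ∷ [])
        ∷ (leaf-apart b (l≢k ∘ ≡-sym) hk hl ∷ [])
        ∷ [] ∷ [])
      where
      ei′ : L T i ≡ (A ++ p ∷ []) ++ y ∷ q ∷ B
      ei′ = trans ei (≡-sym (++-assoc A _ _))
      p∈ : p ∈ L T i
      p∈ = mid∈ T A ei
      q∈ : q ∈ L T i
      q∈ = mid∈ T (A ++ p ∷ y ∷ []) (trans ei (≡-sym (++-assoc A _ _)))
      pyq : Path (p ∷ y ∷ q ∷ B ++ at T i ∷ [])
      pyq = leg-right T A ei
      p∼y = proj₁ pyq
      y∼q = proj₁ (proj₂ pyq)
      q≢w : q ≢ w
      q≢w q≡w with l ≟ i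
      ... | no l≢i = leg≢leg T (l≢i ∘ ≡-sym) q∈ (head∈ T hl) q≡w
      ... | yes refl = leg-distinct T i {A ++ p ∷ y ∷ []} {q} {B} (trans ei (≡-sym (++-assoc A _ _)))
            (inj₁ (subst (_∈ A ++ p ∷ y ∷ []) (≡-sym q≡w) w∈)) refl
        where
        w∈ : w ∈ A ++ p ∷ y ∷ []
        w∈ with head-prefix A {w = w} (proj₁ hl , trans (≡-sym ei) (proj₂ hl)) (y ∷ [])
        ... | E , e = subst (w ∈_) (≡-sym e) (hd refl)

    -- Leaf adjacencies counted on one leg.

    leaf : ∀ {T} → Best T → Fin 5 → V
    leaf b i = proj₁ (leg-head b i)

    leaf-head : ∀ {T} (b : Best T) i → Head (L T i) (leaf b i)
    leaf-head b i = proj₂ (leg-head b i)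

    near : ∀ {T} → Best T → Fin 5 → V → ℕ
    near b i y = bit (adj G (leaf b i) y)

    nearLeaves : ∀ {T} → Best T → V → ℕ
    nearLeaves b y = ∑ (λ i → near b i y)

    -- Of all adjacencies between leaves and the spine only one is booked here, from the leaf of leg
    -- `c` to the vertex it hangs from; the others are booked with the spine in `sparse`.
    load : ∀ {T} → Best T → Fin 5 → ℕ
    load {T} b c = W (nearLeaves b) (L T c) + near b c (at T c)

    -- The edge `y∼j₀` allows `s` to become a leaf, so the old leaf and `s` are two independent
    -- neighbours of `at T c` with the same restrictions. The vertex `x` is a place to cut the leg,
    -- with two legs to choose from for the transfer.
    record Over {T} (b : Best T) (c : Fin 5) : Set where
      field
        leaf∼at : leaf b c ∼ at T c
        {A₀ A₁ B₁} : List V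
        {y s x} : V
        tail≡ : L T c ≡ A₀ ++ y ∷ s ∷ []
        {j₀ j k} : Fin 5
        j₀≢c : j₀ ≢ c
        y∼j₀ : y ∼ leaf b j₀
        leaf≁s : ¬ leaf b c ∼ s
        mid≡ : L T c ≡ A₁ ++ x ∷ B₁
        j≢k : j ≢ k
        j≢c : j ≢ c
        k≢c : k ≢ c
        x∼j : x ∼ leaf b j
        x∼k : x ∼ leaf b k

    avoid : ∀ {j k : Fin 5} l → j ≢ k → j ≢ l ⊎ k ≢ l
    avoid {j} l j≢k with j ≟ l
    ... | no j≢l   = inj₁ j≢l
    ... | yes refl = inj₂ (j≢k ∘ ≡-sym)

    head∈prefix : ∀ {A x B u} → A ≢ [] → Head (A ++ x ∷ B) u → u ∈ A
    head∈prefix {[]}    ne h       = ⊥-elim (ne refl)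
    head∈prefix {a ∷ A} ne (D , e) = hd (≡-sym (∷-injectiveˡ e))

    module LegLoad {T} (b : Best T) (c : Fin 5) where

      private
        a r : V → ℕ
        a = near b c
        r y = ∑ (λ j → near b (punchIn c j) y)

        punch≢ : ∀ {i j : Fin 4} → i ≢ j → punchIn c i ≢ punchIn c j
        punch≢ i≢j e = i≢j (punchIn-injective c _ _ e)

        hit : ∀ {j y} → 1 ≤ near b j y → y ∼ leaf b j
        hit p = ∼-sym (bit-true p)

        a-hit : ∀ {y} → a y ≡ 1 → leaf b c ∼ y
        a-hit e = bit-true (≤-reflexive (≡-sym e))

        a-miss : ∀ {y} → a y ≡ 0 → ¬ leaf b c ∼ y
        a-miss e p with trans (≡-sym (cong bit p)) e
        ... | ()

        r-zero : ∀ {y} → (∀ {l} → l ≢ c → ¬ y ∼ leaf b l) → r y ≡ 0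
        r-zero h = ∑-zero (λ j → bit-false (λ e → h (punchInᵢ≢i c j) (∼-sym e)))

        record Two (y : V) : Set where
          constructor two
          field
            {j k} : Fin 5
            j≢k : j ≢ k
            j≢c : j ≢ c
            k≢c : k ≢ c
            y∼j : y ∼ leaf b j
            y∼k : y ∼ leaf b k

        r-two : ∀ {y} → r y ≡ 2 → Two y
        r-two {y} e with ∑bit-two (λ j → adj G (leaf b (punchIn c j)) y) (≤-reflexive (≡-sym e))
        ... | j , k , j≢k , p , q = two (punch≢ j≢k) (punchInᵢ≢i c j) (punchInᵢ≢i c k) (∼-sym p) (∼-sym q)

        two-avoiding : ∀ {y} → Two y → ∀ l → Σ (Fin 5) λ m → m ≢ c × m ≢ l × y ∼ leaf b m
        two-avoiding (two {j} {k} j≢k j≢c k≢c p q) l with avoid l j≢k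
        ... | inj₁ x = j , j≢c , x , p
        ... | inj₂ x = k , k≢c , x , q

        H : ∀ i → Head (L T i) (leaf b i)
        H = leaf-head b

        Three : V → Set
        Three y = Σ (Fin 4) λ i → Σ (Fin 4) λ j → Σ (Fin 4) λ l → (i ≢ j × i ≢ l × j ≢ l) ×
          leaf b (punchIn c i) ∼ y × leaf b (punchIn c j) ∼ y × leaf b (punchIn c l) ∼ y

        -- If `x` is the first or the last vertex of the leg, one edge to another leaf is already
        -- too many; in between, three such edges contradict `leg-star`.
        no-three : ∀ A {x} B → L T c ≡ A ++ x ∷ B → ¬ Three x
        no-three A {x} B e (j , k , l , (j≢k , j≢l , k≢l) , p , q , s) = go (unsnoc A) B e
          where
          go : (A ≡ [] ⊎ Σ (List V) λ A′ → Σ V λ w → A ≡ A′ ++ w ∷ []) → ∀ B → L T c ≡ A ++ x ∷ B → ⊥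
          go (inj₁ refl) B e  = leaf-leaf b (punchInᵢ≢i c j ∘ ≡-sym) (_ , e) (H _) (∼-sym p)
          go (inj₂ _)    [] e = last-leaf b (punchInᵢ≢i c j ∘ ≡-sym) (A , e) (H _) (∼-sym p)
          go (inj₂ (A′ , w , refl)) (z ∷ B′) e =
            leg-star b {l = punchIn c l} (punchInᵢ≢i c j ∘ ≡-sym) (punchInᵢ≢i c k ∘ ≡-sym) (punch≢ j≢k) (punch≢ (j≢l ∘ ≡-sym)) (punch≢ (k≢l ∘ ≡-sym))
              e′ (H _) (H _) (H _) (∼-sym p) (∼-sym q) (∼-sym s)
              (λ w∼l → next-leaf b (punchInᵢ≢i c l ∘ ≡-sym) (punch≢ j≢l) e′ (H _) w∼l (H _) (∼-sym p))
              (leg≢leg T (punchInᵢ≢i c l ∘ ≡-sym) (mid∈ T A′ e′) (head∈ T (H _)))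
            where
            e′ : L T c ≡ A′ ++ w ∷ x ∷ z ∷ B′
            e′ = trans e (++-assoc A′ _ _)

        r≤2 : ∀ {A x B} → L T c ≡ A ++ x ∷ B → r x ≤ 2
        r≤2 {A} {x} {B} e = ≮⇒≥ (λ p → no-three A B e (∑bit-three (λ j → adj G (leaf b (punchIn c j)) x) p))

        r-last : ∀ {A x} → L T c ≡ A ++ x ∷ [] → r x ≡ 0
        r-last {A} e = r-zero (λ l≢c → last-leaf b (l≢c ∘ ≡-sym) (A , e) (H _))

        r-before-a : ∀ {A x y B} → L T c ≡ A ++ x ∷ y ∷ B → a y ≡ 1 → r x ≡ 0
        r-before-a e ay = r-zero (λ l≢c → rotate-leaf b (l≢c ∘ ≡-sym) e (H c) (a-hit ay) (H _))

        r-after-2 : ∀ {A x y B} → L T c ≡ A ++ x ∷ y ∷ B → r x ≡ 2 → r y ≡ 0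
        r-after-2 e rx = r-zero λ {l} l≢c y∼l → let (m , m≢c , m≢l , x∼m) = two-avoiding (r-two rx) l in
          next-leaf b (m≢c ∘ ≡-sym) (m≢l ∘ ≡-sym) e (H m) x∼m (H l) y∼l

        resplit : ∀ {A v C} → v ∈ A → L T c ≡ A ++ C → Σ (List V) λ A₁ → Σ (List V) λ A₂ → L T c ≡ A₁ ++ v ∷ A₂ ++ C
        resplit p e with split-∈ p
        ... | A₁ , A₂ , refl = A₁ , A₂ , trans e (++-assoc A₁ _ _)

        Resplit : List V → V → List V → Set
        Resplit A v C = Σ (List V) λ A₁ → Σ (List V) λ A₂ → L T c ≡ A₁ ++ v ∷ A₂ ++ C

        -- Cutting behind `v` moves the old leaf of leg `c` to leg `m`. Then `x` is adjacent to the
        -- leaf of a different leg and `next-leaf` applies to `x` and `y`; taking `m` different from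
        -- `l` keeps leg `l` intact.
        r-after-a : ∀ {A x y B v} → v ∈ A → r v ≡ 2 → L T c ≡ A ++ x ∷ y ∷ B → a x ≡ 1 → r y ≡ 0
        r-after-a {A} {x} {y} {B} {v} v∈A rv e ax =
          r-zero (λ {l} l≢c y∼l → go l≢c y∼l (resplit v∈A e) (two-avoiding (r-two rv) l))
          where
          go : ∀ {l} → l ≢ c → y ∼ leaf b l → Resplit A v (x ∷ y ∷ B) → (Σ (Fin 5) λ m → m ≢ c × m ≢ l × v ∼ leaf b m) → ⊥
          go {l} l≢c y∼l (A₁ , A₂ , e′) (m , m≢c , m≢l , v∼m) =
            next-leaf best′ (m≢c ∘ ≡-sym) (m≢l ∘ ≡-sym) leg-i (head-j (H c)) (∼-sym (a-hit ax)) (head-k l≢c (m≢l ∘ ≡-sym) (H l)) y∼l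
            where open Transfer b (m≢c ∘ ≡-sym) e′ (H m) v∼m

        a-last : ∀ {A x v} → v ∈ A → r v ≡ 2 → L T c ≡ A ++ x ∷ [] → a x ≡ 0
        a-last {A} {x} {v} v∈A rv e = bit-false (λ c∼x → go c∼x (resplit v∈A e) (r-two rv))
          where
          go : leaf b c ∼ x → Resplit A v (x ∷ []) → Two v → ⊥
          go c∼x (A₁ , A₂ , e′) (two {j} _ j≢c _ v∼j _) = last-leaf best′ (j≢c ∘ ≡-sym) (A₂ , leg-i) (head-j (H c)) (∼-sym c∼x)
            where open Transfer b (j≢c ∘ ≡-sym) e′ (H j) v∼j

        nonempty : ∀ {A : List V} {v} → v ∈ A → A ≢ []
        nonempty () refl

        -- Two other leaves, the leaf of leg `c`, `x` and the successor of `y` would form a K₁,₅ at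
        -- `y`. The earlier vertex `v` ensures that `x` is not the leaf itself.
        r-first-a : ∀ {A x y B v} → v ∈ A → r v ≡ 2 → L T c ≡ A ++ x ∷ y ∷ B → a x ≡ 0 → a y ≡ 1 → r y ≢ 2
        r-first-a {A} {x} {y} {B} v∈A rv e ax ay ry = go B e (r-two ry)
          where
          go : ∀ B → L T c ≡ A ++ x ∷ y ∷ B → Two y → ⊥
          go [] e _ = 0≢2 (trans (≡-sym (r-last {A ++ x ∷ []} (trans e (≡-sym (++-assoc A _ _))))) ry)
            where
            0≢2 : 0 ≢ 2
            0≢2 ()
          go (z ∷ B) e (two j≢k j≢c k≢c y∼j y∼k) =
            leg-star b {l = c} (j≢c ∘ ≡-sym) (k≢c ∘ ≡-sym) j≢k (j≢c ∘ ≡-sym) (k≢c ∘ ≡-sym) e (H _) (H _) (H c) y∼j y∼k (∼-sym (a-hit ay))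
              (λ x∼c → a-miss ax (∼-sym x∼c))
              (λ x≡c → leg-distinct T c e (inj₁ (head∈prefix (nonempty v∈A) (subst (λ xs → Head xs (leaf b c)) e (H c)))) (≡-sym x≡c))

        open Charge a r (L T c) (at T c) (λ x → bit≤1 _) r≤2 r-last r-before-a r-after-2 r-after-a a-last r-first-a

        u = leaf b c
        D = proj₁ (H c)

        main : Goal 0 u D
        main = neutral [] u D (proj₂ (H c))

        split : ∀ y → a y + r y ≡ nearLeaves b y
        split y = ≡-sym (sum-remove {i = c} (λ i → near b i y))

        a-leaf : a u ≡ 0
        a-leaf = bit-false ∼-irrefl

        -- The adjacency omitted by `S` at its first vertex is that of the leaf with itself, which
        -- is 0.
        S≡load : S u D ≡ load b c
        S≡load = cong (_+ a (at T c)) (trans (cong (λ m → m + r u + W (λ x → a x + r x) D) (≡-sym a-leaf))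
          (trans (W-cong split (u ∷ D)) (cong (W (nearLeaves b)) (≡-sym (proj₂ (H c))))))

        len : suc (length D) ≡ length (L T c)
        len = cong length (≡-sym (proj₂ (H c)))

        over : Overload → Over b c
        over (az , (A , y , s , e , ry , as) , (x , x∈ , rx)) = go (∑-positive _ ry) (split-∈ x∈) (r-two rx)
          where
          go : (Σ (Fin 4) λ j → 1 ≤ near b (punchIn c j) y) → (Σ (List V) λ A → Σ (List V) λ B → L T c ≡ A ++ x ∷ B) → Two x → Over b c
          go (j , p) (A₁ , B₁ , e₁) (two j≢k j≢c k≢c x∼j x∼k) = record
            { leaf∼at = a-hit az ; tail≡ = e ; j₀≢c = punchInᵢ≢i c j ; y∼j₀ = hit p ; leaf≁s = a-miss as
            ; mid≡ = e₁ ; j≢k = j≢k ; j≢c = j≢c ; k≢c = k≢c ; x∼j = x∼j ; x∼k = x∼k }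

      leg-bound : load b c ≤ length (L T c) ⊎ (load b c ≤ suc (length (L T c)) × Over b c)
      leg-bound = map⊎ (subst₂ _≤_ S≡load len) (λ (p , o) → subst₂ _≤_ S≡load (cong suc len) p , over o) (proj₁ main)

      leg-slack : ¬ leaf b c ∼ at T c → (∀ {A y s} → L T c ≡ A ++ y ∷ s ∷ [] → ∀ {l} → l ≢ c → ¬ y ∼ leaf b l) →
                  load b c < length (L T c)
      leg-slack h k = subst₂ _<_ S≡load len (proj₂ main (bit-false h , λ e → r-zero (k e)))

    open LegLoad public using (leg-bound; leg-slack)

    -- Neighbours of the spine vertex from which a leg hangs.

    -- s can be made the leaf of leg c without changing the spine or the ends of the other legs.
    record Pendant (T : Cfg 5) (c : Fin 5) (s : V) : Set where
      field
        T* : Cfg 5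
        best* : Best T*
        P* : P T* ≡ P T
        at* : ∀ k → at T* k ≡ at T k
        head* : Head (L T* c) s
        last* : ∀ {k t} → k ≢ c → Last (L T k) t → Last (L T* k) t

    reverse-path : ∀ (T : Cfg 5) {c u x} → Head (L T c) u → u ∼ x → Path (reverse (L T c) ++ x ∷ [])
    reverse-path T {c} {u} {x} (D , e) u∼x = subst (λ xs → Path (xs ++ x ∷ [])) (≡-sym (trans (cong reverse e) (unfold-reverse u D)))
      (subst Path (≡-sym (++-assoc (reverse D) _ _))
        (path-link (reverse D) (subst Path (unfold-reverse u D) (path-reverse (u ∷ D) (path-prefix (u ∷ D) (leg-path T e)))) u∼x tt))

    -- The leg is turned round: it hangs from `x` by its old leaf, and its old last vertex becomes
    -- the leaf.
    module Reattach {T} (b : Best T) {i u x} (x∈ : x ∈ P T) (h : Head (L T i) u) (u∼x : u ∼ x) where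
      open Move b i (reverse (L T i)) x x∈ (reverse-path T h u∼x) (λ w → W-reverse w (L T i)) public

      head-i : ∀ {s} → Last (L T i) s → Head (L T′ i) s
      head-i {s} la = subst (λ xs → Head xs s) (≡-sym leg-i) (Head-reverse la)

    pendant-reverse : ∀ {T} (b : Best T) {c u s} → Head (L T c) u → Last (L T c) s → u ∼ at T c → Pendant T c s
    pendant-reverse {T} b {c} h la u∼at = record
      { T* = T′ ; best* = best′ ; P* = refl ; at* = at-same ; head* = head-i la
      ; last* = λ {k} {t} k≢c → subst (λ xs → Last xs t) (≡-sym (leg-k k≢c)) }
      where
      open Reattach b (at∈P T c) h u∼at
      at-same : ∀ k → at T′ k ≡ at T k
      at-same k with k ≟ c
      ... | yes refl = at-i
      ... | no k≢c   = at-k k≢c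

    pendant-transfer : ∀ {T} (b : Best T) {c j A y s v} → j ≢ c → L T c ≡ A ++ y ∷ s ∷ [] → Head (L T j) v → y ∼ v → Pendant T c s
    pendant-transfer b j≢c e hj y∼v = record
      { T* = T′ ; best* = best′ ; P* = refl ; at* = λ _ → refl ; head* = [] , leg-i ; last* = last-other }
      where open Transfer b (j≢c ∘ ≡-sym) e hj y∼v

    -- A neighbour of the spine vertex at c, other than those in leg c, along the tree.
    Side : Cfg 5 → Fin 5 → V → Set
    Side T c e = (Σ (Fin 5) λ k → k ≢ c × at T k ≡ at T c × Last (L T k) e) ⊎ Next (P T) (at T c) e

    side∼ : ∀ (T : Cfg 5) {c e} → Side T c e → at T c ∼ e
    side∼ T (inj₁ (k , _ , eq , la)) = subst (_∼ _) eq (∼-sym (last∼at T la))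
    side∼ T (inj₂ nx)                = next∼ T nx

    side-leaf : ∀ {T} → Best T → ∀ {c e u} → Side T c e → Head (L T c) u → ¬ u ∼ e
    side-leaf b (inj₁ (k , k≢c , _ , la)) h u∼e = last-leaf b k≢c la h (∼-sym u∼e)
    side-leaf b (inj₂ nx)                 h u∼e = leaf-next b nx h u∼e

    side≢ : ∀ (T : Cfg 5) {c e u} → Side T c e → u ∈ L T c → u ≢ e
    side≢ T (inj₁ (k , k≢c , _ , la)) u∈ = leg≢leg T (k≢c ∘ ≡-sym) u∈ (last∈ T la)
    side≢ T (inj₂ nx)                 u∈ = leg≢spine T u∈ (next∈ nx)

    -- In `T*` the vertex `s` is a leaf while `e` is still a side neighbour, so `side-leaf` applies
    -- there.
    side-pendant : ∀ {T c s e} → Pendant T c s → Side T c e → ¬ s ∼ e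
    side-pendant p (inj₁ (k , k≢c , eq , la)) = side-leaf best* (inj₁ (k , k≢c , trans (at* _) (trans eq (≡-sym (at* _))) , last* k≢c la)) head*
      where open Pendant p
    side-pendant {T} {c} {e = e} p (inj₂ nx) =
      side-leaf best* (inj₂ (subst₂ (λ P z → Next P z e) (≡-sym P*) (≡-sym (at* c)) nx)) head*
      where open Pendant p

    last-snoc : ∀ A {y s : V} → Last (A ++ y ∷ s ∷ []) s
    last-snoc A {y} = A ++ y ∷ [] , ≡-sym (++-assoc A _ _)

    -- An edge from `s` to a side neighbour shows that `s` cannot be made a leaf. So neither turning
    -- the leg round nor transferring everything before `s` is possible, which is what `leg-slack`
    -- requires.
    side-slack : ∀ {T} (b : Best T) {c e s} → Side T c e → Last (L T c) s → s ∼ e → load b c < length (L T c)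
    side-slack {T} b {c} {e} {s} sd la s∼e = leg-slack b c
      (λ u∼at → side-pendant (pendant-reverse b (leaf-head b c) la u∼at) sd s∼e)
      (λ {A} {y} {t} eq {l} l≢c y∼l → side-pendant (pendant-transfer b l≢c eq (leaf-head b l) y∼l) sd
        (subst (_∼ e) (last-unique la (subst (λ xs → Last xs t) (≡-sym eq) (last-snoc A))) s∼e))

    over-last : ∀ {T} {b : Best T} {c} (o : Over b c) → Last (L T c) (Over.s o)
    over-last {T} o = subst (λ xs → Last xs s) (≡-sym tail≡) (last-snoc A₀)
      where open Over o

    over-pendant : ∀ {T} (b : Best T) {c} (o : Over b c) → Pendant T c (Over.s o)
    over-pendant b o = pendant-transfer b j₀≢c tail≡ (leaf-head b j₀) y∼j₀
      where open Over o

    over-apart : ∀ {T} (b : Best T) {c} (o : Over b c) → Apart (leaf b c) (Over.s o)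
    over-apart {T} b {c} o = leg-distinct T c {A₀ ++ y ∷ []} {s} {[]} eq (inj₁ (head∈prefix (snoc≢[] A₀) (subst (λ xs → Head xs (leaf b c)) eq (leaf-head b c)))) , leaf≁s
      where
      open Over o
      eq : L T c ≡ (A₀ ++ y ∷ []) ++ s ∷ []
      eq = trans tail≡ (≡-sym (++-assoc A₀ _ _))
      snoc≢[] : ∀ A → A ++ y ∷ [] ≢ []
      snoc≢[] []      ()
      snoc≢[] (_ ∷ _) ()

    side-apart : ∀ {T} (b : Best T) {c e} (o : Over b c) → Side T c e → Apart (leaf b c) e × Apart (Over.s o) e
    side-apart {T} b o sd = (side≢ T sd (head∈ T (leaf-head b _)) , side-leaf b sd (leaf-head b _)) ,
      (side≢ T sd (last∈ T (over-last o)) , side-pendant (over-pendant b o) sd)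

    -- The leaf and the last vertex of an overloaded leg are already two rays at `at T c`, so three
    -- more are enough.
    over-star : ∀ {T} (b : Best T) {c} (o : Over b c) {e₁ e₂ e₃} → All (at T c ∼_) (e₁ ∷ e₂ ∷ e₃ ∷ []) →
                All (λ e → Apart (leaf b c) e × Apart (Over.s o) e) (e₁ ∷ e₂ ∷ e₃ ∷ []) →
                AllPairs (Apart) (e₁ ∷ e₂ ∷ e₃ ∷ []) → ⊥
    over-star {T} b o adj ap pairs = no-star free (at T _) (∼-sym leaf∼at ∷ ∼-sym (last∼at T (over-last o)) ∷ adj)
      ((over-apart b o ∷ All.map proj₁ ap) ∷ All.map proj₂ ap ∷ pairs)
      where open Over o

    -- Two overloaded legs at the same spine vertex would give a K₁,₅ there.
    over-unique : ∀ {T} (b : Best T) {c d e} → c ≢ d → at T c ≡ at T d → Over b c → Over b d → Side T c e → Side T d e → ⊥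
    over-unique {T} b {c} {d} {e} c≢d eq oc od sc sd = over-star b oc
      (subst (_∼ leaf b d) (≡-sym eq) (∼-sym (Over.leaf∼at od)) ∷ side∼ T side-d ∷ side∼ T sc ∷ [])
      ((leaf-apart b c≢d (leaf-head b c) (leaf-head b d) ,
         (leg≢leg T c≢d (last∈ T (over-last oc)) (head∈ T (leaf-head b d)) , last-leaf b c≢d (over-last oc) (leaf-head b d)))
       ∷ side-apart b oc side-d ∷ side-apart b oc sc ∷ [])
      ((over-apart b od ∷ proj₁ (side-apart b od sd) ∷ []) ∷ (proj₂ (side-apart b od sd) ∷ []) ∷ [] ∷ [])
      where
      side-d : Side T c (Over.s od)
      side-d = inj₁ (d , c≢d ∘ ≡-sym , ≡-sym eq , over-last od)

    -- The degree sum of the five leaves.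

    module Dense (dense : σ≥ G 5 (n ∸ 1)) where

      -- The five leaves are independent, so their degree sum, all of which is spent inside T, is at least n − 1.
      dense-leaves : ∀ {T} (b : Best T) → n ∸ 1 ≤ weight (nearLeaves b) T
      dense-leaves {T} b = ≤-trans (dense (leaf b) (inj , indep))
        (subst (_≤ weight (nearLeaves b) T) (≡-sym degrees) (subst (∑ (nearLeaves b) ≤_) (weight-∑ (nearLeaves b) T) (∑-mono inside)))
        where
        inj : ∀ {i j} → leaf b i ≡ leaf b j → i ≡ j
        inj {i} {j} e with i ≟ j
        ... | yes p = p
        ... | no ne = ⊥-elim (proj₁ (leaf-apart b ne (leaf-head b i) (leaf-head b j)) e)
        indep : ∀ i j → ¬ leaf b i ∼ leaf b j
        indep i j with i ≟ j
        ... | yes refl = ∼-irrefl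
        ... | no ne    = leaf-leaf b ne (leaf-head b i) (leaf-head b j)
        degrees : sum (map (λ i → deg G (leaf b i)) (allFin 5)) ≡ ∑ (nearLeaves b)
        degrees = trans (sum-allFin (λ i → deg G (leaf b i)))
          (trans (sum-cong-≗ (λ i → sum-allFin (near b i))) (∑-comm (near b)))
        inside : ∀ v → nearLeaves b v ≤ weight (δ v) T * nearLeaves b v
        inside v = go (1 ≤? weight (δ v) T)
          where
          far : ¬ 1 ≤ weight (δ v) T → ∀ i → near b i v ≡ 0
          far ¬p i = bit-false (λ e → ¬p (leaf-inside b (leaf-head b i) e))
          go : Dec (1 ≤ weight (δ v) T) → nearLeaves b v ≤ weight (δ v) T * nearLeaves b v
          go (yes p) = ≤-trans (≤-reflexive (≡-sym (+-identityʳ (nearLeaves b v)))) (*-monoˡ-≤ (nearLeaves b v) p)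
          go (no ¬p) = subst (_≤ weight (δ v) T * nearLeaves b v) (≡-sym (∑-zero {f = λ i → near b i v} (far ¬p))) z≤n

      -- Here e j bounds the number of neighbours of the leaf of leg j on the spine, other than at j.
      sparse : ∀ {T} (b : Best T) (e : Fin 5 → ℕ) → (∀ j → W (near b j) (P T) ≤ near b j (at T j) + e j) →
               ∑ (load b) + ∑ e + 2 ≤ length (P T) + ∑ (λ i → length (L T i)) → ⊥
      -- The degree sum is at least `n ∸ 1`, so two spare vertices would give a tree with more than
      -- `n` vertices.
      sparse {T} b e h le = pred-bound n (≤-trans (+-monoˡ-≤ 2 (≤-trans (dense-leaves b) bound))
          (≤-trans le (≤-trans (≤-reflexive (≡-sym (size-lengths T))) (size≤n T))))
        where
        pred-bound : ∀ n → n ∸ 1 + 2 ≤ n → ⊥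
        pred-bound (suc n) p = 1+n≰n (≤-trans (≤-reflexive (+-comm 2 n)) p)
        legs = ∑ (λ i → W (nearLeaves b) (L T i))
        ends = ∑ (λ i → near b i (at T i))
        bound : weight (nearLeaves b) T ≤ ∑ (load b) + ∑ e
        bound = begin
          W (nearLeaves b) (P T) + legs             ≡⟨ cong (_+ legs) (W-∑ (near b) (P T)) ⟩
          ∑ (λ j → W (near b j) (P T)) + legs       ≤⟨ +-monoˡ-≤ legs (∑-mono h) ⟩
          ∑ (λ j → near b j (at T j) + e j) + legs  ≡⟨ cong (_+ legs) (∑-distrib-+ (λ j → near b j (at T j)) e) ⟩
          ends + ∑ e + legs                         ≡⟨ solve 3 (λ x y z → (x :+ y) :+ z := (z :+ x) :+ y) refl ends (∑ e) legs ⟩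
          legs + ends + ∑ e                         ≡⟨ cong (_+ ∑ e) (≡-sym (∑-distrib-+ (λ i → W (nearLeaves b) (L T i)) (λ i → near b i (at T i)))) ⟩
          ∑ (load b) + ∑ e                          ∎
          where open ≤-Reasoning

      near-only : ∀ {T} (b : Best T) j {z} → (∀ {x} → x ∈ P T → x ≢ z → ¬ leaf b j ∼ x) → W (near b j) (P T) ≤ near b j z
      near-only {T} b j {z} h = ≤-trans (W-mono (P T) (λ {x} → pointwise x)) (≤-trans (≤-reflexive (W-* (δ z) (near b j z) (P T)))
        (≤-trans (*-monoˡ-≤ (near b j z) (≤-trans (m≤m+n (mult z (P T)) (∑ (λ i → mult z (L T i)))) (simple T z))) (≤-reflexive (+-identityʳ (near b j z)))))
        where
        pointwise : ∀ x → x ∈ P T → near b j x ≤ δ z x * near b j z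
        pointwise x p with z ≟ x
        ... | yes refl = ≤-reflexive (≡-sym (+-identityʳ _))
        ... | no z≢x   = ≤-reflexive (bit-false (h p (z≢x ∘ ≡-sym)))

      near-length : ∀ {T} (b : Best T) j xs → W (near b j) xs ≤ length xs
      near-length b j xs = W-≤-length xs (λ _ → bit≤1 _)

      private
        ∈-single : ∀ {x y : V} → x ∈ y ∷ [] → x ≡ y
        ∈-single (hd e) = e

      -- The last vertex of a third leg is the common side neighbour needed by `over-unique` when
      -- the spine is one vertex.
      third : ∀ (c d : Fin 5) → Σ (Fin 5) λ e → e ≢ c × e ≢ d
      third c d with 0F ≟ c | 0F ≟ d | 1F ≟ c | 1F ≟ d
      ... | no p | no q | _ | _ = 0F , p , q
      ... | yes refl | _ | _ | no q = 1F , (λ ()) , q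
      ... | yes refl | _ | _ | yes refl = 2F , (λ ()) , (λ ())
      ... | no _ | yes refl | no p | _ = 1F , p , (λ ())
      ... | no _ | yes refl | yes refl | _ = 2F , (λ ()) , (λ ())

      -- The five last vertices are neighbours of `s`, so two of them are adjacent. Their two legs
      -- are then below their lengths by `side-slack`, and at most one leg is overloaded; the net
      -- gain of one and the spine vertex are the two spare vertices.
      singleton-case : ∀ {T} (b : Best T) {s} → P T ≡ s ∷ [] → ⊥
      singleton-case {T} b {s} eP = adjacent-ends (any? (λ a → any? (λ c → ¬? (a ≟ c) ×-dec (adj G (end a) (end c) ≟ᵇ true))))
        where
        end : Fin 5 → V
        end i = proj₁ (leg-last b i)
        end-last : ∀ i → Last (L T i) (end i)
        end-last i = proj₂ (leg-last b i)
        at≡ : ∀ i → at T i ≡ s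
        at≡ i = ∈-single (subst (_ ∈_) eP (at∈P T i))
        same-at : ∀ i j → at T i ≡ at T j
        same-at i j = trans (at≡ i) (≡-sym (at≡ j))
        side : ∀ {i j} → j ≢ i → Side T i (end j)
        side {i} {j} j≢i = inj₁ (j , j≢i , same-at j i , end-last j)
        unique : ∀ {c d} → Over b c → d ≢ c → load b d ≤ length (L T d)
        unique {c} {d} o d≢c = go (leg-bound b d)
          where
          go : (load b d ≤ length (L T d)) ⊎ (load b d ≤ suc (length (L T d)) × Over b d) → load b d ≤ length (L T d)
          go (inj₁ p) = p
          go (inj₂ (_ , o′)) = let (e , e≢c , e≢d) = third c d in
            ⊥-elim (over-unique b (d≢c ∘ ≡-sym) (same-at c d) o o′ (side e≢c) (side e≢d))
        spine-near : ∀ j → W (near b j) (P T) ≤ near b j (at T j) + 0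
        spine-near j = ≤-reflexive (trans (cong (W (near b j)) eP) (cong (λ z → near b j z + 0) (≡-sym (at≡ j))))
        finish : ∀ {a c} → a ≢ c → load b a < length (L T a) → load b c < length (L T c) →
                 (f : Fin 5 → ℕ) → ∑ f ≤ 1 → (∀ i → load b i ≤ length (L T i) + f i) → ⊥
        finish {a} {c} a≢c la lc f f≤1 h = sparse b (λ _ → 0) spine-near
          (≤-trans (≤-reflexive (cong (_+ 2) (+-identityʳ (∑ (load b)))))
            (≤-trans (≤-reflexive (+-comm (∑ (load b)) 2)) (subst (λ xs → 2 + ∑ (load b) ≤ length xs + lens) (≡-sym eP) ∑<)))
          where
          lens = ∑ (λ i → length (L T i))
          lo : Fin 5 → ℕ
          lo = load b
          marks : Fin 5 → ℕ
          -- Legs `a` and `c` each have one unit of slack, which `marks` returns to their loads; `f`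
          -- marks the possible overload.
          marks = upd c 1 (upd a 1 (λ _ → 0))
          ones : ∀ i → marks i + lo i ≤ length (L T i) + f i
          ones i = go (i ≟ c) (i ≟ a)
            where
            go : Dec (i ≡ c) → Dec (i ≡ a) → marks i + lo i ≤ length (L T i) + f i
            go (yes refl) _ = ≤-trans (≤-reflexive (cong (_+ lo i) (upd-same c))) (≤-trans lc (m≤m+n _ (f i)))
            go (no i≢c) (yes refl) = ≤-trans (≤-reflexive (cong (_+ lo i) (trans (upd-other c i≢c) (upd-same a)))) (≤-trans la (m≤m+n _ (f i)))
            go (no i≢c) (no i≢a) = ≤-trans (≤-reflexive (cong (_+ lo i) (trans (upd-other c i≢c) (upd-other a i≢a)))) (h i)
          ∑marks : ∑ marks ≡ 2
          ∑marks = trans (trans (≡-sym (+-identityʳ (∑ marks))) (trans (cong (∑ marks +_) (≡-sym (upd-other a (a≢c ∘ ≡-sym))))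
            (∑-upd (λ x → x) c (upd a 1 (λ _ → 0))))) (cong (_+ 1) (∑-single a 1))
          ∑< : 2 + ∑ lo ≤ 1 + lens
          ∑< = begin
            2 + ∑ lo                            ≡⟨ cong (_+ ∑ lo) (≡-sym ∑marks) ⟩
            ∑ marks + ∑ lo                      ≡⟨ ≡-sym (∑-distrib-+ marks lo) ⟩
            ∑ (λ i → marks i + lo i)            ≤⟨ ∑-mono ones ⟩
            ∑ (λ i → length (L T i) + f i)      ≡⟨ ∑-distrib-+ (λ i → length (L T i)) f ⟩
            lens + ∑ f                          ≤⟨ +-monoʳ-≤ lens f≤1 ⟩
            lens + 1                            ≡⟨ +-comm lens 1 ⟩
            1 + lens                            ∎
            where open ≤-Reasoning
        adjacent-ends : Dec (Σ (Fin 5) λ a → Σ (Fin 5) λ c → ¬ a ≡ c × end a ∼ end c) → ⊥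
        adjacent-ends (no none) = no-star free s
          (toEnd 0F ∷ toEnd 1F ∷ toEnd 2F ∷ toEnd 3F ∷ toEnd 4F ∷ [])
          ((ap 0F 1F (λ ()) ∷ ap 0F 2F (λ ()) ∷ ap 0F 3F (λ ()) ∷ ap 0F 4F (λ ()) ∷ [])
           ∷ (ap 1F 2F (λ ()) ∷ ap 1F 3F (λ ()) ∷ ap 1F 4F (λ ()) ∷ [])
           ∷ (ap 2F 3F (λ ()) ∷ ap 2F 4F (λ ()) ∷ []) ∷ (ap 3F 4F (λ ()) ∷ []) ∷ [] ∷ [])
          where
          toEnd : ∀ i → s ∼ end i
          toEnd i = ∼-sym (subst (end i ∼_) (at≡ i) (last∼at T (end-last i)))
          ap : ∀ i j → i ≢ j → Apart (end i) (end j)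
          ap i j i≢j = leg≢leg T i≢j (last∈ T (end-last i)) (last∈ T (end-last j)) , λ e → none (i , j , i≢j , e)
        adjacent-ends (yes (a , c , a≢c , e)) = go (choose (leg-bound b))
          where
          la : load b a < length (L T a)
          la = side-slack b (side (a≢c ∘ ≡-sym)) (end-last a) e
          lc : load b c < length (L T c)
          lc = side-slack b (side a≢c) (end-last c) (∼-sym e)
          go : (∀ i → load b i ≤ length (L T i)) ⊎ (Σ (Fin 5) λ i → load b i ≤ suc (length (L T i)) × Over b i) → ⊥
          go (inj₁ all) = finish a≢c la lc (λ _ → 0) z≤n (λ i → ≤-trans (all i) (m≤m+n _ 0))
          go (inj₂ (d , le , o)) = finish a≢c la lc (upd d 1 (λ _ → 0)) (≤-reflexive (∑-single d 1)) pointwise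
            where
            pointwise : ∀ i → load b i ≤ length (L T i) + upd d 1 (λ _ → 0) i
            pointwise i = cases (i ≟ d)
              where
              cases : Dec (i ≡ d) → load b i ≤ length (L T i) + upd d 1 (λ _ → 0) i
              cases (yes refl) = ≤-trans le (≤-reflexive (trans (+-comm 1 (length (L T i))) (cong (length (L T i) +_) (≡-sym (upd-same i)))))
              cases (no i≢d)   = ≤-trans (unique o i≢d) (m≤m+n (length (L T i)) _)

      -- What leaves at an end of the spine can see.

      End : Cfg 5 → V → Set
      End T z = Head (P T) z ⊎ Last (P T) z

      lonely : ∀ {T} → Best T → ∀ {z} → End T z → ∀ k → (∀ {m} → m ≢ k → at T m ≢ z) → ⊥
      lonely b (inj₁ h) k others = let (m , m≢k , h′) = heads b k in others m≢k (head-unique h′ h)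
      lonely b (inj₂ l) k others = let (m , m≢k , l′) = lasts b k in others m≢k (last-unique l′ l)

      module _ {T} (b : Best T) {z} (end : End T z) (i k : Fin 5) (others : ∀ {m} → m ≢ i → m ≢ k → at T m ≢ z)
        {x} (x∈ : x ∈ P T) (x≢z : x ≢ z) where

        private
          moved : ∀ {T′} → Best T′ → End T′ z → at T′ i ≡ x → (∀ {m} → m ≢ i → at T′ m ≡ at T m) → ⊥
          moved {T′} b′ end′ ai ak = lonely b′ end′ k (λ {m} m≢k e → cases m≢k e (m ≟ i))
            where
            cases : ∀ {m} → m ≢ k → at T′ m ≡ z → Dec (m ≡ i) → ⊥
            cases m≢k e (yes refl) = x≢z (trans (≡-sym ai) e)
            cases m≢k e (no m≢i)   = others m≢i m≢k (trans (≡-sym (ak m≢i)) e)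

        -- If z carries only the legs i and k, then moving leg i away from z would shorten the spine.
        only-two : ∀ {u} → Head (L T i) u → ¬ u ∼ x
        only-two h u∼x = moved best′ end at-i at-k
          where open Reattach b x∈ h u∼x

        only-two-last : ∀ {s} → Last (L T i) s → ¬ s ∼ x
        only-two-last {s} (A , e) s∼x = moved best′ end at-i at-k
          where
          open Move b i (L T i) x x∈
            (subst (λ xs → Path (xs ++ x ∷ [])) (≡-sym e) (subst Path (≡-sym (++-assoc A _ _)) (path-link A (leg-left T e) s∼x tt)))
            (λ w → refl)

      -- If both leaves saw spine vertices beyond `z`, legs `i` and `i′` could be moved away one
      -- after the other, leaving only leg `k` at `z`.
      only-three : ∀ {T} (b : Best T) {z} → End T z → ∀ {i i′ k} → i ≢ i′ → (∀ {m} → m ≢ i → m ≢ i′ → m ≢ k → at T m ≢ z) →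
                   ∀ {u u′ x y} → Head (L T i) u → Head (L T i′) u′ → x ∈ P T → x ≢ z → y ∈ P T → y ≢ z → u ∼ x → ¬ u′ ∼ y
      only-three {T} b {z} end {i} {i′} {k} i≢i′ others {x = x} h (D , e) x∈ x≢z y∈ y≢z u∼x =
        only-two best′ end i′ k (λ {m} m≢i′ m≢k e → cases m≢i′ m≢k e (m ≟ i)) y∈ y≢z (D , trans (leg-k (i≢i′ ∘ ≡-sym)) e)
        where
        open Reattach b x∈ h u∼x
        cases : ∀ {m} → m ≢ i′ → m ≢ k → at T′ m ≡ z → Dec (m ≡ i) → ⊥
        cases m≢i′ m≢k e (yes refl) = x≢z (trans (≡-sym at-i) e)
        cases m≢i′ m≢k e (no m≢i)   = others m≢i m≢i′ m≢k (trans (≡-sym (at-k m≢i)) e)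

      -- A change of labels only. It allows the positions of the legs to be fixed by number and
      -- symmetric cases to be reduced to one.
      module Swap {T} (b : Best T) (i j : Fin 5) (i≢j : i ≢ j) where

        private
          swap : ∀ {A : Set} → (Fin 5 → A) → Fin 5 → A
          swap f = upd i (f j) (upd j (f i) f)

          swap-j : ∀ {A : Set} (f : Fin 5 → A) → swap f j ≡ f i
          swap-j f = trans (upd-other i (i≢j ∘ ≡-sym)) (upd-same j)

          swap-k : ∀ {A : Set} (f : Fin 5 → A) {k} → k ≢ i → k ≢ j → swap f k ≡ f k
          swap-k f k≢i k≢j = trans (upd-other i k≢i) (upd-other j k≢j)

          cover : ∀ {R : V → Set} → (Σ (Fin 5) λ k → R (at T k)) → Σ (Fin 5) λ k → R (swap (at T) k)
          cover {R} (k , r) = go (k ≟ i) (k ≟ j)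
            where
            go : Dec (k ≡ i) → Dec (k ≡ j) → Σ (Fin 5) λ k → R (swap (at T) k)
            go (yes refl) _          = j , subst R (≡-sym (swap-j (at T))) r
            go (no _)     (yes refl) = i , subst R (≡-sym (upd-same i)) r
            go (no k≢i)   (no k≢j)   = k , subst R (≡-sym (swap-k (at T) k≢i k≢j)) r

          paths : ∀ k → Path (swap (L T) k ++ swap (at T) k ∷ [])
          paths = upd₂-∀ PathEnd i (L-path T j) (upd₂-∀ PathEnd j (L-path T i) (L-path T))
            where
            PathEnd : List V → V → Set
            PathEnd xs z = Path (xs ++ z ∷ [])

          spots : ∀ k → swap (at T) k ∈ P T
          spots = upd-∀ (λ _ z → z ∈ P T) i (at∈P T j) (upd-∀ (λ _ z → z ∈ P T) j (at∈P T i) (at∈P T))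

          same : ∀ w → ∑ (W w ∘ swap (L T)) ≡ ∑ (W w ∘ L T)
          same w = ∑-upd₂ (W w) j i {L T i} {L T j} (L T) i≢j (+-comm (W w (L T i)) (W w (L T j)))

        T′ : Cfg 5
        T′ = rebuild T (swap (L T)) (swap (at T)) paths spots (cover {Head (P T)} (first T)) (cover {Last (P T)} (final T)) same

        best′ : Best T′
        best′ = best (trans (rebuild-weight T (swap (L T)) (swap (at T)) paths spots (cover {Head (P T)} (first T)) (cover {Last (P T)} (final T)) same _) (size≡ b)) (spine≡ b)

        at-i : at T′ i ≡ at T j
        at-i = upd-same i

        at-k : ∀ {k} → k ≢ i → k ≢ j → at T′ k ≡ at T k
        at-k = swap-k (at T)

      -- Leg 2 is left free: its place on the spine is what separates the remaining cases.
      record Ends (T : Cfg 5) : Set where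
        field
          {s t} : V
          head-s : Head (P T) s
          last-t : Last (P T) t
          s≢t : s ≢ t
          at0 : at T 0F ≡ s
          at1 : at T 1F ≡ s
          at3 : at T 3F ≡ t
          at4 : at T 4F ≡ t

        t≢s : t ≢ s
        t≢s = s≢t ∘ ≡-sym

      module EndEdges {T} (E : Ends T) where
        open Ends E

        first-edge : Σ V λ y → Σ (List V) λ R → P T ≡ s ∷ y ∷ R
        first-edge with head-s
        ... | y ∷ R , e = y , R , e
        ... | []    , e = ⊥-elim (s≢t (last-unique ([] , e) last-t))

        last-edge : Σ V λ y → Next (P T) t y
        last-edge with last-t
        ... | A , e with unsnoc A
        ...   | inj₁ refl            = ⊥-elim (s≢t (head-unique head-s ([] , e)))
        ...   | inj₂ (A′ , y , refl) = y , A′ , [] , inj₂ (trans e (++-assoc A′ _ _))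

        s∈ : s ∈ P T
        s∈ = subst (s ∈_) (≡-sym (proj₂ head-s)) (hd refl)

        t∈ : t ∈ P T
        t∈ = Last⇒∈ last-t

      one-spare : ∀ {a b c x y z} → a ≤ suc x → suc b ≤ y → c ≤ z → a + (b + c) ≤ x + (y + z)
      one-spare {a} {b} {c} {x} {y} {z} p q r = ≤-trans (+-mono-≤ p (+-monoʳ-≤ b r))
        (≤-trans (≤-reflexive (solve 3 (λ x b z → con 1 :+ (x :+ (b :+ z)) := x :+ ((con 1 :+ b) :+ z)) refl x b z))
          (+-monoʳ-≤ x (+-monoˡ-≤ z q)))

      rotate-+ : ∀ a b c → b + (a + c) ≡ a + (b + c)
      rotate-+ = solve 3 (λ a b c → b :+ (a :+ c) := a :+ (b :+ c)) refl

      -- Three legs hanging from one end.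

      module Three {T} (b : Best T) where

        len : Fin 5 → ℕ
        len i = length (L T i)

        end : Fin 5 → V
        end i = proj₁ (leg-last b i)

        end-last : ∀ i → Last (L T i) (end i)
        end-last i = proj₂ (leg-last b i)

        module _ {c d e : Fin 5} {y : V} (c≢d : c ≢ d) (c≢e : c ≢ e) (d≢e : d ≢ e) (cd : at T c ≡ at T d) (ce : at T c ≡ at T e)
          (nx : Next (P T) (at T c) y) where

          private
            nx-d : Next (P T) (at T d) y
            nx-d = subst (λ z → Next (P T) z y) cd nx
            nx-e : Next (P T) (at T e) y
            nx-e = subst (λ z → Next (P T) z y) ce nx
            d-of-c : Side T c (end d)
            d-of-c = inj₁ (d , c≢d ∘ ≡-sym , ≡-sym cd , end-last d)
            e-of-c : Side T c (end e)
            e-of-c = inj₁ (e , c≢e ∘ ≡-sym , ≡-sym ce , end-last e)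
            e-of-d : Side T d (end e)
            e-of-d = inj₁ (e , d≢e ∘ ≡-sym , trans (≡-sym ce) cd , end-last e)

            under : ∀ {f} → c ≢ f → at T c ≡ at T f → Over b c → load b f ≤ len f
            under {f} c≢f cf o = go (leg-bound b f)
              where
              go : (load b f ≤ len f) ⊎ (load b f ≤ suc (len f) × Over b f) → load b f ≤ len f
              go (inj₁ p)        = p
              go (inj₂ (_ , o′)) = ⊥-elim (over-unique b c≢f cf o o′ (inj₂ nx) (inj₂ (subst (λ z → Next (P T) z y) cf nx)))

            -- Without an edge among `end d`, `end e` and `y`, these and the two rays from leg `c`
            -- form a K₁,₅. Any such edge joins the last vertex of leg `d` or `e` to a side
            -- neighbour, and the unit gained there pays for the overload of leg `c`.
            slack : Over b c → load b d < len d ⊎ load b e < len e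
            slack o = go (adj G (end d) (end e) ≟ᵇ true) (adj G (end d) y ≟ᵇ true) (adj G (end e) y ≟ᵇ true)
              where
              go : Dec (end d ∼ end e) → Dec (end d ∼ y) → Dec (end e ∼ y) → load b d < len d ⊎ load b e < len e
              go (yes p) _ _ = inj₁ (side-slack b e-of-d (end-last d) p)
              go (no _) (yes p) _ = inj₁ (side-slack b (inj₂ nx-d) (end-last d) p)
              go (no _) (no _) (yes p) = inj₂ (side-slack b (inj₂ nx-e) (end-last e) p)
              go (no p) (no q) (no r) = ⊥-elim (over-star b o
                (side∼ T d-of-c ∷ side∼ T e-of-c ∷ next∼ T nx ∷ [])
                (side-apart b o d-of-c ∷ side-apart b o e-of-c ∷ side-apart b o (inj₂ nx) ∷ [])
                (((leg≢leg T d≢e (last∈ T (end-last d)) (last∈ T (end-last e)) , p) ∷ (leg≢spine T (last∈ T (end-last d)) (next∈ nx) , q) ∷ [])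
                 ∷ ((leg≢spine T (last∈ T (end-last e)) (next∈ nx) , r) ∷ []) ∷ [] ∷ []))

          over-three : load b c ≤ suc (len c) → Over b c → load b c + (load b d + load b e) ≤ len c + (len d + len e)
          over-three le o = go (slack o)
            where
            go : load b d < len d ⊎ load b e < len e → load b c + (load b d + load b e) ≤ len c + (len d + len e)
            go (inj₁ p) = one-spare le p (under c≢e ce o)
            go (inj₂ p) = subst₂ (λ x y → load b c + x ≤ len c + y) (+-comm (load b e) (load b d)) (+-comm (len e) (len d)) (one-spare le p (under c≢d cd o))

        three : ∀ {c d e : Fin 5} {y : V} → c ≢ d → c ≢ e → d ≢ e → at T c ≡ at T d → at T c ≡ at T e → Next (P T) (at T c) y →
                load b c + (load b d + load b e) ≤ len c + (len d + len e)
        three {c} {d} {e} {y} c≢d c≢e d≢e cd ce nx = go (leg-bound b c) (leg-bound b d) (leg-bound b e)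
          where
          Bound : Fin 5 → Set
          Bound f = (load b f ≤ len f) ⊎ (load b f ≤ suc (len f) × Over b f)
          go : Bound c → Bound d → Bound e → load b c + (load b d + load b e) ≤ len c + (len d + len e)
          go (inj₂ (p , o)) _ _ = over-three c≢d c≢e d≢e cd ce nx p o
          go _ (inj₂ (p , o)) _ = subst₂ _≤_ (rotate-+ (load b c) (load b d) (load b e)) (rotate-+ (len c) (len d) (len e))
            (over-three (c≢d ∘ ≡-sym) d≢e c≢e (≡-sym cd) (trans (≡-sym cd) ce) (subst (λ z → Next (P T) z y) cd nx) p o)
          go _ _ (inj₂ (p , o)) = subst₂ _≤_ (last-first (load b c) (load b d) (load b e)) (last-first (len c) (len d) (len e))
            (over-three (c≢e ∘ ≡-sym) (d≢e ∘ ≡-sym) c≢d (≡-sym ce) (trans (≡-sym ce) cd) (subst (λ z → Next (P T) z y) ce nx) p o)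
            where
            last-first : ∀ a b c → c + (a + b) ≡ a + (b + c)
            last-first = solve 3 (λ a b c → c :+ (a :+ b) := a :+ (b :+ c)) refl
          go (inj₁ p) (inj₁ q) (inj₁ r) = +-mono-≤ p (+-mono-≤ q r)

      open Three public using (three)

      -- Here `f` is the surplus allowed to the last two legs and `m` counts the adjacencies booked
      -- with the spine; the spine must cover both and two vertices more.
      sum-bound : ∀ a b c d e x y z u v m f p → a + (b + c) ≤ x + (y + z) → d + e ≤ (u + v) + f → m + f + 2 ≤ p →
                  (a + (b + (c + (d + (e + 0))))) + m + 2 ≤ p + (x + (y + (z + (u + (v + 0)))))
      sum-bound a b c d e x y z u v m f p low high top = begin
        (a + (b + (c + (d + (e + 0))))) + m + 2              ≡⟨ solve 6 (λ a b c d e m → (a :+ (b :+ (c :+ (d :+ (e :+ con 0))))) :+ m :+ con 2 := (a :+ (b :+ c)) :+ (d :+ e) :+ (m :+ con 2)) refl a b c d e m ⟩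
        (a + (b + c)) + (d + e) + (m + 2)                    ≤⟨ +-monoˡ-≤ (m + 2) (+-mono-≤ low high) ⟩
        (x + (y + z)) + ((u + v) + f) + (m + 2)              ≡⟨ solve 7 (λ x y z u v m f → (x :+ (y :+ z)) :+ ((u :+ v) :+ f) :+ (m :+ con 2) := (m :+ f :+ con 2) :+ (x :+ (y :+ (z :+ (u :+ (v :+ con 0)))))) refl x y z u v m f ⟩
        (m + f + 2) + (x + (y + (z + (u + (v + 0)))))        ≤⟨ +-monoˡ-≤ _ top ⟩
        p + (x + (y + (z + (u + (v + 0)))))                  ∎
        where open ≤-Reasoning

      only-at : ∀ {T} (b : Best T) i {z} → at T i ≡ z → (∀ {x} → x ∈ P T → x ≢ z → ¬ leaf b i ∼ x) →
                W (near b i) (P T) ≤ near b i (at T i) + 0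
      only-at b i refl h = ≤-trans (near-only b i h) (m≤m+n _ 0)

      -- Three legs at one end and two at the other.

      module TypeTwo {T} (b : Best T) (E : Ends T) (at2 : at T 2F ≡ Ends.s E) where
        open Ends E
        open EndEdges E
        open Three b using (len; end; end-last)

        y : V
        y = proj₁ first-edge

        R : List V
        R = proj₁ (proj₂ first-edge)

        eP : P T ≡ s ∷ y ∷ R
        eP = proj₂ (proj₂ first-edge)

        next-y : Next (P T) s y
        next-y = [] , R , inj₁ eP

        s-others : ∀ {m} → m ≢ 0F → m ≢ 1F → m ≢ 2F → at T m ≢ s
        s-others {0F} p _ _ _ = p refl
        s-others {1F} _ p _ _ = p refl
        s-others {2F} _ _ p _ = p refl
        s-others {3F} _ _ _ e = t≢s (trans (≡-sym at3) e)
        s-others {4F} _ _ _ e = t≢s (trans (≡-sym at4) e)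

        t-others : ∀ {m} → m ≢ 3F → m ≢ 4F → at T m ≢ t
        t-others {0F} _ _ e = s≢t (trans (≡-sym at0) e)
        t-others {1F} _ _ e = s≢t (trans (≡-sym at1) e)
        t-others {2F} _ _ e = s≢t (trans (≡-sym at2) e)
        t-others {3F} p _ _ = p refl
        t-others {4F} _ p _ = p refl

        R∈ : ∀ {x} → x ∈ R → x ∈ P T
        R∈ p = subst (_ ∈_) (≡-sym eP) (tl (tl p))

        R≢s : ∀ {x} → x ∈ R → x ≢ s
        R≢s p = spine-distinct T {[]} eP (inj₂ (tl p))

        not-y : ∀ i → at T i ≡ s → ¬ leaf b i ∼ y
        not-y i e = leaf-next b (subst (λ z → Next (P T) z y) (≡-sym e) next-y) (leaf-head b i)

        low : load b 0F + (load b 1F + load b 2F) ≤ len 0F + (len 1F + len 2F)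
        low = three b (λ ()) (λ ()) (λ ()) (trans at0 (≡-sym at1)) (trans at0 (≡-sym at2)) (subst (λ z → Next (P T) z y) (≡-sym at0) next-y)

        far3 : W (near b 3F) (P T) ≤ near b 3F (at T 3F) + 0
        far3 = only-at b 3F at3 (λ x∈ x≢t → only-two b (inj₂ last-t) 3F 4F t-others x∈ x≢t (leaf-head b 3F))

        far4 : W (near b 4F) (P T) ≤ near b 4F (at T 4F) + 0
        far4 = only-at b 4F at4 (λ x∈ x≢t → only-two b (inj₂ last-t) 4F 3F (λ p q → t-others q p) x∈ x≢t (leaf-head b 4F))

        tail-near : ∀ i → at T i ≡ s → W (near b i) (P T) ≡ near b i (at T i) + W (near b i) R
        tail-near i e = trans (cong (W (near b i)) eP)
          (cong₂ (λ z m → near b i z + (m + W (near b i) R)) (≡-sym e) (bit-false (not-y i e)))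

        tail-bound : ∀ i → at T i ≡ s → W (near b i) (P T) ≤ near b i (at T i) + length R
        tail-bound i e = ≤-trans (≤-reflexive (tail-near i e)) (+-monoʳ-≤ (near b i (at T i)) (near-length b i R))

        settle : ∀ (e : Fin 5 → ℕ) f → (∀ j → W (near b j) (P T) ≤ near b j (at T j) + e j) →
                load b 3F + load b 4F ≤ (len 3F + len 4F) + f → ∑ e + f + 2 ≤ length (P T) → ⊥
        settle e f h high top = sparse b e h
          (sum-bound (load b 0F) (load b 1F) (load b 2F) (load b 3F) (load b 4F) (len 0F) (len 1F) (len 2F) (len 3F) (len 4F) (∑ e) f (length (P T))
            low high top)

        Hits : Fin 5 → Set
        Hits i = Any.Any (λ x → leaf b i ∼ x) R

        hits? : ∀ i → Dec (Hits i)
        hits? i = Any.any? (λ x → adj G (leaf b i) x ≟ᵇ true) R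

        excluded : ∀ {i i′ k} → i ≢ i′ → (∀ {m} → m ≢ i → m ≢ i′ → m ≢ k → at T m ≢ s) → at T i′ ≡ s → Hits i →
                   W (near b i′) (P T) ≤ near b i′ (at T i′) + 0
        excluded {i} {i′} {k} i≢i′ others e hit = only-at b i′ e (λ y∈ y≢s →
          only-three b (inj₁ head-s) i≢i′ others (leaf-head b i) (leaf-head b i′) (R∈ x∈) (R≢s x∈) y∈ y≢s i∼x)
          where
          x∈ = proj₁ (proj₂ (find hit))
          i∼x = proj₂ (proj₂ (find hit))

        missed : ∀ i → at T i ≡ s → ¬ Hits i → W (near b i) (P T) ≤ near b i (at T i) + 0
        missed i e none = only-at b i e (λ x∈ x≢s i∼x → go (subst (_ ∈_) eP x∈) x≢s i∼x)
          where
          go : ∀ {x} → x ∈ s ∷ y ∷ R → x ≢ s → leaf b i ∼ x → ⊥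
          go (hd p) x≢s _            = x≢s p
          go (tl (hd refl)) _ i∼x    = not-y i e i∼x
          go (tl (tl p)) _ i∼x       = none (Any.map (λ { refl → i∼x }) p)

        Spend : ℕ → Set
        Spend m = Σ (Fin 5 → ℕ) λ e → ∑ e ≡ m × (∀ j → W (near b j) (P T) ≤ near b j (at T j) + e j)

        spend-at : ∀ m → (Σ (Fin 5) λ i → i ≢ 3F × i ≢ 4F × (∀ j → j ≢ 3F → j ≢ 4F → W (near b j) (P T) ≤ near b j (at T j) + upd i m (λ _ → 0) j)) → Spend m
        spend-at m (i , i≢3 , i≢4 , h) = upd i m (λ _ → 0) , ∑-single i m , bound
          where
          bound : ∀ j → W (near b j) (P T) ≤ near b j (at T j) + upd i m (λ _ → 0) j
          bound 0F = h 0F (λ ()) (λ ())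
          bound 1F = h 1F (λ ()) (λ ())
          bound 2F = h 2F (λ ()) (λ ())
          bound 3F = subst (λ x → W (near b 3F) (P T) ≤ near b 3F (at T 3F) + x) (≡-sym (upd-other i (i≢3 ∘ ≡-sym))) far3
          bound 4F = subst (λ x → W (near b 4F) (P T) ≤ near b 4F (at T 4F) + x) (≡-sym (upd-other i (i≢4 ∘ ≡-sym))) far4

        -- At most one of the leaves of legs 0, 1, 2 has neighbours on the spine beyond s.
        spend : Spend (length R)
        spend = spend-at (length R) (go (hits? 0F) (hits? 1F))
          where
          go : Dec (Hits 0F) → Dec (Hits 1F) → Σ (Fin 5) λ i → i ≢ 3F × i ≢ 4F ×
               (∀ j → j ≢ 3F → j ≢ 4F → W (near b j) (P T) ≤ near b j (at T j) + upd i (length R) (λ _ → 0) j)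
          go (yes p) _ = 0F , (λ ()) , (λ ()) , λ
            { 0F _ _ → tail-bound 0F at0
            ; 1F _ _ → excluded {0F} {1F} {2F} (λ ()) s-others at1 p
            ; 2F _ _ → excluded {0F} {2F} {1F} (λ ()) (λ p q r → s-others p r q) at2 p
            ; 3F q _ → ⊥-elim (q refl)
            ; 4F _ q → ⊥-elim (q refl) }
          go (no ¬0) (yes p) = 1F , (λ ()) , (λ ()) , λ
            { 0F _ _ → missed 0F at0 ¬0
            ; 1F _ _ → tail-bound 1F at1
            ; 2F _ _ → excluded {1F} {2F} {0F} (λ ()) (λ p q r → s-others r p q) at2 p
            ; 3F q _ → ⊥-elim (q refl)
            ; 4F _ q → ⊥-elim (q refl) }
          go (no ¬0) (no ¬1) = 2F , (λ ()) , (λ ()) , λ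
            { 0F _ _ → missed 0F at0 ¬0
            ; 1F _ _ → missed 1F at1 ¬1
            ; 2F _ _ → tail-bound 2F at2
            ; 3F q _ → ⊥-elim (q refl)
            ; 4F _ q → ⊥-elim (q refl) }

        spine-length : length (P T) ≡ 2 + length R
        spine-length = cong length eP

        -- Beyond the vertices from which the legs hang, only `R` is seen, and by one leaf at most.
        -- So `s` and `y` are the two spare vertices.
        balanced : load b 3F ≤ len 3F → load b 4F ≤ len 4F → ⊥
        balanced p q = settle (proj₁ spend) 0 (proj₂ (proj₂ spend)) (≤-trans (+-mono-≤ p q) (m≤m+n _ 0))
          (≤-reflexive (trans (cong (λ m → m + 0 + 2) (proj₁ (proj₂ spend)))
            (trans (solve 1 (λ m → m :+ con 0 :+ con 2 := con 2 :+ m) refl (length R)) (≡-sym spine-length))))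

        Bound : Fin 5 → Set
        Bound f = (load b f ≤ len f) ⊎ (load b f ≤ suc (len f) × Over b f)

        module _ {y′} (nx : Next (P T) t y′) (t∼0 : t ∼ leaf b 0F) (0≁y′ : ¬ leaf b 0F ∼ y′) where

          private
            y′≢t : y′ ≢ t
            y′≢t e = ∼-irrefl (subst (t ∼_) e (next∼ T nx))

            no-over : ∀ {i k} → i ≢ k → i ≢ 0F → k ≢ 0F → at T i ≡ t → at T k ≡ t → (∀ {m} → m ≢ k → m ≢ i → at T m ≢ t) → Over b i → ⊥
            no-over {i} {k} i≢k i≢0 k≢0 ei ek others o = over-star b o
              (side∼ T sk ∷ side∼ T sy ∷ subst (_∼ leaf b 0F) (≡-sym ei) t∼0 ∷ [])
              (side-apart b o sk ∷ side-apart b o sy ∷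
                (leaf-apart b i≢0 (leaf-head b i) (leaf-head b 0F) ,
                  (leg≢leg T i≢0 (last∈ T (over-last o)) (head∈ T (leaf-head b 0F)) , last-leaf b i≢0 (over-last o) (leaf-head b 0F))) ∷ [])
              (((leg≢spine T (last∈ T (end-last k)) (next∈ nx) , only-two-last b (inj₂ last-t) k i others (next∈ nx) y′≢t (end-last k))
                ∷ (leg≢leg T k≢0 (last∈ T (end-last k)) (head∈ T (leaf-head b 0F)) , last-leaf b k≢0 (end-last k) (leaf-head b 0F)) ∷ [])
               ∷ (((λ e → leg≢spine T (head∈ T (leaf-head b 0F)) (next∈ nx) (≡-sym e)) , λ e → 0≁y′ (∼-sym e)) ∷ []) ∷ [] ∷ [])
              where
              sk : Side T i (end k)
              sk = inj₁ (k , i≢k ∘ ≡-sym , trans ek (≡-sym ei) , end-last k)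
              sy : Side T i y′
              sy = inj₂ (subst (λ z → Next (P T) z y′) (≡-sym ei) nx)

          -- With the leaf of leg 0 as a neighbour of `t`, an overloaded leg at `t` would complete a
          -- K₁,₅: its own two rays, the last vertex of the other leg there, `y′` and that leaf. So
          -- `balanced` applies.
          opposite-leaf : ⊥
          opposite-leaf = go (leg-bound b 3F) (leg-bound b 4F)
            where
            go : Bound 3F → Bound 4F → ⊥
            go (inj₂ (_ , o)) _ = no-over {3F} {4F} (λ ()) (λ ()) (λ ()) at3 at4 (λ p q → t-others q p) o
            go _ (inj₂ (_ , o)) = no-over {4F} {3F} (λ ()) (λ ()) (λ ()) at4 at3 (λ p q → t-others p q) o
            go (inj₁ p) (inj₁ q) = balanced p q

        high : load b 3F + load b 4F ≤ (len 3F + len 4F) + 1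
        high = go (leg-bound b 3F) (leg-bound b 4F)
          where
          side : ∀ i → at T i ≡ t → Side T i (proj₁ last-edge)
          side i e = inj₂ (subst (λ z → Next (P T) z (proj₁ last-edge)) (≡-sym e) (proj₂ last-edge))
          go : Bound 3F → Bound 4F → load b 3F + load b 4F ≤ (len 3F + len 4F) + 1
          go (inj₁ p) (inj₁ q) = ≤-trans (+-mono-≤ p q) (m≤m+n _ 1)
          go (inj₁ p) (inj₂ (q , _)) = ≤-trans (+-mono-≤ p q) (≤-reflexive (solve 2 (λ x y → x :+ (con 1 :+ y) := x :+ y :+ con 1) refl (len 3F) (len 4F)))
          go (inj₂ (p , _)) (inj₁ q) = ≤-trans (+-mono-≤ p q) (≤-reflexive (solve 2 (λ x y → (con 1 :+ x) :+ y := x :+ y :+ con 1) refl (len 3F) (len 4F)))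
          go (inj₂ (_ , o)) (inj₂ (_ , o′)) = ⊥-elim (over-unique b (λ ()) (trans at3 (≡-sym at4)) o o′ (side 3F at3) (side 4F at4))

      -- Once a part of leg 3 has been transferred to leg 0, its leaf u sees the far end t from leg 0. So the leaves
      -- of legs 1 and 2 see nothing beyond s; and if the leaf v of leg 0 sees the third spine vertex, then
      -- the transferred leg can be moved to t, after which its leaf is adjacent to s but not to the neighbour of s.
      module Linked {T} (b : Best T) (E : Ends T) (at2 : at T 2F ≡ Ends.s E) {A x B v u} (e3 : L T 3F ≡ A ++ x ∷ B)
        (h0 : Head (L T 0F) v) (x∼v : x ∼ v) (h3 : Head (L T 3F) u) (u∼t : u ∼ Ends.t E) where
        open TypeTwo b E at2
        open Ends E
        open EndEdges E
        open Three b using (len; end; end-last)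
        module X = Transfer b {3F} {0F} (λ ()) e3 h0 x∼v

        private
          u-head : Head (L X.T′ 0F) u
          u-head = X.head-j h3

          -- If `t` were the spine neighbour of `s`, then after the transfer the leaf `u` of leg 0
          -- would contradict `leaf-next`.
          y≢t : y ≢ t
          y≢t e = leaf-next X.best′ {0F} (subst (λ z → Next (P T) z y) (≡-sym at0) next-y) u-head (subst (u ∼_) (≡-sym e) u∼t)

          beyond : ∀ R → P T ≡ s ∷ y ∷ R → Σ V λ y₂ → Σ (List V) λ R′ → R ≡ y₂ ∷ R′
          beyond []       e = ⊥-elim (y≢t (last-unique (s ∷ [] , e) last-t))
          beyond (y₂ ∷ R) e = y₂ , R , refl

          y₂ = proj₁ (beyond R eP)
          R′ = proj₁ (proj₂ (beyond R eP))

          eR : R ≡ y₂ ∷ R′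
          eR = proj₂ (proj₂ (beyond R eP))

          blind : ∀ {i k} → i ≢ 0F → i ≢ 3F → (∀ {m} → m ≢ 0F → m ≢ i → m ≢ k → at T m ≢ s) → at T i ≡ s →
                  W (near b i) (P T) ≤ near b i (at T i) + 0
          blind {i} {k} i≢0 i≢3 others e = only-at b i e (λ z∈ z≢s →
            only-three X.best′ (inj₁ head-s) {0F} {i} {k} (i≢0 ∘ ≡-sym) others u-head (X.head-k i≢3 i≢0 (leaf-head b i)) t∈ t≢s z∈ z≢s u∼t)

          leaf0 : leaf b 0F ≡ v
          leaf0 = head-unique (leaf-head b 0F) h0

          -- The leaf of leg 0 misses both `y` and `y₂`. With `s` this leaves three spine vertices,
          -- two to spare and one for the overload among legs 3 and 4.
          apart-case : ¬ v ∼ y₂ → ⊥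
          apart-case v≁y₂ = settle (proj₁ spent) 1 (proj₂ (proj₂ spent)) high
            (≤-reflexive (trans (cong (λ m → m + 1 + 2) (proj₁ (proj₂ spent)))
              (trans (solve 1 (λ m → m :+ con 1 :+ con 2 := con 3 :+ m) refl (length R′)) (≡-sym (trans spine-length (cong (λ r → 2 + length r) eR))))))
            where
            first-leg : W (near b 0F) (P T) ≤ near b 0F (at T 0F) + length R′
            first-leg = ≤-trans (≤-reflexive (trans (tail-near 0F at0) (cong (near b 0F (at T 0F) +_)
                (trans (cong (W (near b 0F)) eR) (cong (_+ W (near b 0F) R′) (bit-false (λ e → v≁y₂ (subst (_∼ y₂) leaf0 e))))))))
              (+-monoʳ-≤ (near b 0F (at T 0F)) (near-length b 0F R′))
            spent : Spend (length R′)
            spent = spend-at (length R′) (0F , (λ ()) , (λ ()) , λ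
              { 0F _ _ → first-leg
              ; 1F _ _ → blind {1F} {2F} (λ ()) (λ ()) s-others at1
              ; 2F _ _ → blind {2F} {1F} (λ ()) (λ ()) (λ p q r → s-others p r q) at2
              ; 3F q _ → ⊥-elim (q refl)
              ; 4F _ q → ⊥-elim (q refl) })

          adjacent-case : v ∼ y₂ → ⊥
          adjacent-case v∼y₂ = TypeTwo.opposite-leaf Z₂.best′ ends refl-at2 (next-reverse next-y)
            (subst (s ∼_) (≡-sym leaf-end) (∼-sym (subst (end 0F ∼_) at0 (last∼at T (end-last 0F)))))
            (λ e → no-y (∼-sym (subst (_∼ y) leaf-end e)))
            where
            no-y : ¬ y ∼ end 0F
            -- Otherwise leg 0 could be inserted between `y` and `y₂`.
            no-y y∼ = insert b {A = s ∷ []} (trans eP (cong (λ r → s ∷ y ∷ r) eR)) h0 (end-last 0F) y∼ v∼y₂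
            module Y = Reattach X.best′ {0F} t∈ u-head u∼t
            -- Legs 0, 3 and 4 now hang from `t`, and 1 and 2 from `s`. Reversing the spine and
            -- exchanging labels restores the pattern of `Ends` with the ends interchanged.
            module Z₁ = Swap (best-mirror Y.best′) 1F 3F (λ ())
            module Z₂ = Swap Z₁.best′ 2F 4F (λ ())
            ends : Ends Z₂.T′
            ends = record
              { head-s = Head-reverse last-t ; last-t = Last-reverse head-s ; s≢t = t≢s
              ; at0 = refl ; at1 = at3 ; at3 = at1 ; at4 = at2 }
            refl-at2 : at Z₂.T′ 2F ≡ t
            refl-at2 = at4
            leaf-end : leaf Z₂.best′ 0F ≡ end 0F
            leaf-end = head-unique (leaf-head Z₂.best′ 0F) (Y.head-i (X.last-other (λ ()) (end-last 0F)))

        linked : ⊥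
        linked = go (adj G v y₂ ≟ᵇ true)
          where
          go : Dec (v ∼ y₂) → ⊥
          go (yes p) = adjacent-case p
          go (no ¬p) = apart-case ¬p

      -- With `i` and `l` the two legs at one end, the transfer goes to a leg `m` that hangs
      -- elsewhere; an overloaded leg offers two targets, so one of them is not `l`.
      record Link {T} (b : Best T) (i l : Fin 5) : Set where
        field
          {A B} : List V
          {x} : V
          {m} : Fin 5
          split≡ : L T i ≡ A ++ x ∷ B
          m≢i : m ≢ i
          m≢l : m ≢ l
          x∼m : x ∼ leaf b m

      link : ∀ {T} {b : Best T} {i} → Over b i → ∀ l → Link b i l
      link {b = b} {i} o l = go (avoid l j≢k)
        where
        open Over o
        go : j ≢ l ⊎ k ≢ l → Link b i l
        go (inj₁ j≢l) = record { split≡ = mid≡ ; m≢i = j≢c ; m≢l = j≢l ; x∼m = x∼j }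
        go (inj₂ k≢l) = record { split≡ = mid≡ ; m≢i = k≢c ; m≢l = k≢l ; x∼m = x∼k }

      linked-via : ∀ {T} (b : Best T) (E : Ends T) → at T 2F ≡ Ends.s E → ∀ {A x B v u} m → m ≢ 3F → m ≢ 4F → L T 3F ≡ A ++ x ∷ B →
                   Head (L T m) v → x ∼ v → Head (L T 3F) u → u ∼ Ends.t E → ⊥
      linked-via b E at2 0F _ _ = Linked.linked b E at2
      linked-via b E at2 1F _ _ = Linked.linked (Swap.best′ b 0F 1F (λ ()))
        (record { head-s = head-s ; last-t = last-t ; s≢t = s≢t ; at0 = at1 ; at1 = at0 ; at3 = at3 ; at4 = at4 }) at2
        where open Ends E
      linked-via b E at2 2F _ _ = Linked.linked (Swap.best′ b 0F 2F (λ ()))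
        (record { head-s = head-s ; last-t = last-t ; s≢t = s≢t ; at0 = at2 ; at1 = at1 ; at3 = at3 ; at4 = at4 }) at0
        where open Ends E
      linked-via b E at2 3F p _ = ⊥-elim (p refl)
      linked-via b E at2 4F _ p = ⊥-elim (p refl)

      linked-via-4 : ∀ {T} (b : Best T) (E : Ends T) → at T 2F ≡ Ends.s E → ∀ {A x B v u} m → m ≢ 3F → m ≢ 4F → L T 4F ≡ A ++ x ∷ B →
                     Head (L T m) v → x ∼ v → Head (L T 4F) u → u ∼ Ends.t E → ⊥
      linked-via-4 {T} b E at2 m m≢3 m≢4 e h x∼v h3 u∼t =
        linked-via S.best′ ends at2 m m≢3 m≢4 e (subst (λ xs → Head xs _) (same m m≢3 m≢4) h) x∼v h3 u∼t
        where
        open Ends E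
        module S = Swap b 3F 4F (λ ())
        ends : Ends S.T′
        ends = record { head-s = head-s ; last-t = last-t ; s≢t = s≢t ; at0 = at0 ; at1 = at1 ; at3 = at4 ; at4 = at3 }
        same : ∀ m → m ≢ 3F → m ≢ 4F → L T m ≡ L S.T′ m
        same 0F _ _ = refl
        same 1F _ _ = refl
        same 2F _ _ = refl
        same 3F p _ = ⊥-elim (p refl)
        same 4F _ p = ⊥-elim (p refl)

      type-two : ∀ {T} (b : Best T) (E : Ends T) → at T 2F ≡ Ends.s E → ⊥
      type-two {T} b E at2 = go (leg-bound b 3F) (leg-bound b 4F)
        where
        open TypeTwo b E at2 using (Bound; balanced)
        open Ends E

        at-end : ∀ {i} → Over b i → at T i ≡ t → leaf b i ∼ t
        at-end {i} o e = subst (leaf b i ∼_) e (Over.leaf∼at o)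

        go : Bound 3F → Bound 4F → ⊥
        go (inj₁ p) (inj₁ q) = balanced p q
        go (inj₂ (_ , o)) _ = linked-via b E at2 m m≢i m≢l split≡ (leaf-head b m) x∼m (leaf-head b 3F) (at-end o at3)
          where open Link (link o 4F)
        go (inj₁ _) (inj₂ (_ , o)) = linked-via-4 b E at2 m m≢l m≢i split≡ (leaf-head b m) x∼m (leaf-head b 4F) (at-end o at4)
          where open Link (link o 3F)

      type-two-last : ∀ {T} (b : Best T) (E : Ends T) → at T 2F ≡ Ends.t E → ⊥
      type-two-last b E at2 = type-two S₂.best′ ends at2
        where
        open Ends E
        module S₁ = Swap (best-mirror b) 0F 3F (λ ())
        module S₂ = Swap S₁.best′ 1F 4F (λ ())
        ends : Ends S₂.T′
        ends = record
          { head-s = Head-reverse last-t ; last-t = Last-reverse head-s ; s≢t = t≢s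
          ; at0 = at3 ; at1 = at4 ; at3 = at0 ; at4 = at1 }

      -- Two legs at each end and one between them.

      record Gathered {T} (b : Best T) (i l : Fin 5) : Set where
        field
          {T′} : Cfg 5
          {m} : Fin 5
          best′ : Best T′
          P≡ : P T′ ≡ P T
          m≢i : m ≢ i
          m≢l : m ≢ l
          at-m : at T′ m ≡ at T i
          at-k : ∀ {k} → k ≢ m → at T′ k ≡ at T k

      -- The transfer gives leg `m` the leaf of the overloaded leg `i`. That leaf sees `at T i`, so
      -- leg `m` can be rehung there.
      gather : ∀ {T} (b : Best T) {i} → Over b i → ∀ l → Gathered b i l
      gather {T} b {i} o l = record { best′ = Y.best′ ; P≡ = refl ; m≢i = m≢i ; m≢l = m≢l ; at-m = Y.at-i ; at-k = Y.at-k }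
        where
        open Link (link o l)
        module X = Transfer b (m≢i ∘ ≡-sym) split≡ (leaf-head b m) x∼m
        module Y = Reattach X.best′ {m} (at∈P T i) (X.head-j (leaf-head b i)) (Over.leaf∼at o)

      module _ {T} (b : Best T) (E : Ends T) (2≢s : at T 2F ≢ Ends.s E) (2≢t : at T 2F ≢ Ends.t E) where
        open Ends E

        private
          -- A leg drawn to `s` from elsewhere is impossible: leg 2 would give the pattern three and
          -- two, and leg 3 or 4 would leave a single leg at `t`.
          to-first : ∀ {i l} → at T i ≡ s → (∀ {m} → m ≢ i → m ≢ l → m ≢ 0F × m ≢ 1F) → Gathered b i l → ⊥
          to-first {i} {l} ai rest g = go m (rest m≢i m≢l) (trans at-m ai) at-k
            where
            open Gathered g
            head′ : Head (P T′) s
            head′ = subst (λ P → Head P s) (≡-sym P≡) head-s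
            last′ : Last (P T′) t
            last′ = subst (λ P → Last P t) (≡-sym P≡) last-t
            go : ∀ m → m ≢ 0F × m ≢ 1F → at T′ m ≡ s → (∀ {k} → k ≢ m → at T′ k ≡ at T k) → ⊥
            go 0F (p , _) _ _ = p refl
            go 1F (_ , p) _ _ = p refl
            go 2F _ am ak = type-two best′ (record { head-s = head′ ; last-t = last′ ; s≢t = s≢t
              ; at0 = trans (ak λ ()) at0 ; at1 = trans (ak λ ()) at1 ; at3 = trans (ak λ ()) at3 ; at4 = trans (ak λ ()) at4 }) am
            go 3F _ am ak = lonely best′ (inj₂ last′) 4F λ
              { {0F} _ e → s≢t (trans (≡-sym (trans (ak λ ()) at0)) e)
              ; {1F} _ e → s≢t (trans (≡-sym (trans (ak λ ()) at1)) e)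
              ; {2F} _ e → 2≢t (trans (≡-sym (ak λ ())) e)
              ; {3F} _ e → s≢t (trans (≡-sym am) e)
              ; {4F} p _ → p refl }
            go 4F _ am ak = lonely best′ (inj₂ last′) 3F λ
              { {0F} _ e → s≢t (trans (≡-sym (trans (ak λ ()) at0)) e)
              ; {1F} _ e → s≢t (trans (≡-sym (trans (ak λ ()) at1)) e)
              ; {2F} _ e → 2≢t (trans (≡-sym (ak λ ())) e)
              ; {3F} p _ → p refl
              ; {4F} _ e → s≢t (trans (≡-sym am) e) }

          to-last : ∀ {i l} → at T i ≡ t → (∀ {m} → m ≢ i → m ≢ l → m ≢ 3F × m ≢ 4F) → Gathered b i l → ⊥
          to-last {i} {l} ai rest g = go m (rest m≢i m≢l) (trans at-m ai) at-k
            where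
            open Gathered g
            head′ : Head (P T′) s
            head′ = subst (λ P → Head P s) (≡-sym P≡) head-s
            last′ : Last (P T′) t
            last′ = subst (λ P → Last P t) (≡-sym P≡) last-t
            go : ∀ m → m ≢ 3F × m ≢ 4F → at T′ m ≡ t → (∀ {k} → k ≢ m → at T′ k ≡ at T k) → ⊥
            go 3F (p , _) _ _ = p refl
            go 4F (_ , p) _ _ = p refl
            go 2F _ am ak = type-two-last best′ (record { head-s = head′ ; last-t = last′ ; s≢t = s≢t
              ; at0 = trans (ak λ ()) at0 ; at1 = trans (ak λ ()) at1 ; at3 = trans (ak λ ()) at3 ; at4 = trans (ak λ ()) at4 }) am
            go 0F _ am ak = lonely best′ (inj₁ head′) 1F λ
              { {3F} _ e → t≢s (trans (≡-sym (trans (ak λ ()) at3)) e)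
              ; {4F} _ e → t≢s (trans (≡-sym (trans (ak λ ()) at4)) e)
              ; {2F} _ e → 2≢s (trans (≡-sym (ak λ ())) e)
              ; {0F} _ e → t≢s (trans (≡-sym am) e)
              ; {1F} p _ → p refl }
            go 1F _ am ak = lonely best′ (inj₁ head′) 0F λ
              { {3F} _ e → t≢s (trans (≡-sym (trans (ak λ ()) at3)) e)
              ; {4F} _ e → t≢s (trans (≡-sym (trans (ak λ ()) at4)) e)
              ; {2F} _ e → 2≢s (trans (≡-sym (ak λ ())) e)
              ; {0F} p _ → p refl
              ; {1F} _ e → t≢s (trans (≡-sym am) e) }

          len : Fin 5 → ℕ
          len i = length (L T i)

          within : ∀ {i} → ¬ Over b i → load b i ≤ len i
          within {i} none = go (leg-bound b i)
            where
            go : (load b i ≤ len i) ⊎ (load b i ≤ suc (len i) × Over b i) → load b i ≤ len i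
            go (inj₁ p)       = p
            go (inj₂ (_ , o)) = ⊥-elim (none o)

          spare : load b 2F ≤ suc (len 2F)
          spare = go (leg-bound b 2F)
            where
            go : (load b 2F ≤ len 2F) ⊎ (load b 2F ≤ suc (len 2F) × Over b 2F) → load b 2F ≤ suc (len 2F)
            go (inj₁ p)       = m≤n⇒m≤1+n p
            go (inj₂ (p , _)) = p

          s-others : ∀ {m} → m ≢ 0F → m ≢ 1F → at T m ≢ s
          s-others {0F} p _ _ = p refl
          s-others {1F} _ p _ = p refl
          s-others {2F} _ _ e = 2≢s e
          s-others {3F} _ _ e = t≢s (trans (≡-sym at3) e)
          s-others {4F} _ _ e = t≢s (trans (≡-sym at4) e)

          t-others : ∀ {m} → m ≢ 3F → m ≢ 4F → at T m ≢ t
          t-others {0F} _ _ e = s≢t (trans (≡-sym at0) e)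
          t-others {1F} _ _ e = s≢t (trans (≡-sym at1) e)
          t-others {2F} _ _ e = 2≢t e
          t-others {3F} p _ _ = p refl
          t-others {4F} _ p _ = p refl

          middle : ∀ A B → P T ≡ A ++ at T 2F ∷ B →
                   Σ (List V) λ A′ → Σ V λ p → Σ V λ q → Σ (List V) λ B′ → P T ≡ A′ ++ p ∷ at T 2F ∷ q ∷ B′
          middle A B e with unsnoc A | B
          ... | inj₁ refl | _ = ⊥-elim (2≢s (head-unique (_ , e) head-s))
          ... | inj₂ _ | [] = ⊥-elim (2≢t (last-unique (A , e) last-t))
          ... | inj₂ (A′ , p , refl) | q ∷ B′ = A′ , p , q , B′ , trans e (++-assoc A′ _ _)

        -- By `gather` no leg at an end is overloaded, and the leaves there see nothing else on the
        -- spine. The leaf of leg 2 misses `p` and `q`, and `w` is booked in its load; of these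
        -- three vertices one pays for a possible overload of leg 2 and two are spare.
        type-three : ⊥
        type-three = go (middle _ _ (proj₂ (proj₂ (split-∈ (at∈P T 2F)))))
          where
          w = at T 2F
          go : (Σ (List V) λ A → Σ V λ p → Σ V λ q → Σ (List V) λ B → P T ≡ A ++ p ∷ w ∷ q ∷ B) → ⊥
          go (A , p , q , B , e) = sparse b (upd 2F m (λ _ → 0)) bound
            (≤-trans (≤-reflexive (cong (λ x → ∑ (load b) + x + 2) (∑-single {5} 2F m)))
              (≤-trans (sum-bound (load b 0F) (load b 1F) (load b 2F) (load b 3F) (load b 4F) (len 0F) (len 1F) (suc (len 2F)) (len 3F) (len 4F) m 0 (2 + m)
                (+-mono-≤ (within over0) (+-mono-≤ (within over1) spare)) (≤-trans (+-mono-≤ (within over3) (within over4)) (m≤m+n _ 0))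
                (≤-reflexive (solve 1 (λ m → m :+ con 0 :+ con 2 := con 2 :+ m) refl m)))
                (≤-reflexive (trans (solve 6 (λ m a b c d e → (con 2 :+ m) :+ (a :+ (b :+ ((con 1 :+ c) :+ (d :+ (e :+ con 0))))) := (con 3 :+ m) :+ (a :+ (b :+ (c :+ (d :+ (e :+ con 0)))))) refl m (len 0F) (len 1F) (len 2F) (len 3F) (len 4F))
                  (cong (_+ ∑ len) (≡-sym spine-length))))))
            where
            m = length A + length B
            spine-length : length (P T) ≡ 3 + m
            spine-length = trans (cong length e) (trans (length-++ A) (solve 2 (λ a b → a :+ (con 3 :+ b) := con 3 :+ (a :+ b)) refl (length A) (length B)))
            over0 : ¬ Over b 0F
            over0 o = to-first at0 (λ p q → p , q) (gather b o 1F)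
            over1 : ¬ Over b 1F
            over1 o = to-first at1 (λ p q → q , p) (gather b o 0F)
            over3 : ¬ Over b 3F
            over3 o = to-last at3 (λ p q → p , q) (gather b o 4F)
            over4 : ¬ Over b 4F
            over4 o = to-last at4 (λ p q → q , p) (gather b o 3F)
            f : V → ℕ
            f = near b 2F
            p-none : f p ≡ 0
            p-none = bit-false (leaf-next b (A , q ∷ B , inj₂ e) (leaf-head b 2F))
            q-none : f q ≡ 0
            q-none = bit-false (leaf-next b (A ++ p ∷ [] , B , inj₁ (trans e (≡-sym (++-assoc A _ _)))) (leaf-head b 2F))
            second : W f (P T) ≤ f w + m
            second = begin
              W f (P T)                             ≡⟨ trans (cong (W f) e) (W-++ f A) ⟩
              W f A + (f p + (f w + (f q + W f B))) ≡⟨ cong₂ (λ x y → W f A + (x + (f w + (y + W f B)))) p-none q-none ⟩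
              W f A + (f w + W f B)                 ≡⟨ solve 3 (λ a w b → a :+ (w :+ b) := w :+ (a :+ b)) refl (W f A) (f w) (W f B) ⟩
              f w + (W f A + W f B)                 ≤⟨ +-monoʳ-≤ (f w) (+-mono-≤ (near-length b 2F A) (near-length b 2F B)) ⟩
              f w + m                               ∎
              where open ≤-Reasoning
            bound : ∀ j → W (near b j) (P T) ≤ near b j (at T j) + upd 2F m (λ _ → 0) j
            bound 0F = only-at b 0F at0 (λ x∈ x≢s → only-two b (inj₁ head-s) 0F 1F s-others x∈ x≢s (leaf-head b 0F))
            bound 1F = only-at b 1F at1 (λ x∈ x≢s → only-two b (inj₁ head-s) 1F 0F (λ p q → s-others q p) x∈ x≢s (leaf-head b 1F))
            bound 2F = second
            bound 3F = only-at b 3F at3 (λ x∈ x≢t → only-two b (inj₂ last-t) 3F 4F t-others x∈ x≢t (leaf-head b 3F))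
            bound 4F = only-at b 4F at4 (λ x∈ x≢t → only-two b (inj₂ last-t) 4F 3F (λ p q → t-others q p) x∈ x≢t (leaf-head b 4F))

      normal : ∀ {T} (b : Best T) → Ends T → ⊥
      normal {T} b E = go (at T 2F ≟ Ends.s E) (at T 2F ≟ Ends.t E)
        where
        go : Dec (at T 2F ≡ Ends.s E) → Dec (at T 2F ≡ Ends.t E) → ⊥
        go (yes p) _      = type-two b E p
        go (no _) (yes p) = type-two-last b E p
        go (no p) (no q)  = type-three b E p q

      -- Normalising the labels of the legs.

      record Brought (T : Cfg 5) (i j : Fin 5) : Set where
        field
          {T′} : Cfg 5
          best′ : Best T′
          P≡ : P T′ ≡ P T
          at-i : at T′ i ≡ at T j
          at-k : ∀ {k} → k ≢ i → k ≢ j → at T′ k ≡ at T k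

      bring : ∀ {T} → Best T → ∀ i j → Brought T i j
      bring {T} b i j with i ≟ j
      ... | yes refl = record { best′ = b ; P≡ = refl ; at-i = refl ; at-k = λ _ _ → refl }
      ... | no i≢j   = record { best′ = best′ ; P≡ = refl ; at-i = at-i ; at-k = at-k }
        where open Swap b i j i≢j

      module _ {s t : V} (s≢t : s ≢ t) where

        private
          away : ∀ {T : Cfg 5} {i k} → at T k ≡ t → at T i ≡ s → i ≢ k
          away e e′ refl = s≢t (trans (≡-sym e′) e)

          move : ∀ {P Q : List V} {z} (R : List V → V → Set) → Q ≡ P → R P z → R Q z
          move R refl h = h

          place₄ : ∀ {T} → Best T → Head (P T) s → Last (P T) t → at T 0F ≡ s → at T 1F ≡ s → at T 3F ≡ t → ⊥
          place₄ {T} b h l at0 at1 at3 = go (lasts b 3F)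
            where
            go : (Σ (Fin 5) λ k → k ≢ 3F × Last (P T) (at T k)) → ⊥
            go (k , k≢3 , l′) = normal best′ (record
              { head-s = move Head P≡ h ; last-t = move Last P≡ l ; s≢t = s≢t
              ; at0 = trans (at-k (λ ()) (away {T} e at0)) at0 ; at1 = trans (at-k (λ ()) (away {T} e at1)) at1
              ; at3 = trans (at-k (λ ()) (k≢3 ∘ ≡-sym)) at3 ; at4 = trans at-i e })
              where
              e = last-unique l′ l
              open Brought (bring b 4F k)

          place₃ : ∀ {T} → Best T → Head (P T) s → Last (P T) t → at T 0F ≡ s → at T 1F ≡ s → ⊥
          place₃ {T} b h l at0 at1 = go (lasts b 0F)
            where
            go : (Σ (Fin 5) λ k → k ≢ 0F × Last (P T) (at T k)) → ⊥
            go (k , _ , l′) = place₄ best′ (move Head P≡ h) (move Last P≡ l)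
              (trans (at-k (λ ()) (away {T} e at0)) at0) (trans (at-k (λ ()) (away {T} e at1)) at1) (trans at-i e)
              where
              e = last-unique l′ l
              open Brought (bring b 3F k)

          place₁ : ∀ {T} → Best T → Head (P T) s → Last (P T) t → at T 0F ≡ s → ⊥
          place₁ {T} b h l at0 = go (heads b 0F)
            where
            go : (Σ (Fin 5) λ k → k ≢ 0F × Head (P T) (at T k)) → ⊥
            go (k , k≢0 , h′) = place₃ best′ (move Head P≡ h) (move Last P≡ l)
              (trans (at-k (λ ()) (k≢0 ∘ ≡-sym)) at0) (trans at-i (head-unique h′ h))
              where open Brought (bring b 1F k)

        two-ends : ∀ {T} → Best T → Head (P T) s → Last (P T) t → ⊥
        two-ends {T} b h l = go (heads b 1F)
          where
          go : (Σ (Fin 5) λ k → k ≢ 1F × Head (P T) (at T k)) → ⊥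
          go (k , _ , h′) = place₁ best′ (move Head P≡ h) (move Last P≡ l) (trans at-i (head-unique h′ h))
            where open Brought (bring b 0F k)

      no-best : ∀ {T} → Best T → ⊥
      no-best {T} b = go (P T) refl (heads b 0F) (lasts b 0F)
        where
        go : ∀ Q → P T ≡ Q → (Σ (Fin 5) λ k → k ≢ 0F × Head (P T) (at T k)) → (Σ (Fin 5) λ k → k ≢ 0F × Last (P T) (at T k)) → ⊥
        go []          e (_ , _ , _ , e′) _ with trans (≡-sym e) e′
        ... | ()
        go (s ∷ [])    e _ _ = singleton-case b e
        go (s ∷ y ∷ R) e _ (k , _ , A , e′) = two-ends (s≢ A e′) b (y ∷ R , e) (A , e′)
          where
          s≢ : ∀ A → P T ≡ A ++ at T k ∷ [] → s ≢ at T k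
          s≢ [] e′ _ with trans (≡-sym e) e′
          ... | ()
          s≢ (a ∷ A) e′ s≡ = spine-distinct T {[]} e (inj₂ (subst (at T k ∈_) (≡-sym (∷-injectiveʳ (trans (≡-sym e) e′))) (∈-mid A))) (≡-sym s≡)

  -- Growing a tree that does not span.

  module Growth (conn : Connected G) (free : K1r-free G 5) (dense : σ≥ G 5 (n ∸ 1))
    (noSpanning : ∀ (T : Cfg 4) → (∀ v → In v T) → ⊥) where

    exit : ∀ {k} (T : Cfg k) {u v} → Walk G u v → In u T → ¬ In v T → Σ V λ x → Σ V λ y → In x T × ¬ In y T × x ∼ y
    exit T here p q = ⊥-elim (q p)
    exit T (step {u} {w} e walk) p q with 1 ≤? weight (δ w) T
    ... | yes r = exit T walk r q
    ... | no ¬r = u , w , p , ¬r , e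

    fresh : ∀ {k} (T : Cfg k) {v} → ¬ In v T → ∀ x → δ x v + weight (δ x) T ≤ 1
    fresh T {v} v∉ x with x ≟ v
    ... | no _     = simple T x
    ... | yes refl = s≤s (≮⇒≥ v∉)

    cons : ∀ {A : Set} {k} → A → (Fin k → A) → Fin (suc k) → A
    cons a f zero    = a
    cons a f (suc i) = f i

    five-in-four : ∀ {a b c d e : Fin 4} → AllPairs _≢_ (a ∷ b ∷ c ∷ d ∷ e ∷ []) → ⊥
    five-in-four {a} {b} {c} {d} {e} ne with pigeonhole (s≤s (s≤s (s≤s (s≤s (s≤s z≤n))))) (lookup (a ∷ b ∷ c ∷ d ∷ e ∷ []))
    ... | i , j , i<j , eq = lookup-pairs (_∘ ≡-sym) ne i j (<⇒≢ i<j) eq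

    module Step {σ : ℕ} (noLarger₄ : ∀ (T : Cfg 4) → size T ≡ suc σ → ⊥) (noLarger₅ : ∀ (T : Cfg 5) → size T ≡ suc σ → ⊥) where

      module AtLength {ℓ : ℕ} (noShorter : ∀ (T : Cfg 4) → size T ≡ σ → spine T < ℓ → ⊥) where

        open Min {2} {σ} {ℓ} noShorter

        from-spine : ∀ {T} → Best T → ∀ {v x} → ¬ In v T → x ∈ P T → v ∼ x → ⊥
        from-spine {T} b {v} {x} v∉ x∈ v∼x = noLarger₅ T₁ (trans (same (λ _ → 1)) (cong suc (size≡ b)))
          where
          L′ = cons (v ∷ []) (L T)
          at′ = cons x (at T)
          same : ∀ w → W w (P T) + ∑ (W w ∘ L′) ≡ w v + weight w T
          same w = solve 3 (λ p v s → p :+ ((v :+ con 0) :+ s) := v :+ (p :+ s)) refl (W w (P T)) (w v) (∑ (W w ∘ L T))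
          T₁ : Cfg 5
          T₁ = record
            { P = P T ; L = L′ ; at = at′ ; P-path = P-path T
            ; L-path = λ { zero → v∼x , tt ; (suc i) → L-path T i }
            ; at∈P = λ { zero → x∈ ; (suc i) → at∈P T i }
            ; first = suc (proj₁ (first T)) , proj₂ (first T) ; final = suc (proj₁ (final T)) , proj₂ (final T)
            ; simple = λ y → subst (_≤ 1) (≡-sym (same (δ y))) (fresh T v∉ y) }

        from-leaf : ∀ {T} → Best T → ∀ {i v} → ¬ In v T → ∀ {x B} → L T i ≡ x ∷ B → v ∼ x → ⊥
        from-leaf {T} b {i} {v} v∉ {x} {B} e v∼x = noLarger₄ T₁ (trans (same (λ _ → 1)) (cong suc (size≡ b)))
          where
          L′ = upd i (v ∷ L T i) (L T)
          same : ∀ w → W w (P T) + ∑ (W w ∘ L′) ≡ w v + weight w T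
          same w = +-cancelʳ-≡ (W w (L T i)) _ _
            (trans (+-assoc (W w (P T)) _ _)
            (trans (cong (W w (P T) +_) (∑-upd (W w) i (L T)))
              (solve 4 (λ p s v l → p :+ (s :+ (v :+ l)) := (v :+ (p :+ s)) :+ l) refl (W w (P T)) (∑ (W w ∘ L T)) (w v) (W w (L T i)))))
          T₁ : Cfg 4
          T₁ = record
            { P = P T ; L = L′ ; at = at T ; P-path = P-path T
            ; L-path = upd-∀ (λ j xs → Path (xs ++ at T j ∷ [])) i
                (subst (λ xs → Path (v ∷ xs ++ at T i ∷ [])) (≡-sym e) (v∼x , subst (λ xs → Path (xs ++ at T i ∷ [])) e (L-path T i))) (L-path T)
            ; at∈P = at∈P T ; first = first T ; final = final T
            ; simple = λ x → subst (_≤ 1) (≡-sym (same (δ x))) (fresh T v∉ x) }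

        -- The part of leg i between x and the end of the spine joins the spine.
        from-end-leg : ∀ {T} → Best T → ∀ {i v} → ¬ In v T → Head (P T) (at T i) → ∀ {A x B} → L T i ≡ A ++ x ∷ B → v ∼ x → ⊥
        from-end-leg {T} b {i} {v} v∉ (C , eP) {A} {x} {B} e v∼x = noLarger₅ T₁ (trans (same (λ _ → 1)) (cong suc (size≡ b)))
          where
          P′ = x ∷ B ++ P T
          L₀ = upd i A (L T)
          L′ = cons (v ∷ []) L₀
          at₀ = upd i x (at T)
          at′ = cons x at₀
          same : ∀ w → W w P′ + ∑ (W w ∘ L′) ≡ w v + weight w T
          same w = +-cancelʳ-≡ (W w (L T i)) _ _
            (trans (cong (λ z → z + ∑ (W w ∘ L′) + W w (L T i)) (cong (w x +_) (W-++ w B)))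
            (trans (solve 6 (λ x b p v s l → ((x :+ (b :+ p)) :+ ((v :+ con 0) :+ s)) :+ l := ((x :+ b) :+ p) :+ v :+ (s :+ l)) refl
                     (w x) (W w B) (W w (P T)) (w v) (∑ (W w ∘ L₀)) (W w (L T i)))
            (trans (cong (λ z → ((w x + W w B) + W w (P T)) + w v + z) (∑-upd (W w) i (L T)))
            (trans (solve 6 (λ x b p v s a → ((x :+ b) :+ p) :+ v :+ (s :+ a) := (v :+ (p :+ s)) :+ (a :+ (x :+ b))) refl
                     (w x) (W w B) (W w (P T)) (w v) (∑ (W w ∘ L T)) (W w A))
              (cong (w v + weight w T +_) (≡-sym (trans (cong (W w) e) (W-++ w A))))))))
          leg : Path (A ++ x ∷ B ++ at T i ∷ [])
          leg = subst Path (++-assoc A _ _) (subst (λ xs → Path (xs ++ at T i ∷ [])) e (L-path T i))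
          spine′ : Path P′
          spine′ = subst (λ xs → Path (x ∷ B ++ xs)) (≡-sym eP) (path-join (x ∷ B) (path-right A leg) (subst Path eP (P-path T)))
          last′ = lasts b i
          T₁ : Cfg 5
          T₁ = record
            { P = P′ ; L = L′ ; at = at′ ; P-path = spine′
            ; L-path = λ { zero → v∼x , tt ; (suc j) → upd₂-∀ (λ xs z → Path (xs ++ z ∷ [])) i (path-left A leg) (L-path T) j }
            ; at∈P = λ { zero → hd refl ; (suc j) → upd-∀ (λ _ z → z ∈ P′) i (hd refl) (λ j → ∈-right (x ∷ B) (at∈P T j)) j }
            ; first = zero , B ++ P T , refl
            ; final = suc (proj₁ last′) , subst (Last P′) (≡-sym (upd-other i (proj₁ (proj₂ last′)))) (Last-++ (x ∷ B) (proj₂ (proj₂ last′)))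
            ; simple = λ y → subst (_≤ 1) (≡-sym (same (δ y))) (fresh T v∉ y) }

        -- Two legs at each of two ends already use up all four, so a leg hanging in between would
        -- be a fifth.
        at-an-end : ∀ {T} → Best T → ∀ i → Head (P T) (at T i) ⊎ Last (P T) (at T i)
        at-an-end {T} b i = go (heads b i) (lasts b i)
          where
          go : (Σ (Fin 4) λ j → j ≢ i × Head (P T) (at T j)) → (Σ (Fin 4) λ j → j ≢ i × Last (P T) (at T j)) →
               Head (P T) (at T i) ⊎ Last (P T) (at T i)
          go (j , j≢i , h) (k , k≢i , l) with at T i ≟ at T j | at T i ≟ at T k
          ... | yes e | _     = inj₁ (subst (Head (P T)) (≡-sym e) h)
          ... | no _  | yes e = inj₂ (subst (Last (P T)) (≡-sym e) l)
          ... | no p  | no q  = ⊥-elim (crowd (heads b j) (lasts b k))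
            where
            s≢t : at T j ≢ at T k
            s≢t e = ends h l e
              where
              ends : ∀ {s t} → Head (P T) s → Last (P T) t → s ≡ t → ⊥
              ends ([] , e) _ refl with subst (at T i ∈_) e (at∈P T i)
              ... | hd i≡ = p (trans i≡ (head-unique (_ , e) h))
              ends (y ∷ R , e) ([] , e′) refl with trans (≡-sym e) e′
              ... | ()
              ends (y ∷ R , e) (a ∷ A , e′) refl = spine-distinct T {[]} e (inj₂ (subst (_ ∈_) (≡-sym (∷-injectiveʳ (trans (≡-sym e) e′))) (∈-mid A))) refl
            crowd : (Σ (Fin 4) λ j′ → j′ ≢ j × Head (P T) (at T j′)) → (Σ (Fin 4) λ k′ → k′ ≢ k × Last (P T) (at T k′)) → ⊥
            crowd (j′ , j′≢j , h′) (k′ , k′≢k , l′) = five-in-four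
              ((j≢i ∘ ≡-sym ∷ (λ { refl → p (head-unique h′ h) }) ∷ k≢i ∘ ≡-sym ∷ (λ { refl → q (last-unique l′ l) }) ∷ [])
               ∷ (j′≢j ∘ ≡-sym ∷ (λ { refl → s≢t refl }) ∷ (λ { refl → s≢t (last-unique l′ l) }) ∷ [])
               ∷ ((λ { refl → s≢t (head-unique h h′) }) ∷ (λ { refl → s≢t (trans (head-unique h h′) (last-unique l′ l)) }) ∷ [])
               ∷ (k′≢k ∘ ≡-sym ∷ []) ∷ [] ∷ [])

        grow : ∀ {T} → Best T → ⊥
        grow {T} b = go (all? (λ v → 1 ≤? weight (δ v) T))
          where
          attach : (Σ V λ x → Σ V λ v → In x T × ¬ In v T × x ∼ v) → ⊥
          attach (x , v , x∈ , v∉ , x∼v) = split (In⇒∈ T x∈)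
            where
            leg : ∀ {i} A B → L T i ≡ A ++ x ∷ B → ⊥
            leg []      B e = from-leaf b v∉ e (∼-sym x∼v)
            leg {i} (a ∷ A) B e = ends (at-an-end b i)
              where
              ends : Head (P T) (at T i) ⊎ Last (P T) (at T i) → ⊥
              ends (inj₁ h) = from-end-leg b v∉ h {a ∷ A} e (∼-sym x∼v)
              ends (inj₂ l) = from-end-leg (best-mirror b) (λ p → v∉ (subst (1 ≤_) (mirror-weight (δ v) T) p)) (Head-reverse l) {a ∷ A} e (∼-sym x∼v)
            split : x ∈ P T ⊎ Σ (Fin 4) (λ i → x ∈ L T i) → ⊥
            split (inj₁ p)       = from-spine b v∉ p (∼-sym x∼v)
            split (inj₂ (i , p)) = let (A , B , e) = split-∈ p in leg A B e
          go : Dec (∀ v → In v T) → ⊥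
          go (yes all) = noSpanning T all
          go (no ¬all) = let (v , v∉) = ¬∀⟶∃¬ n _ (λ v → 1 ≤? weight (δ v) T) ¬all in
            attach (exit T (conn (at T zero) v) (∈spine⇒In T (at∈P T zero)) v∉)

      -- No shortest spine is chosen; strong induction on the spine length provides the assumption
      -- that nothing shorter exists.
      by-length : ∀ {k} → (∀ ℓ → (∀ (T : Cfg k) → size T ≡ σ → spine T < ℓ → ⊥) → ∀ (T : Cfg k) → size T ≡ σ → spine T ≡ ℓ → ⊥) →
                  ∀ (T : Cfg k) → size T ≡ σ → ⊥
      by-length {k} h T e = below (suc (spine T)) T e ≤-refl
        where
        below : ∀ m (T : Cfg k) → size T ≡ σ → spine T < m → ⊥
        below (suc m) T e (s≤s le) = h (spine T) (λ T′ e′ lt → below m T′ e′ (≤-trans lt le)) T e refl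

      none₄ : ∀ (T : Cfg 4) → size T ≡ σ → ⊥
      none₄ = by-length λ ℓ noShorter T e l → AtLength.grow noShorter {T} (Min.best e l)

      -- Four legs come first at each size, because `none₄` is what forbids an exchange from saving
      -- a leg.
      none₅ : ∀ (T : Cfg 5) → size T ≡ σ → ⊥
      none₅ = by-length λ ℓ noShorter T e l → Opt.Dense.no-best free noShorter none₄ noLarger₅ dense {T} (Min.best e l)

    -- Downward induction on the size: `d` bounds the distance to sizes above `n`, where nothing
    -- fits.
    none : ∀ d σ → n < σ + d → (∀ (T : Cfg 4) → size T ≡ σ → ⊥) × (∀ (T : Cfg 5) → size T ≡ σ → ⊥)
    none zero σ lt = (λ T e → too-big T e) , (λ T e → too-big T e)
      where
      too-big : ∀ {k} (T : Cfg k) → size T ≡ σ → ⊥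
      too-big T e = 1+n≰n (≤-trans (subst (n <_) (trans (+-identityʳ σ) (≡-sym e)) lt) (size≤n T))
    none (suc d) σ lt = Step.none₄ (proj₁ larger) (proj₂ larger) , Step.none₅ (proj₁ larger) (proj₂ larger)
      where
      larger = none d (suc σ) (subst (n <_) (+-suc σ d) lt)

    no-tree : Cfg 4 → ⊥
    no-tree T = proj₁ (none (suc n) (size T) (m≤n+m (suc n) (size T))) T refl

  -- Spanning trees as lists of edges.

  Edge : Set
  Edge = V × V

  open DecMembership (≡-dec (_≟_ {n}) (_≟_ {n})) using () renaming (_∈?_ to _∈ᵉ?_)
  open DecMembership (_≟_ {n}) using (_∈?_)

  -- Adjacency in `G` is part of the relation, so every list, grown or not, defines a subgraph of
  -- `G`.
  Link : List Edge → V → V → Set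
  Link es u v = u ∼ v × ((u , v) ∈ es ⊎ (v , u) ∈ es)

  link? : ∀ es u v → Dec (Link es u v)
  link? es u v = (adj G u v ≟ᵇ true) ×-dec (((u , v) ∈ᵉ? es) ⊎-dec ((v , u) ∈ᵉ? es))

  link-sym : ∀ {es u v} → Link es u v → Link es v u
  link-sym (e , inj₁ p) = ∼-sym e , inj₂ p
  link-sym (e , inj₂ p) = ∼-sym e , inj₁ p

  link-⊆ : ∀ {es es′} → (∀ {e} → e ∈ es → e ∈ es′) → ∀ {u v} → Link es u v → Link es′ u v
  link-⊆ h (e , inj₁ p) = e , inj₁ (h p)
  link-⊆ h (e , inj₂ p) = e , inj₂ (h p)

  tree : List Edge → Graph n
  tree es = record
    { adj    = λ u v → does (link? es u v)
    ; sym    = λ u v → does-⇔ (mk⇔ link-sym link-sym) (link? es u v) (link? es v u)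
    ; irrefl = λ v → dec-false (link? es v v) (λ l → ∼-irrefl (proj₁ l)) }

  tree⇒link : ∀ es {u v} → u ∼[ tree es ] v → Link es u v
  tree⇒link es {u} {v} = witness (link? es u v)
    where
    witness : ∀ {A : Set} (d : Dec A) → does d ≡ true → A
    witness (yes a) _ = a

  link⇒tree : ∀ es {u v} → Link es u v → u ∼[ tree es ] v
  link⇒tree es {u} {v} = dec-true (link? es u v)

  verts : V → List Edge → List V
  verts r es = map proj₁ es ++ r ∷ []

  -- Edges (child , parent), each child being new with respect to the later edges and the root r.
  Grow : V → List Edge → Set
  Grow r []             = ⊤
  Grow r ((c , p) ∷ es) = p ∈ verts r es × ¬ c ∈ verts r es × c ∼ p × Grow r es

  grow? : ∀ r es → Dec (Grow r es)
  grow? r []             = yes tt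
  grow? r ((c , p) ∷ es) = (p ∈? verts r es) ×-dec ¬? (c ∈? verts r es) ×-dec (adj G c p ≟ᵇ true) ×-dec grow? r es

  walk-map : ∀ {H K : Graph n} → (∀ {u v} → u ∼[ H ] v → u ∼[ K ] v) → ∀ {u v} → Walk H u v → Walk K u v
  walk-map f here       = here
  walk-map f (step e w) = step (f e) (walk-map f w)

  walk-trans : ∀ {H : Graph n} {u v w} → Walk H u v → Walk H v w → Walk H u w
  walk-trans here       q = q
  walk-trans (step e p) q = step e (walk-trans p q)

  walk-sym : ∀ {H : Graph n} {u v} → Walk H u v → Walk H v u
  walk-sym here = here
  walk-sym {H} (step {u} {w} e p) = walk-trans (walk-sym p) (step (trans (Graph.sym H w u) e) here)

  to-root : ∀ {r} es → Grow r es → ∀ {v} → v ∈ verts r es → Walk (tree es) v r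
  to-root []             g (hd refl) = here
  to-root ((c , p) ∷ es) (p∈ , c∉ , c∼p , g) v∈ = go v∈
    where
    lift : ∀ {v} → Walk (tree es) v _ → Walk (tree ((c , p) ∷ es)) v _
    lift = walk-map (λ e → link⇒tree ((c , p) ∷ es) (link-⊆ tl (tree⇒link es e)))
    go : ∀ {v} → v ∈ c ∷ verts _ es → Walk (tree ((c , p) ∷ es)) v _
    go (hd refl) = step (link⇒tree ((c , p) ∷ es) (c∼p , inj₁ (hd refl))) (lift (to-root es g p∈))
    go (tl v∈)   = lift (to-root es g v∈)

  child∈ : ∀ {r c p} es → (c , p) ∈ es → c ∈ verts r es
  child∈ (_ ∷ es) (hd refl) = hd refl
  child∈ (_ ∷ es) (tl q)    = tl (child∈ es q)

  parent∈ : ∀ {r c p} es → Grow r es → (c , p) ∈ es → p ∈ verts r es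
  parent∈ (_ ∷ es) (p∈ , _) (hd refl)        = tl p∈
  parent∈ (_ ∷ es) (_ , _ , _ , g) (tl q)    = tl (parent∈ es g q)

  -- Every end of an older edge is among the older vertices, and `c` is not.
  only-parent : ∀ {r c p es} → Grow r ((c , p) ∷ es) → ∀ {v} → Link ((c , p) ∷ es) c v → v ≡ p
  only-parent g (_ , inj₁ (hd refl)) = refl
  only-parent {es = es} (_ , c∉ , _) (_ , inj₁ (tl q)) = ⊥-elim (c∉ (child∈ es q))
  only-parent (_ , _ , c∼p , _) (_ , inj₂ (hd refl)) = refl
  only-parent {es = es} (_ , c∉ , _ , g) (_ , inj₂ (tl q)) = ⊥-elim (c∉ (parent∈ es g q))

  old-link : ∀ {c p es u v} → u ≢ c → v ≢ c → Link ((c , p) ∷ es) u v → Link es u v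
  old-link u≢c v≢c (e , inj₁ (hd refl)) = ⊥-elim (u≢c refl)
  old-link u≢c v≢c (e , inj₁ (tl q))    = e , inj₁ q
  old-link u≢c v≢c (e , inj₂ (hd refl)) = ⊥-elim (v≢c refl)
  old-link u≢c v≢c (e , inj₂ (tl q))    = e , inj₂ q

  module _ {H : Graph n} {k} (c : Fin (suc (suc (suc k))) → V)
    (along : ∀ (i : Fin (suc (suc k))) → c (inject₁ i) ∼[ H ] c (suc i)) (close : c (fromℕ (suc (suc k))) ∼[ H ] c zero) where

    private
      back : ∀ {u v} → u ∼[ H ] v → v ∼[ H ] u
      back {u} {v} e = trans (Graph.sym H v u) e

    cycle-neighbours : ∀ i → Σ (Fin (suc (suc (suc k)))) λ a → Σ (Fin (suc (suc (suc k)))) λ b → a ≢ b × c i ∼[ H ] c a × c i ∼[ H ] c b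
    cycle-neighbours zero = suc zero , fromℕ (suc (suc k)) , (λ ()) , along zero , back close
    cycle-neighbours (suc i) with view i
    ... | ‵fromℕ = inject₁ (fromℕ (suc k)) , zero , (λ ()) , back (along (fromℕ (suc k))) , close
    ... | ‵inject₁ j = inject₁ (inject₁ j) , suc (suc j) , apart , back (along (inject₁ j)) , along (suc j)
      where
      apart : inject₁ (inject₁ j) ≢ suc (suc j)
      apart e = m≢2+m (trans (≡-sym (trans (toℕ-inject₁ (inject₁ j)) (toℕ-inject₁ j))) (cong toℕ e))
        where
        m≢2+m : ∀ {m} → m ≢ suc (suc m)
        m≢2+m {zero}  ()
        m≢2+m {suc m} e = m≢2+m (suc-injective e)

  -- The newest vertex has a single neighbour, whereas a vertex on a cycle has two. So the cycle
  -- avoids it and lies among the older edges.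
  acyclic : ∀ {r} es → Grow r es → ¬ HasCycle (tree es)
  acyclic [] g (k , c , inj , along , close) with tree⇒link [] close
  ... | _ , inj₁ ()
  ... | _ , inj₂ ()
  acyclic ((x , p) ∷ es) g (k , c , inj , along , close) with any? (λ i → c i ≟ x)
  ... | yes (i , refl) with cycle-neighbours {H = tree ((x , p) ∷ es)} c along close i
  ...   | a , b , a≢b , ea , eb = a≢b (inj (trans (only-parent g (tree⇒link ((x , p) ∷ es) ea)) (≡-sym (only-parent g (tree⇒link ((x , p) ∷ es) eb)))))
  acyclic ((x , p) ∷ es) (_ , _ , _ , g) (k , c , inj , along , close) | no avoids =
    acyclic es g (k , c , inj , (λ i → restrict (along i)) , restrict close)
    where
    restrict : ∀ {i j} → c i ∼[ tree ((x , p) ∷ es) ] c j → c i ∼[ tree es ] c j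
    restrict {i} {j} e = link⇒tree es (old-link (λ q → avoids (i , q)) (λ q → avoids (j , q)) (tree⇒link ((x , p) ∷ es) e))

  spanning : ∀ {r es} → Grow r es → (∀ v → v ∈ verts r es) → IsSpanningTree (tree es) G
  spanning {r} {es} g all = (λ u v e → proj₁ (tree⇒link es e)) ,
    (λ u v → walk-trans (to-root es g (all u)) (walk-sym (to-root es g (all v)))) , acyclic es g

  -- The predicate counted by leaves, which Defs does not name.
  isLeaf : Graph n → V → Bool
  isLeaf H = predicate (leaves H) refl
    where
    predicate : ∀ {p : V → Bool} m → m ≡ count p → V → Bool
    predicate {p} _ _ = p

  isLeaf-deg : ∀ H u → isLeaf H u ≡ true → deg H u ≡ 1
  isLeaf-deg H u e with deg H u
  ... | suc zero = refl

  leaves-bound : ∀ H Z → (∀ u → deg H u ≡ 1 → u ∈ Z) → leaves H ≤ length Z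
  leaves-bound H Z h = subst₂ _≤_ (≡-sym (sum-allFin (bit ∘ isLeaf H))) (trans (∑-mult (λ _ → 1) Z) (W-one Z)) (∑-mono pointwise)
    where
    pointwise : ∀ u → bit (isLeaf H u) ≤ mult u Z * 1
    pointwise u with isLeaf H u in eq
    ... | false = z≤n
    ... | true  = subst (1 ≤_) (≡-sym (*-identityʳ _)) (∈⇒mult (h u (isLeaf-deg H u eq)))

  two-neighbours : ∀ (H : Graph n) {u a b} → a ≢ b → u ∼[ H ] a → u ∼[ H ] b → deg H u ≢ 1
  two-neighbours H {u} {a} {b} a≢b ea eb one = 1+n≰n (≤-trans two (≤-reflexive (trans (≡-sym (sum-allFin (bit ∘ adj H u))) one)))
    where
    two : 2 ≤ ∑ (bit ∘ adj H u)
    two = subst₂ (λ x y → x + y ≤ ∑ (bit ∘ adj H u)) (cong bit ea) (cong bit eb) (pair≤∑ (bit ∘ adj H u) a≢b)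

  SmallTree : V → List Edge → Set
  SmallTree r es = Grow r es × (∀ v → v ∈ verts r es) × leaves (tree es) ≤ 4

  small? : ∀ r es → Dec (SmallTree r es)
  small? r es = grow? r es ×-dec all? (λ v → v ∈? verts r es) ×-dec (leaves (tree es) ≤? 4)

  -- Only finitely many edges can stand in each place, so bounding the length makes the search
  -- finite.
  bounded? : {Q : List Edge → Set} → (∀ es → Dec (Q es)) → ∀ m → Dec (Σ (List Edge) λ es → length es ≤ m × Q es)
  bounded? Q? zero with Q? []
  ... | yes q = yes ([] , z≤n , q)
  ... | no ¬q = no λ { ([] , _ , q) → ¬q q }
  bounded? Q? (suc m) with Q? [] | any? (λ c → any? (λ p → bounded? (λ es → Q? ((c , p) ∷ es)) m))
  ... | yes q | _ = yes ([] , z≤n , q)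
  ... | no ¬q | yes (c , p , es , le , q) = yes ((c , p) ∷ es , s≤s le , q)
  ... | no ¬q | no none = no λ { ([] , _ , q) → ¬q q ; ((c , p) ∷ es , s≤s le , q) → none (c , p , es , le , q) }

  -- The edges of a configuration

  pairs : List V → List Edge
  pairs (x ∷ y ∷ xs) = (x , y) ∷ pairs (y ∷ xs)
  pairs _            = []

  pairs-mid : ∀ A {x y B} → (x , y) ∈ pairs (A ++ x ∷ y ∷ B)
  pairs-mid []          = hd refl
  pairs-mid (a ∷ [])    = tl (hd refl)
  pairs-mid (a ∷ b ∷ A) = tl (pairs-mid (b ∷ A))

  verts-leg : ∀ {r} l {z es} → verts r (pairs (l ++ z ∷ []) ++ es) ≡ l ++ verts r es
  verts-leg []          = refl
  verts-leg (x ∷ [])    = refl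
  verts-leg (x ∷ y ∷ l) = cong (x ∷_) (verts-leg (y ∷ l))

  -- A leg runs from its leaf to the spine, so the successor of each vertex is its parent and is
  -- already present.
  grow-leg : ∀ {r} l {z es} → Grow r es → z ∈ verts r es → Path (l ++ z ∷ []) → (∀ v → mult v (l ++ verts r es) ≤ 1) →
             Grow r (pairs (l ++ z ∷ []) ++ es)
  grow-leg [] g z∈ p u = g
  grow-leg {r} (x ∷ l) {z} {es} g z∈ p u = go l (λ q → grow-leg l g z∈ q (λ v → ≤-trans (m≤n+m _ (δ v x)) (u v))) p new
    where
    new : ¬ x ∈ l ++ verts r es
    new x∈ = 2≰1 (+-mono-≤ (≤-reflexive (≡-sym (δ-same x))) (∈⇒mult x∈)) (u x)
    go : ∀ l → (Path (l ++ z ∷ []) → Grow r (pairs (l ++ z ∷ []) ++ es)) → Path (x ∷ l ++ z ∷ []) → ¬ x ∈ l ++ verts r es →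
         Grow r (pairs (x ∷ l ++ z ∷ []) ++ es)
    go []      h (e , p) x∉ = z∈ , x∉ , e , h p
    go (y ∷ l) h (e , p) x∉ = subst (y ∈_) (≡-sym (verts-leg (y ∷ l))) (hd refl) ,
      (λ x∈ → x∉ (subst (x ∈_) (verts-leg (y ∷ l)) x∈)) , e , h p

  legEdges : ∀ {k} → (Fin k → List V) → (Fin k → V) → List Edge → List Edge
  legEdges {zero}  L at es = es
  legEdges {suc k} L at es = legEdges (L ∘ suc) (at ∘ suc) (pairs (L zero ++ at zero ∷ []) ++ es)

  legEdges-⊇ : ∀ {k} (L : Fin k → List V) at {es e} → e ∈ es → e ∈ legEdges L at es
  legEdges-⊇ {zero}  L at p = p
  legEdges-⊇ {suc k} L at p = legEdges-⊇ (L ∘ suc) (at ∘ suc) (∈-right (pairs (L zero ++ at zero ∷ [])) p)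

  legEdges-leg : ∀ {k} (L : Fin k → List V) at {es e} i → e ∈ pairs (L i ++ at i ∷ []) → e ∈ legEdges L at es
  legEdges-leg L at zero    p = legEdges-⊇ (L ∘ suc) (at ∘ suc) (∈-left p)
  legEdges-leg L at (suc i) p = legEdges-leg (L ∘ suc) (at ∘ suc) i p

  legEdges-mult : ∀ {k r} (L : Fin k → List V) at es v → mult v (verts r (legEdges L at es)) ≡ ∑ (mult v ∘ L) + mult v (verts r es)
  legEdges-mult {zero} L at es v = refl
  legEdges-mult {suc k} {r} L at es v = trans (legEdges-mult (L ∘ suc) (at ∘ suc) (pairs (L zero ++ at zero ∷ []) ++ es) v)
    (trans (cong (∑ (mult v ∘ L ∘ suc) +_) (trans (cong (mult v) (verts-leg (L zero))) (W-++ (δ v) (L zero))))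
      (solve 3 (λ s l e → s :+ (l :+ e) := (l :+ s) :+ e) refl (∑ (mult v ∘ L ∘ suc)) (mult v (L zero)) (mult v (verts r es))))

  grow-legs : ∀ {k r} (L : Fin k → List V) at es → Grow r es → (∀ i → at i ∈ verts r es) → (∀ i → Path (L i ++ at i ∷ [])) →
              (∀ v → ∑ (mult v ∘ L) + mult v (verts r es) ≤ 1) → Grow r (legEdges L at es)
  grow-legs {zero} L at es g at∈ p u = g
  grow-legs {suc k} {r} L at es g at∈ p u = grow-legs (L ∘ suc) (at ∘ suc) _
    (grow-leg (L zero) g (at∈ zero) (p zero) (λ v → ≤-trans (≤-reflexive (W-++ (δ v) (L zero)))
      (≤-trans (+-monoˡ-≤ (mult v (verts r es)) (m≤m+n (mult v (L zero)) (∑ (mult v ∘ L ∘ suc)))) (u v))))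
    (λ i → subst (at (suc i) ∈_) (≡-sym (verts-leg (L zero))) (∈-right (L zero) (at∈ (suc i))))
    (p ∘ suc)
    (λ v → ≤-trans (≤-reflexive (trans (cong (∑ (mult v ∘ L ∘ suc) +_) (trans (cong (mult v) (verts-leg (L zero))) (W-++ (δ v) (L zero))))
      (solve 3 (λ s l e → s :+ (l :+ e) := (l :+ s) :+ e) refl (∑ (mult v ∘ L ∘ suc)) (mult v (L zero)) (mult v (verts r es))))) (u v))

  module _ (T : Cfg 4) (all : ∀ v → In v T) where

    private
      -- Rooted at its last vertex, the spine can be added by `grow-leg` as though it were a leg.
      r : V
      r = at T (proj₁ (final T))

      A₀ : List V
      A₀ = proj₁ (proj₂ (final T))

      eP : P T ≡ A₀ ++ r ∷ []
      eP = proj₂ (proj₂ (final T))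

      es₀ es : List Edge
      es₀ = pairs (A₀ ++ r ∷ []) ++ []
      es  = legEdges (L T) (at T) es₀

      verts₀ : verts r es₀ ≡ P T
      verts₀ = trans (verts-leg A₀) (≡-sym eP)

      total-verts : ∀ v → mult v (verts r es) ≡ weight (δ v) T
      total-verts v = trans (legEdges-mult (L T) (at T) es₀ v)
        (trans (cong (λ xs → ∑ (mult v ∘ L T) + mult v xs) verts₀) (+-comm (∑ (mult v ∘ L T)) _))

      grown : Grow r es
      grown = grow-legs (L T) (at T) es₀
        (grow-leg A₀ tt (hd refl) (subst Path eP (P-path T))
          (λ v → ≤-trans (≤-reflexive (cong (mult v) (≡-sym eP))) (≤-trans (m≤m+n _ _) (simple T v))))
        (λ i → subst (at T i ∈_) (≡-sym verts₀) (at∈P T i)) (L-path T)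
        (λ v → ≤-trans (≤-reflexive (trans (cong (λ xs → ∑ (mult v ∘ L T) + mult v xs) verts₀) (+-comm (∑ (mult v ∘ L T)) _))) (simple T v))

      covers : ∀ v → v ∈ verts r es
      covers v = mult⇒∈ (verts r es) (subst (1 ≤_) (≡-sym (total-verts v)) (all v))

      spine-link : ∀ A {x y B} → P T ≡ A ++ x ∷ y ∷ B → Link es x y
      spine-link A {x} {y} {B} e = path-edge A (subst Path e (P-path T)) ,
        inj₁ (legEdges-⊇ (L T) (at T) (∈-left (subst (λ xs → (x , y) ∈ pairs xs) (trans (≡-sym e) eP) (pairs-mid A))))

      leg-link : ∀ i A {x y B} → L T i ++ at T i ∷ [] ≡ A ++ x ∷ y ∷ B → Link es x y
      leg-link i A {x} {y} e = path-edge A (subst Path e (L-path T i)) ,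
        inj₁ (legEdges-leg (L T) (at T) i (subst (λ xs → (x , y) ∈ pairs xs) (≡-sym e) (pairs-mid A)))

      last-link : ∀ i {A s} → L T i ≡ A ++ s ∷ [] → Link es (at T i) s
      last-link i {A} e = link-sym (leg-link i A (trans (cong (_++ at T i ∷ []) e) (++-assoc A _ _)))

      tip : Fin 4 → V
      tip i = go (L T i)
        where
        go : List V → V
        go []      = at T i
        go (x ∷ _) = x

      tip-empty : ∀ i → L T i ≡ [] → tip i ≡ at T i
      tip-empty i e rewrite e = refl

      tip-head : ∀ i {x B} → L T i ≡ x ∷ B → tip i ≡ x
      tip-head i e rewrite e = refl

      tips : List V
      tips = tip 0F ∷ tip 1F ∷ tip 2F ∷ tip 3F ∷ []

      tip∈ : ∀ i → tip i ∈ tips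
      tip∈ 0F = hd refl
      tip∈ 1F = tl (hd refl)
      tip∈ 2F = tl (tl (hd refl))
      tip∈ 3F = tl (tl (tl (hd refl)))

      -- Two distinct neighbours exclude degree one, so this alternative places every leaf among the
      -- four tips.
      TipOrTwo : V → Set
      TipOrTwo v = v ∈ tips ⊎ Σ V λ a → Σ V λ b → a ≢ b × Link es v a × Link es v b

      at-leg : ∀ i → at T i ∈ tips ⊎ Σ V λ s → s ∈ L T i × Link es (at T i) s
      at-leg i = go (unsnoc (L T i))
        where
        go : L T i ≡ [] ⊎ (Σ (List V) λ A → Σ V λ s → L T i ≡ A ++ s ∷ []) → at T i ∈ tips ⊎ Σ V λ s → s ∈ L T i × Link es (at T i) s
        go (inj₁ e)           = inj₁ (subst (_∈ tips) (tip-empty i e) (tip∈ i))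
        go (inj₂ (A , s , e)) = inj₂ (s , subst (s ∈_) (≡-sym e) (∈-mid A) , last-link i e)

      -- An end of the spine: a neighbour in its leg, and another one in the spine or in a second leg.
      at-end : ∀ i → (Σ V λ q → q ∈ P T × Link es (at T i) q) ⊎ (Σ (Fin 4) λ j → j ≢ i × at T j ≡ at T i) → TipOrTwo (at T i)
      at-end i other = go (at-leg i) other
        where
        Leg : Fin 4 → Set
        Leg i = at T i ∈ tips ⊎ Σ V λ s → s ∈ L T i × Link es (at T i) s
        second : ∀ {s} → s ∈ L T i → Link es (at T i) s → ∀ j → j ≢ i → at T j ≡ at T i → Leg j → TipOrTwo (at T i)
        second s∈ ls j j≢i e (inj₁ t) = inj₁ (subst (_∈ tips) e t)
        second s∈ ls j j≢i e (inj₂ (s′ , s′∈ , ls′)) = inj₂ (_ , s′ , leg≢leg T (j≢i ∘ ≡-sym) s∈ s′∈ , ls , subst (λ z → Link es z s′) e ls′)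
        go : Leg i → (Σ V λ q → q ∈ P T × Link es (at T i) q) ⊎ (Σ (Fin 4) λ j → j ≢ i × at T j ≡ at T i) → TipOrTwo (at T i)
        go (inj₁ t) _ = inj₁ t
        go (inj₂ (s , s∈ , ls)) (inj₁ (q , q∈ , lq)) = inj₂ (s , q , leg≢spine T s∈ q∈ , ls , lq)
        go (inj₂ (s , s∈ , ls)) (inj₂ (j , j≢i , e)) = second s∈ ls j j≢i e (at-leg j)

      on-spine : ∀ A v B → P T ≡ A ++ v ∷ B → TipOrTwo v
      on-spine A v B e = go (unsnoc A) B e
        where
        at∈ : ∀ {B} A → P T ≡ A ++ B → ∀ {z} → z ∈ B → z ∈ P T
        at∈ A e p = subst (_ ∈_) (≡-sym e) (∈-right A p)
        go : (A ≡ [] ⊎ Σ (List V) λ A′ → Σ V λ p → A ≡ A′ ++ p ∷ []) → ∀ B → P T ≡ A ++ v ∷ B → TipOrTwo v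
        go (inj₁ refl) B e = first-vertex B e (first T)
          where
          first-vertex : ∀ B → P T ≡ v ∷ B → (Σ (Fin 4) λ i → Head (P T) (at T i)) → TipOrTwo v
          first-vertex B e (i , C , e′) with ∷-injectiveˡ (trans (≡-sym e) e′)
          first-vertex [] e (i , C , e′) | refl = at-end i (inj₂ (punchIn i zero , punchInᵢ≢i i zero , alone (subst (at T (punchIn i zero) ∈_) e (at∈P T (punchIn i zero)))))
            where
            alone : ∀ {x y : V} → x ∈ y ∷ [] → x ≡ y
            alone (hd p) = p
          first-vertex (q ∷ B) e (i , C , e′) | refl = at-end i (inj₁ (q , at∈ [] e (tl (hd refl)) , spine-link [] e))
        go (inj₂ (A′ , p , refl)) [] e = last-vertex (final T)
          where
          e″ : P T ≡ A′ ++ p ∷ v ∷ []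
          e″ = trans e (++-assoc A′ _ _)
          last-vertex : (Σ (Fin 4) λ i → Last (P T) (at T i)) → TipOrTwo v
          last-vertex (i , C , e′) = subst TipOrTwo (≡-sym v≡) (at-end i (inj₁ (p , at∈ A′ e″ (hd refl) , link-sym (subst (Link es p) v≡ (spine-link A′ e″)))))
            where
            v≡ : v ≡ at T i
            v≡ = ∷ʳ-injectiveʳ (A′ ++ p ∷ []) C (trans (≡-sym e) e′)
        go (inj₂ (A′ , p , refl)) (q ∷ B) e = inj₂ (p , q , apart , link-sym (spine-link A′ e″) , spine-link (A′ ++ p ∷ []) e)
          where
          e″ : P T ≡ A′ ++ p ∷ v ∷ q ∷ B
          e″ = trans e (++-assoc A′ _ _)
          apart : p ≢ q
          apart p≡q = spine-distinct T {A′} e″ (inj₂ (tl (hd refl))) (≡-sym p≡q)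

      on-leg : ∀ i A v B → L T i ≡ A ++ v ∷ B → TipOrTwo v
      on-leg i A v B e = go (unsnoc A) B e
        where
        go : (A ≡ [] ⊎ Σ (List V) λ A′ → Σ V λ p → A ≡ A′ ++ p ∷ []) → ∀ B → L T i ≡ A ++ v ∷ B → TipOrTwo v
        go (inj₁ refl) B e = inj₁ (subst (_∈ tips) (tip-head i e) (tip∈ i))
        go (inj₂ (A′ , p , refl)) B e = next B e₁
          where
          e₁ : L T i ≡ A′ ++ p ∷ v ∷ B
          e₁ = trans e (++-assoc A′ _ _)
          p∈ : p ∈ L T i
          p∈ = subst (p ∈_) (≡-sym e₁) (∈-mid A′)
          next : ∀ B → L T i ≡ A′ ++ p ∷ v ∷ B → TipOrTwo v
          next [] e = inj₂ (p , at T i , leg≢spine T p∈ (at∈P T i) ,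
            link-sym (leg-link i A′ (trans (cong (_++ at T i ∷ []) e) (++-assoc A′ _ _))) ,
            link-sym (last-link i {A′ ++ p ∷ []} (trans e (≡-sym (++-assoc A′ _ _)))))
          next (q ∷ B) e = inj₂ (p , q , (λ p≡q → leg-distinct T i {A′} e (inj₂ (tl (hd refl))) (≡-sym p≡q)) ,
            link-sym (leg-link i A′ (trans (cong (_++ at T i ∷ []) e) (++-assoc A′ _ _))) ,
            leg-link i (A′ ++ p ∷ []) (trans (cong (_++ at T i ∷ []) (trans e (≡-sym (++-assoc A′ _ _)))) (++-assoc (A′ ++ p ∷ []) _ _)))

      tip-or-two : ∀ v → TipOrTwo v
      tip-or-two v = go (In⇒∈ T (all v))
        where
        go : v ∈ P T ⊎ Σ (Fin 4) (λ i → v ∈ L T i) → TipOrTwo v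
        go (inj₁ p)       = let (A , B , e) = split-∈ p in on-spine A v B e
        go (inj₂ (i , p)) = let (A , B , e) = split-∈ p in on-leg i A v B e

      few-leaves : leaves (tree es) ≤ 4
      few-leaves = leaves-bound (tree es) tips (λ u one → go u one (tip-or-two u))
        where
        go : ∀ u → deg (tree es) u ≡ 1 → TipOrTwo u → u ∈ tips
        go u one (inj₁ t) = t
        go u one (inj₂ (a , b , a≢b , la , lb)) = ⊥-elim (two-neighbours (tree es) a≢b (link⇒tree es la) (link⇒tree es lb) one)

      short : length es ≤ n
      short = ≤-trans (m≤m+n _ 1) (≤-trans (≤-reflexive lengths) (≤-trans (≤-reflexive weights) (size≤n T)))
        where
        lengths : length es + 1 ≡ length (verts r es)
        lengths = trans (cong (_+ 1) (≡-sym (length-map proj₁ es))) (≡-sym (length-++ (map proj₁ es)))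
        weights : length (verts r es) ≡ size T
        weights = trans (≡-sym (W-one (verts r es))) (trans (≡-sym (∑-mult (λ _ → 1) (verts r es)))
          (trans (sum-cong-≗ (λ v → cong (_* 1) (total-verts v))) (weight-∑ (λ _ → 1) T)))

    small-tree : Σ V λ r → Σ (List Edge) λ es → length es ≤ n × SmallTree r es
    small-tree = r , es , short , grown , covers , few-leaves

theorem1p9 : (n : ℕ) (G : Graph n) → Connected G → K1r-free G 5 →
    σ≥ G 5 (n ∸ 1) →
    Σ (Graph n) (λ T → IsSpanningTree T G × leaves T ≤ 4)
-- Without a vertex there is no configuration to start from, but the empty graph is its own spanning
-- tree.
theorem1p9 zero G conn free dense = G , ((λ _ _ e → e) , conn , λ { (_ , c , _) → no-vertex (c zero) }) , z≤n
  where
  no-vertex : ¬ Fin 0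
  no-vertex ()
theorem1p9 (suc m) G conn free dense = go (any? (λ r → bounded? (small? r) (suc m)))
  where
  open Configurations G
  -- One vertex carrying four empty legs.
  start : Cfg 4
  start = record
    { P = zero ∷ [] ; L = λ _ → [] ; at = λ _ → zero ; P-path = tt ; L-path = λ _ → tt ; at∈P = λ _ → hd refl
    ; first = zero , [] , refl ; final = zero , [] , refl
    ; simple = λ { zero → s≤s z≤n ; (suc _) → z≤n } }
  go : Dec (Σ (Fin (suc m)) λ r → Σ (List Edge) λ es → length es ≤ suc m × SmallTree r es) →
       Σ (Graph (suc m)) (λ T → IsSpanningTree T G × leaves T ≤ 4)
  go (yes (r , es , _ , grown , all , few)) = tree es , spanning grown all , few
  -- If the search fails, no four-leg configuration spans, and this is the assumption that `Growth`
  -- refutes.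
  go (no none) = ⊥-elim (Growth.no-tree conn free dense (λ T all → none (small-tree T all)) start)
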